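{- Let $\mathcal A$ be a gargantuan (weighted) species of structures that can be represented as $\mathcal A=\mathcal E\circ\mathcal B$ for some (weighted) species of structures $\mathcal B$, where $\mathcal E$ is the species of sets. Assume that $m,n\in\mathbb Z_{\ge 0}$, and $s\in\mathcal A$ is a random $\mathcal A$-structure on $[n]$. In this case, $$\mathbb P\big(s\in\mathcal B^{\{m\}}\big)\approx\sum_{k\ge 0}\mathfrak d_{k,m}\cdot\binom nk\cdot\frac{\mathfrak a_{n-k}}{\mathfrak a_n},$$ where $\mathfrak a_n$ and $\mathfrak d_{n,m}$ are the total weights on the set $[n]$ of the species of structures $\mathcal A$ and $\mathcal D(m)=\mathcal B^{\{m-1\}}\cdot(\mathcal E^{ -1}\circ\mathcal B)$, respectively.
   Context: A species of structures $F$ assigns to each finite set $U$ a finite set $F[U]$ of structures and to each bijection $\sigma:U\to V$ a map $F[\sigma]:F[U]\to F[V]$, functorially ($F[\tau\circ\sigma]=F[\tau]\circ F[\sigma]$, $F[\mathrm{Id}_U]=\mathrm{Id}_{F[U]}$). In a weighted species every structure $s$ carries a weight $w(s)$, taken in a ring of formal power series with coefficients in an integral domain ($\mathbb Z$ or $\mathbb R$), preserved by transport, and $F[U]$ is finite or summable. An unweighted species has all weights $1$. Write $[n]=\{1,\dots,n\}$, $[0]=\emptyset$, $F[n]=F[[n]]$. The total weight of $F$ on $[n]$ is $|F[n]|_w=\sum_{s\in F[n]}w(s)$. When all weights are positive, $F[n]$ is endowed with the discrete probability in which a structure $s$ appears with probability $w(s)/|F[n]|_w$ (uniform probability if the species is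 unweighted); $\mathbb P(s\in\cdot)$ denotes the resulting sequence of probabilities indexed by $n$ (for those $n$ with $F[n]$ nonempty). Equality of species means isomorphism (natural and weight-preserving). $\mathcal E$ is the species of sets ($\mathcal E[U]=\{U\}$), $\mathcal E_m$ is its restriction to sets of cardinality $m$, and $\mathcal E_+$ is its restriction to nonempty sets. For $\mathcal B$ with $\mathcal B[\emptyset]=\emptyset$, an $(F\circ\mathcal B)$-structure on $U$ consists of a partition $\pi$ of $U$, an $F$-structure on the set $\pi$, and a $\mathcal B$-structure on each block of $\pi$; its weight is the product of the weights of its components. Put $\mathcal B^{\{m\}}=\mathcal E_m\circ\mathcal B$, the subspecies of $\mathcal A=\mathcal E\circ\mathcal B$ whose structures have exactly $m$ connected components ($\mathcal B$-structures being the connected ones). The product $F\cdot G$ is the species of ordered pairs (an $F$-structure on $U_1$, a $G$-structure on $U_2$) with $U_1\sqcup U_2=U$, the weight being the product of weights. Virtual species are formal differences of species (the ring extension of the semiring of species under sum and product, to which composition also extends); total weights extend by linearity. $\mathcal E^{ -1}=\sum_{k\ge0}(-1)^k(\mathcal E_+)^k$ is the multiplicative inverse of $\mathcal E$ among virtual species. A sequence $(a_n)$ is gargantuan if (i) $a_{n-1}/a_n\to0$ as $n\to\infty$ and (ii) for each $r\in\mathbb Z_{\ge0}$, $\sum_{k=r}^{n-r}|a_ka_{n-k}|=O(a_{n-r})$. A (virtual, weighted) species $F$ is gargantuan if the sequence $a_n=(\text{total weight of }F\text{ on }[n])/n!$ is gargantuan; in particular it is assumed that $a_n\neq0$ for almost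 all $n\in\mathbb Z_{\ge0}$. Notation $\approx$: for a sequence $(x_n)$ and an integer $\ell$, $x_n\approx\sum_{k\ge \ell}f_k(n)$ means that for every integer $r\ge \ell$, $x_n=\sum_{k=\ell}^{r}f_k(n)+O\big(f_{r+1}(n)\big)$, and for every integer $k\ge \ell$, $f_{k+1}(n)=o\big(f_k(n)\big)$, as $n\to\infty$. Here $f_k(n)=\mathfrak d_{k,m}\binom nk\frac{\mathfrak a_{n-k}}{\mathfrak a_n}$, $k\ge0$.
   Formalization: Literally, ≈ fails if some 𝔡_{k,m}=0 (simple graphs, m=1: 𝔡_2=0, 𝔡_3=-2). Here errors and term order are relative to C(n,k)𝔞_{n-k}/𝔞_n for all k, and to the terms themselves where the coefficient is nonzero. Weights lie in any Archimedean ordered field. -}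

module Defs where

open import Level using (Level; 0ℓ; _⊔_) renaming (suc to lsuc)
open import Algebra.Bundles using (CommutativeRing)
import Algebra.Definitions.RawMonoid as RawMonoid
open import Data.Bool using (Bool; true; false; if_then_else_)
import Data.Bool.Properties as Bool
open import Data.Empty using (⊥; ⊥-elim)
open import Data.Fin using (Fin)
import Data.Fin.Properties as Fin
open import Data.Integer using (ℤ; +_; 1ℤ) renaming (_-_ to _-ℤ_; _≟_ to _≟ℤ_)
open import Data.List using (List; []; _∷_; map; _++_; length; foldr; filter; concatMap; cartesianProduct;
  deduplicate; allFin; upTo; applyUpTo)
open import Data.List.Properties using (length-map)
open import Data.List.Relation.Unary.All as All using (All; []; _∷_)
open import Data.List.Relation.Unary.Any as Any using (Any; here; there)
import Data.List.Relation.Unary.Any.Properties as Any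
open import Data.List.Relation.Unary.AllPairs using ([]; _∷_)
open import Data.List.Membership.Propositional.Properties using (∈-allFin; ∈-upTo⁺)
import Data.List.Membership.Setoid as Membership
import Data.List.Membership.Setoid.Properties as Membershipₚ
import Data.List.Relation.Binary.Permutation.Setoid as Permutation
import Data.List.Relation.Binary.Permutation.Setoid.Properties as Permutationₚ
import Data.List.Relation.Unary.Unique.Setoid as Unique
import Data.List.Relation.Unary.Unique.Setoid.Properties as Uniqueₚ
open import Data.List.Relation.Unary.Unique.DecSetoid.Properties using (deduplicate-!)
open import Data.Nat as ℕ using (ℕ; zero; suc; z≤n; s≤s; _∸_; _!)
import Data.Nat.Properties as ℕ
open import Data.Nat.Combinatorics using (_C_)
open import Data.Product using (Σ; ∃; ∃-syntax; Σ-syntax; _×_; _,_; proj₁; proj₂)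
open import Data.Product.Relation.Binary.Pointwise.NonDependent using (×-decSetoid)
open import Data.Unit using (⊤; tt)
open import Function.Base using (_∘_; id)
open import Function.Bundles using (Inverse)
import Function.Construct.Composition as Compose
import Function.Construct.Identity as Identity
open import Relation.Binary using (Rel; DecSetoid; Setoid; Decidable; DecidableEquality; IsStrictTotalOrder)
import Relation.Binary.Construct.StrictToNonStrict as StrictToNonStrict
open import Relation.Binary.PropositionalEquality as ≡ using (_≡_; refl)
open import Relation.Nullary using (Dec; yes; no; ¬_; does; ¬?)
import Relation.Nullary.Decidable as Dec

-- A finite set is a set with decidable equality together with a list
-- (possibly with repetitions) of all its elements.

record FinSet : Set₁ where
  field
    decSetoid : DecSetoid 0ℓ 0ℓ
  open DecSetoid decSetoid public
    renaming (refl to ≈-refl; sym to ≈-sym; trans to ≈-trans)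
  open Membership setoid public using (_∈_)
  field
    enum     : List Carrier
    complete : ∀ x → x ∈ enum

  -- every element exactly once
  elements : List Carrier
  elements = deduplicate _≟_ enum

  card : ℕ
  card = length elements

  elements-unique : Unique.Unique setoid elements
  elements-unique = deduplicate-! decSetoid enum

  elements-complete : ∀ x → x ∈ elements
  elements-complete x =
    Membershipₚ.∈-deduplicate⁺ setoid _≟_ (λ y≈z z≈x → ≈-trans z≈x (≈-sym y≈z) ) (complete x)

open FinSet using (Carrier; elements; card)

infix 4 _≅_

record _≅_ (U V : FinSet) : Set where
  field
    inverse : Inverse (FinSet.setoid U) (FinSet.setoid V)
  open Inverse inverse public using (to; from; to-cong; from-cong; inverseˡ; inverseʳ)

open _≅_ using (to; from; to-cong; from-cong)

-- The set written [n] in the literature, labelled here by 0,…,n−1.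
⟦_⟧ : ℕ → FinSet
⟦ n ⟧ = record
  { decSetoid = Fin.≡-decSetoid n ; enum = allFin n ; complete = ∈-allFin }

idᵇ : ∀ {U} → U ≅ U
idᵇ {U} = record { inverse = Identity.inverse (FinSet.setoid U) }

infixr 9 _∘ᵇ_
_∘ᵇ_ : ∀ {U V W} → V ≅ W → U ≅ V → U ≅ W
τ ∘ᵇ σ = record { inverse = Compose.inverse (_≅_.inverse σ) (_≅_.inverse τ) }

module _ {U V : FinSet} (σ : U ≅ V) where
  private
    module U = FinSet U
    module V = FinSet V

  to-from : ∀ y → to σ (from σ y) V.≈ y
  to-from y = _≅_.inverseˡ σ U.≈-refl

  from-to : ∀ x → from σ (to σ x) U.≈ x
  from-to x = _≅_.inverseʳ σ V.≈-refl

  to-injective : ∀ {x y} → to σ x V.≈ to σ y → x U.≈ y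
  to-injective {x} {y} p =
    U.≈-trans (U.≈-sym (from-to x)) (U.≈-trans (from-cong σ p) (from-to y))

from-≈ : ∀ {U V} (σ τ : U ≅ V) → (∀ x → FinSet._≈_ V (to σ x) (to τ x)) →
         ∀ y → FinSet._≈_ U (from σ y) (from τ y)
from-≈ {U} {V} σ τ e y = to-injective σ
  (FinSet.≈-trans V (to-from σ y)
    (FinSet.≈-trans V (FinSet.≈-sym V (to-from τ y)) (FinSet.≈-sym V (e (from τ y)))))

module _ (S : Setoid 0ℓ 0ℓ) where
  open Setoid S renaming (refl to ≈-refl; sym to ≈-sym; trans to ≈-trans) hiding (Carrier)
  open Membership S using (_∈_)
  open Permutation S using (_↭_; ↭-sym; ↭-trans; ↭-prep; ↭-refl; ↭-reflexive-≋)
  open Permutationₚ S using (↭-shift; ∈-resp-↭; Unique-resp-↭; xs↭ys⇒|xs|≡|ys|)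
  open Unique S using (Unique)

  ∈⇒↭ : ∀ {x ys} → x ∈ ys → ∃ λ zs → ys ↭ x ∷ zs
  ∈⇒↭ x∈ys with Membershipₚ.∈-∃++ S x∈ys
  ... | as , bs , w , x≈w , eq =
    as ++ bs ,
    ↭-trans (↭-reflexive-≋ eq) (↭-trans (↭-shift as bs) (Permutation.prep (≈-sym x≈w) ↭-refl))

  private
    ∈-tail : ∀ {x ys zs} → ys ↭ x ∷ zs → ∀ {z} → ¬ x ≈ z → z ∈ ys → z ∈ zs
    ∈-tail π x≉z z∈ys with ∈-resp-↭ π z∈ys
    ... | here z≈x   = ⊥-elim (x≉z (≈-sym z≈x))
    ... | there z∈zs = z∈zs

    ∉-head : ∀ {x zs} → All (λ y → ¬ x ≈ y) zs → ∀ {z} → z ∈ zs → ¬ x ≈ z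
    ∉-head (x≉y ∷ _)  (here z≈y) x≈z = x≉y (≈-trans x≈z z≈y)
    ∉-head (_ ∷ x≉zs) (there z∈) x≈z = ∉-head x≉zs z∈ x≈z

  length-⊆ : ∀ {xs ys} → Unique xs → (∀ {z} → z ∈ xs → z ∈ ys) → length xs ℕ.≤ length ys
  length-⊆ [] _ = z≤n
  length-⊆ {x ∷ xs} {ys} (x≉xs ∷ uxs) xs⊆ys with ∈⇒↭ (xs⊆ys (here ≈-refl))
  ... | zs , π = ≡.subst (suc (length xs) ℕ.≤_) (≡.sym (xs↭ys⇒|xs|≡|ys| π))
    (s≤s (length-⊆ uxs λ z∈xs → ∈-tail π (∉-head x≉xs z∈xs) (xs⊆ys (there z∈xs))))

  unique-↭ : ∀ {xs ys} → Unique xs → Unique ys →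
             (∀ {z} → z ∈ xs → z ∈ ys) → (∀ {z} → z ∈ ys → z ∈ xs) → xs ↭ ys
  unique-↭ {ys = []} [] _ _ _ = ↭-refl
  unique-↭ {ys = y ∷ _} [] _ _ ys⊆xs with () ← ys⊆xs (here ≈-refl)
  unique-↭ {x ∷ xs} {ys} (x≉xs ∷ uxs) uys xs⊆ys ys⊆xs with ∈⇒↭ (xs⊆ys (here ≈-refl))
  ... | zs , π with Unique-resp-↭ π uys
  ... | x≉zs ∷ uzs = ↭-trans (↭-prep x (unique-↭ uxs uzs xs⊆zs zs⊆xs)) (↭-sym π)
    where
    xs⊆zs : ∀ {z} → z ∈ xs → z ∈ zs
    xs⊆zs z∈xs = ∈-tail π (∉-head x≉xs z∈xs) (xs⊆ys (there z∈xs))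
    zs⊆xs : ∀ {z} → z ∈ zs → z ∈ xs
    zs⊆xs z∈zs with ys⊆xs (∈-resp-↭ (↭-sym π) (there z∈zs))
    ... | here z≈x   = ⊥-elim (∉-head x≉zs z∈zs (≈-sym z≈x))
    ... | there z∈xs = z∈xs

module _ {U V : FinSet} (σ : U ≅ V) where
  private
    module U = FinSet U
    module V = FinSet V

  elements-↭ : Permutation._↭_ V.setoid (map (to σ) U.elements) V.elements
  elements-↭ = unique-↭ V.setoid
    (Uniqueₚ.map⁺ U.setoid V.setoid (to-injective σ) U.elements-unique) V.elements-unique
    (λ {z} _ → V.elements-complete z)
    (λ {z} _ → Membershipₚ.∈-resp-≈ V.setoid (to-from σ z)
      (Membershipₚ.∈-map⁺ U.setoid V.setoid (to-cong σ) (U.elements-complete (from σ z))))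

  card-≅ : card U ≡ card V
  card-≅ = ≡.trans (≡.sym (length-map (to σ) U.elements))
                   (Permutationₚ.xs↭ys⇒|xs|≡|ys| V.setoid elements-↭)

unique⇒≤card : ∀ U {xs} → Unique.Unique (FinSet.setoid U) xs → length xs ℕ.≤ card U
unique⇒≤card U uxs = length-⊆ (FinSet.setoid U) uxs λ {z} _ → FinSet.elements-complete U z

infixr 2 _×ᶠ_
_×ᶠ_ : FinSet → FinSet → FinSet
U ×ᶠ V = record
  { decSetoid = ×-decSetoid U.decSetoid V.decSetoid
  ; enum      = cartesianProduct U.enum V.enum
  ; complete  = λ (x , y) →
      Membershipₚ.∈-cartesianProduct⁺ U.setoid V.setoid (U.complete x) (V.complete y)
  }
  where
  module U = FinSet U
  module V = FinSet V

𝔹 : FinSet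
𝔹 = record
  { decSetoid = Bool.≡-decSetoid
  ; enum      = true ∷ false ∷ []
  ; complete  = λ { true → here refl ; false → there (here refl) }
  }

-- The set with one element if P holds, and with none otherwise.
truth : {P : Set} → Dec P → FinSet
truth {P} P? = record
  { decSetoid = record
    { Carrier = P ; _≈_ = λ _ _ → ⊤
    ; isDecEquivalence = record
      { isEquivalence = record { refl = tt ; sym = λ _ → tt ; trans = λ _ _ → tt }
      ; _≟_ = λ _ _ → yes tt } }
  ; enum     = proofs P?
  ; complete = found P?
  }
  where
  proofs : Dec P → List P
  proofs (yes p) = p ∷ []
  proofs (no _)  = []
  found : (d : Dec P) → P → Any (λ _ → ⊤) (proofs d)
  found (yes _) _ = here tt
  found (no ¬p) p = ⊥-elim (¬p p)

module _ (U : FinSet) {P : Carrier U → Set}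
         (resp : ∀ {x y} → FinSet._≈_ U x y → P x → P y) (P? : ∀ x → Dec (P x)) where
  open FinSet U hiding (Carrier; elements; card)

  all? : Dec (∀ x → P x)
  all? = Dec.map′
    (λ ps x → All.lookupₛ setoid resp ps (complete x)) (λ p → All.universal p enum)
    (All.all? P? enum)

  sub : FinSet
  sub = record
    { decSetoid = record
      { Carrier = Σ (Carrier U) P
      ; _≈_ = λ u v → proj₁ u ≈ proj₁ v
      ; isDecEquivalence = record
        { isEquivalence = record { refl = ≈-refl ; sym = ≈-sym ; trans = ≈-trans }
        ; _≟_ = λ u v → proj₁ u ≟ proj₁ v } }
    ; enum     = select enum
    ; complete = λ u → select-complete u (complete (proj₁ u))
    }
    where
    select : List (Carrier U) → List (Σ (Carrier U) P)
    select [] = []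
    select (x ∷ xs) with P? x
    ... | yes p = (x , p) ∷ select xs
    ... | no  _ = select xs
    select-complete : ∀ (u : Σ (Carrier U) P) {xs} → proj₁ u ∈ xs →
                      Any (λ v → proj₁ u ≈ proj₁ v) (select xs)
    select-complete (y , q) {x ∷ xs} y∈ with P? x | y∈
    ... | yes p | here y≈x  = here y≈x
    ... | yes p | there y∈′ = there (select-complete (y , q) y∈′)
    ... | no ¬p | here y≈x  = ⊥-elim (¬p (resp y≈x q))
    ... | no ¬p | there y∈′ = select-complete (y , q) y∈′

-- A family of finite sets over a set: equal indices have canonically
-- isomorphic fibres.
record Family (I : DecSetoid 0ℓ 0ℓ) : Set₁ where
  open DecSetoid I using () renaming (Carrier to Index; _≈_ to _≈ᴵ_)
  field
    fib : Index → FinSet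
    tr  : ∀ {i j} → i ≈ᴵ j → Carrier (fib i) → Carrier (fib j)
    tr-cong : ∀ {i j} (p : i ≈ᴵ j) {x y} → FinSet._≈_ (fib i) x y →
              FinSet._≈_ (fib j) (tr p x) (tr p y)
    tr-id   : ∀ {i} (p : i ≈ᴵ i) x → FinSet._≈_ (fib i) (tr p x) x
    tr-∘    : ∀ {i j k} (p : i ≈ᴵ j) (q : j ≈ᴵ k) (r : i ≈ᴵ k) x →
              FinSet._≈_ (fib k) (tr q (tr p x)) (tr r x)

constant : ∀ I → FinSet → Family I
constant I V = record
  { fib = λ _ → V ; tr = λ _ x → x ; tr-cong = λ _ p → p
  ; tr-id = λ _ _ → FinSet.≈-refl V ; tr-∘ = λ _ _ _ _ → FinSet.≈-refl V }

-- Dependent sums.  The index set itself may be infinite, as long as only the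
-- indices in the list support have a nonempty fibre.
module _ (I : DecSetoid 0ℓ 0ℓ) (A : Family I) (support : List (DecSetoid.Carrier I))
         (supported : ∀ i → Carrier (Family.fib A i) → Membership._∈_ (DecSetoid.setoid I) i support)
         where
  open DecSetoid I using (setoid; _≈_; _≟_)
    renaming (Carrier to Index; refl to ≈-refl; sym to ≈-sym; trans to ≈-trans)
  open Family A
  private
    module Fib (i : Index) = FinSet (fib i)

    tr-irr : ∀ {i j} (p q : i ≈ j) x → Fib._≈_ j (tr p x) (tr q x)
    tr-irr {j = j} p q x =
      Fib.≈-trans j (Fib.≈-sym j (tr-id ≈-refl (tr p x))) (tr-∘ p ≈-refl q x)

  infix 4 _≈∑_
  _≈∑_ : Rel (Σ Index λ i → Carrier (fib i)) 0ℓ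
  (i , x) ≈∑ (j , y) = Σ[ p ∈ i ≈ j ] Fib._≈_ j (tr p x) y

  ∑-decSetoid : DecSetoid 0ℓ 0ℓ
  ∑-decSetoid = record
    { Carrier = Σ Index λ i → Carrier (fib i)
    ; _≈_ = _≈∑_
    ; isDecEquivalence = record
      { isEquivalence = record
        { refl  = λ { {i , x} → ≈-refl , tr-id ≈-refl x }
        ; sym   = λ { {i , x} {j , y} (p , q) → ≈-sym p ,
            Fib.≈-trans i (tr-cong (≈-sym p) (Fib.≈-sym j q))
              (Fib.≈-trans i (tr-∘ p (≈-sym p) ≈-refl x) (tr-id ≈-refl x)) }
        ; trans = λ { {i , x} {j , y} {k , z} (p , q) (p′ , q′) → ≈-trans p p′ ,
            Fib.≈-trans k (Fib.≈-sym k (tr-∘ p p′ _ x)) (Fib.≈-trans k (tr-cong p′ q) q′) }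
        }
      ; _≟_ = _≟∑_ } }
    where
    _≟∑_ : Decidable _≈∑_
    (i , x) ≟∑ (j , y) with i ≟ j
    ... | no i≉j = no (i≉j ∘ proj₁)
    ... | yes p = Dec.map′ (p ,_) (λ (q , e) → Fib.≈-trans j (tr-irr p q x) e)
                    (Fib._≟_ j (tr p x) y)

  ∑-finSet : FinSet
  ∑-finSet = record
    { decSetoid = ∑-decSetoid
    ; enum      = concatMap (λ i → map (i ,_) (Fib.enum i)) support
    ; complete  = λ (i , x) → Membershipₚ.∈-concatMap⁺ setoid (DecSetoid.setoid ∑-decSetoid)
        (Any.map (λ {j} p → Any.map⁺ (Any.map (p ,_) (Fib.complete j (tr p x))))
          (supported i x))
    }

module _ (I : FinSet) (A : Family (FinSet.decSetoid I)) where
  open FinSet I using (_≈_; _≟_; _∈_; ≈-refl; ≈-sym; ≈-trans) renaming (Carrier to Index)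
  open Family A
  private
    module Fib (i : Index) = FinSet (fib i)

  record Section : Set where
    field
      at  : ∀ i → Carrier (fib i)
      coh : ∀ {i j} (p : i ≈ j) → Fib._≈_ j (tr p (at i)) (at j)

  open Section

  private
    choices : (is : List Index) → List (All (λ i → Carrier (fib i)) is)
    choices []       = [] ∷ []
    choices (i ∷ is) = concatMap (λ x → map (x ∷_) (choices is)) (Fib.enum i)

    find : ∀ {is} → All (λ i → Carrier (fib i)) is → ∀ i → i ∈ is → Carrier (fib i)
    find {j ∷ _} (x ∷ xs) i i∈ with j ≟ i | i∈
    ... | yes p | _        = tr p x
    ... | no ¬p | here i≈j = ⊥-elim (¬p (≈-sym i≈j))
    ... | no _  | there i∈′ = find xs i i∈′

    find-coh : ∀ {is} (xs : All (λ i → Carrier (fib i)) is) {i j} (i∈ : i ∈ is) (j∈ : j ∈ is)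
               (p : i ≈ j) → Fib._≈_ j (tr p (find xs i i∈)) (find xs j j∈)
    find-coh {k ∷ _} (x ∷ xs) {i} {j} i∈ j∈ p with k ≟ i | k ≟ j | i∈ | j∈
    ... | yes q | yes r | _ | _ = tr-∘ q p r x
    ... | yes q | no ¬r | _ | _ = ⊥-elim (¬r (≈-trans q p))
    ... | no ¬q | yes r | _ | _ = ⊥-elim (¬q (≈-trans r (≈-sym p)))
    ... | no ¬q | no _ | here i≈k  | _ = ⊥-elim (¬q (≈-sym i≈k))
    ... | no _ | no ¬r | there _   | here j≈k = ⊥-elim (¬r (≈-sym j≈k))
    ... | no _ | no _  | there i∈′ | there j∈′ = find-coh xs i∈′ j∈′ p

    Matches : ∀ {is} → Section → All (λ i → Carrier (fib i)) is → Set
    Matches s []                 = ⊤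
    Matches s (_∷_ {x = i} x xs) = Fib._≈_ i (at s i) x × Matches s xs

    choices-complete : ∀ s is → Any (Matches s) (choices is)
    choices-complete s []       = here tt
    choices-complete s (i ∷ is) = Any.concat⁺ (Any.map⁺
      (Any.map (λ e → Any.map⁺ (Any.map (e ,_) (choices-complete s is))) (Fib.complete i (at s i))))

    find-matches : ∀ s {is} (xs : All (λ i → Carrier (fib i)) is) → Matches s xs →
                   ∀ i (i∈ : i ∈ is) → Fib._≈_ i (at s i) (find xs i i∈)
    find-matches s {j ∷ _} (x ∷ xs) (e , m) i i∈ with j ≟ i | i∈
    ... | yes p | _         = Fib.≈-trans i (Fib.≈-sym i (coh s p)) (tr-cong p e)
    ... | no ¬p | here i≈j  = ⊥-elim (¬p (≈-sym i≈j))
    ... | no _  | there i∈′ = find-matches s xs m i i∈′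

    section : All (λ i → Carrier (fib i)) (FinSet.enum I) → Section
    section xs = record
      { at  = λ i → find xs i (FinSet.complete I i)
      ; coh = λ p → find-coh xs _ _ p }

  infix 4 _≈∏_
  _≈∏_ : Rel Section 0ℓ
  s ≈∏ t = ∀ i → Fib._≈_ i (at s i) (at t i)

  ∏-finSet : FinSet
  ∏-finSet = record
    { decSetoid = record
      { Carrier = Section
      ; _≈_ = _≈∏_
      ; isDecEquivalence = record
        { isEquivalence = record
          { refl = λ i → Fib.≈-refl i
          ; sym = λ e i → Fib.≈-sym i (e i)
          ; trans = λ e e′ i → Fib.≈-trans i (e i) (e′ i) }
        ; _≟_ = λ s t → all? I
            (λ {i} {j} p e → Fib.≈-trans j (Fib.≈-sym j (coh s p))
                               (Fib.≈-trans j (tr-cong p e) (coh t p)))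
            (λ i → Fib._≟_ i (at s i) (at t i)) } }
    ; enum     = map section (choices (FinSet.enum I))
    ; complete = λ s → Any.map⁺ (Any.map (λ {xs} m i → find-matches s xs m i _)
                   (choices-complete s (FinSet.enum I)))
    }

open Section public

-- A partition of U is an equivalence relation on U; the set π of its blocks is
-- the quotient, that is, U with the coarser equality.

module _ (U : FinSet) where
  open FinSet U using (_≈_; _≟_; ≈-refl; ≈-sym; ≈-trans; enum; complete)

  record Partition : Set where
    field
      related : Carrier U → Carrier U → Bool

    infix 4 _~_
    _~_ : Rel (Carrier U) 0ℓ
    x ~ y = related x y ≡ true

    field
      ~-refl  : ∀ {x y} → x ≈ y → x ~ y
      ~-sym   : ∀ {x y} → x ~ y → y ~ x
      ~-trans : ∀ {x y z} → x ~ y → y ~ z → x ~ z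

  open Partition

  related-cong : ∀ π {x x′ y y′} → x ≈ x′ → y ≈ y′ → related π x y ≡ related π x′ y′
  related-cong π {x} {x′} {y} {y′} p q with related π x y in r | related π x′ y′ in r′
  ... | true  | true  = refl
  ... | false | false = refl
  ... | true  | false = ≡.trans (≡.sym (~-trans π (~-refl π (≈-sym p)) (~-trans π r (~-refl π q)))) r′
  ... | false | true  = ≡.trans (≡.sym r) (~-trans π (~-refl π p) (~-trans π r′ (~-refl π (≈-sym q))))

  blocks : Partition → FinSet
  blocks π = record
    { decSetoid = record
      { Carrier = Carrier U ; _≈_ = _~_ π
      ; isDecEquivalence = record
        { isEquivalence = record { refl = ~-refl π ≈-refl ; sym = ~-sym π ; trans = ~-trans π }
        ; _≟_ = λ x y → related π x y Bool.≟ true } }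
    ; enum     = enum
    ; complete = λ x → Any.map (~-refl π) (complete x)
    }

  block : Partition → Carrier U → FinSet
  block π x = sub U {λ y → _~_ π x y} (λ p q → ~-trans π q (~-refl π p))
                (λ y → related π x y Bool.≟ true)

  private
    relations : FinSet
    relations = ∏-finSet (U ×ᶠ U) (constant (FinSet.decSetoid (U ×ᶠ U)) 𝔹)

    _⟨_,_⟩ : Carrier relations → Carrier U → Carrier U → Bool
    R ⟨ x , y ⟩ = at R (x , y)

    Equivalence : Carrier relations → Set
    Equivalence R = (∀ x → R ⟨ x , x ⟩ ≡ true)
      × (∀ x y → R ⟨ x , y ⟩ ≡ true → R ⟨ y , x ⟩ ≡ true)
      × (∀ x y z → R ⟨ x , y ⟩ ≡ true → R ⟨ y , z ⟩ ≡ true → R ⟨ x , z ⟩ ≡ true)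

    equivalence? : ∀ R → Dec (Equivalence R)
    equivalence? R =
      all? U (λ p → move p p) (λ x → R ⟨ x , x ⟩ Bool.≟ true) Dec.×-dec
      all? U (λ p h y r → move ≈-refl p (h y (move (≈-sym p) ≈-refl r))) (λ x →
        all? U (λ p h r → move p ≈-refl (h (move ≈-refl (≈-sym p) r))) (λ y →
          (R ⟨ x , y ⟩ Bool.≟ true) Dec.→-dec (R ⟨ y , x ⟩ Bool.≟ true))) Dec.×-dec
      all? U (λ p h y z r s → move p ≈-refl (h y z (move (≈-sym p) ≈-refl r) s)) (λ x →
        all? U (λ p h z r s → h z (move ≈-refl (≈-sym p) r) (move (≈-sym p) ≈-refl s)) (λ y →
          all? U (λ p h r s → move ≈-refl p (h r (move ≈-refl (≈-sym p) s))) (λ z →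
            (R ⟨ x , y ⟩ Bool.≟ true) Dec.→-dec
            ((R ⟨ y , z ⟩ Bool.≟ true) Dec.→-dec (R ⟨ x , z ⟩ Bool.≟ true)))))
      where
      move : ∀ {x x′ y y′} → x ≈ x′ → y ≈ y′ → R ⟨ x , y ⟩ ≡ true → R ⟨ x′ , y′ ⟩ ≡ true
      move p q r = ≡.trans (≡.sym (coh R (p , q))) r

    partition : ∀ R → Equivalence R → Partition
    partition R (r , s , t) = record
      { related = R ⟨_,_⟩
      ; ~-refl  = λ {x} p → ≡.trans (≡.sym (coh R (≈-refl , p))) (r x)
      ; ~-sym   = s _ _
      ; ~-trans = t _ _ _ }

    select : ∀ R → Dec (Equivalence R) → List Partition
    select R (yes e) = partition R e ∷ []
    select R (no _)  = []

    relation : Partition → Carrier relations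
    relation π = record
      { at = λ (x , y) → related π x y ; coh = λ (p , q) → related-cong π p q }

  partitions : FinSet
  partitions = record
    { decSetoid = decSetoid
    ; enum     = concatMap (λ R → select R (equivalence? R)) (FinSet.enum relations)
    ; complete = λ π → Any.concat⁺ (Any.map⁺
        (Any.map (λ {R} e → selected π R e (equivalence? R)) (FinSet.complete relations (relation π))))
    }
    where
    module R = FinSet relations
    decSetoid : DecSetoid 0ℓ 0ℓ
    decSetoid = record
      { Carrier = Partition
      ; _≈_ = λ π ρ → ∀ x y → related π x y ≡ related ρ x y
      ; isDecEquivalence = record
        { isEquivalence = record
          { refl = λ _ _ → refl
          ; sym = λ e x y → ≡.sym (e x y)
          ; trans = λ e e′ x y → ≡.trans (e x y) (e′ x y) }
        ; _≟_ = λ π ρ → Dec.map′ (λ e x y → e (x , y)) (λ e (x , y) → e x y)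
                          (relation π R.≟ relation ρ) } }
    selected : ∀ π R → relation π R.≈ R → (d : Dec (Equivalence R)) →
               Any (DecSetoid._≈_ decSetoid π) (select R d)
    selected π R e (yes _) = here λ x y → e (x , y)
    selected π R e (no ¬e) = ⊥-elim (¬e
      ( (λ x → use (~-refl π ≈-refl))
      , (λ x y p → use (~-sym π (back p)))
      , (λ x y z p q → use (~-trans π (back p) (back q))) ))
      where
      use : ∀ {x y} → _~_ π x y → R ⟨ x , y ⟩ ≡ true
      use {x} {y} p = ≡.trans (≡.sym (e (x , y))) p
      back : ∀ {x y} → R ⟨ x , y ⟩ ≡ true → _~_ π x y
      back {x} {y} p = ≡.trans (e (x , y)) p

open Partition using (related)

movePartition : ∀ {U V} → U ≅ V → Partition U → Partition V
movePartition {U} {V} σ π = record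
  { related = λ y y′ → related π (from σ y) (from σ y′)
  ; ~-refl  = λ p → Partition.~-refl π (from-cong σ p)
  ; ~-sym   = Partition.~-sym π
  ; ~-trans = Partition.~-trans π }

module _ {U V : FinSet} (σ : U ≅ V) {π : Partition U} {ρ : Partition V}
         (e : FinSet._≈_ (partitions V) (movePartition σ π) ρ) where
  private
    module U = FinSet U
    module V = FinSet V
    module π = Partition π
    module ρ = Partition ρ

    to-~ : ∀ {x y} → x π.~ y → to σ x ρ.~ to σ y
    to-~ {x} {y} p = ≡.trans (≡.sym (e (to σ x) (to σ y)))
      (≡.trans (related-cong U π (from-to σ x) (from-to σ y)) p)

    from-~ : ∀ {x y} → x ρ.~ y → from σ x π.~ from σ y
    from-~ {x} {y} p = ≡.trans (e x y) p

  blocksIso : blocks U π ≅ blocks V ρ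
  blocksIso = record { inverse = record
    { to = to σ ; from = from σ ; to-cong = to-~ ; from-cong = from-~
    ; inverse = (λ {x} p → ρ.~-trans (to-~ p) (ρ.~-refl (to-from σ x)))
              , (λ {x} p → π.~-trans (from-~ p) (π.~-refl (from-to σ x))) } }

  blockIso : ∀ {x y} → to σ x ρ.~ y → block U π x ≅ block V ρ y
  blockIso {x} {y} h = record { inverse = record
    { to = λ (z , p) → to σ z , ρ.~-trans (ρ.~-sym h) (to-~ p)
    ; from = λ (z , p) → from σ z ,
        π.~-trans (π.~-refl (U.≈-sym (from-to σ x))) (from-~ (ρ.~-trans h p))
    ; to-cong = to-cong σ
    ; from-cong = from-cong σ
    ; inverse = _≅_.inverseˡ σ , _≅_.inverseʳ σ } }

-- The real numbers are represented by an arbitrary ordered field that is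
-- Archimedean.  The value of _⁻¹ at 0 is arbitrary.
record ArchimedeanOrderedField c ℓ₁ ℓ₂ : Set (lsuc (c ⊔ ℓ₁ ⊔ ℓ₂)) where
  infix 4 _<_
  infix 8 _⁻¹
  field
    commutativeRing : CommutativeRing c ℓ₁
  open CommutativeRing commutativeRing public
    renaming (Carrier to Scalar; refl to ≈-refl; sym to ≈-sym; trans to ≈-trans)
  field
    _<_                : Rel Scalar ℓ₂
    isStrictTotalOrder : IsStrictTotalOrder _≈_ _<_
    1≉0                : 1# ≉ 0#
    +-monoʳ-<          : ∀ z {x y} → x < y → z + x < z + y
    *-positive         : ∀ {x y} → 0# < x → 0# < y → 0# < x * y
    _⁻¹                : Scalar → Scalar
    ⁻¹-cong            : ∀ {x y} → x ≈ y → x ⁻¹ ≈ y ⁻¹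
    ⁻¹-inverse         : ∀ {x} → x ≉ 0# → x * x ⁻¹ ≈ 1#

  fromℕ : ℕ → Scalar
  fromℕ n = RawMonoid._×_ +-rawMonoid n 1#

  field
    archimedean : ∀ x → ∃ λ n → x < fromℕ n

  open IsStrictTotalOrder isStrictTotalOrder public using (_<?_)
  open StrictToNonStrict _≈_ _<_ public using (_≤_)

  infixl 7 _/_
  _/_ : Scalar → Scalar → Scalar
  x / y = x * y ⁻¹

  ∣_∣ : Scalar → Scalar
  ∣ x ∣ = if does (x <? 0#) then - x else x

  sum : List Scalar → Scalar
  sum = foldr _+_ 0#

  product : List Scalar → Scalar
  product = foldr _*_ 1#

  -- ∑_{k = lo}^{hi} f k, which is 0 when hi < lo.
  ∑[_⋯_] : ℕ → ℕ → (ℕ → Scalar) → Scalar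
  ∑[ lo ⋯ hi ] f = sum (applyUpTo (λ i → f (lo ℕ.+ i)) (suc hi ∸ lo))

module Asymptotics {c ℓ₁ ℓ₂} (K : ArchimedeanOrderedField c ℓ₁ ℓ₂) where
  open ArchimedeanOrderedField K

  Sequence : Set c
  Sequence = ℕ → Scalar

  infix 4 _=O_ _=o_

  _=O_ : Sequence → Sequence → Set (c ⊔ ℓ₁ ⊔ ℓ₂)
  f =O g = ∃[ C ] ∃[ N ] ∀ n → N ℕ.≤ n → ∣ f n ∣ ≤ C * ∣ g n ∣

  _=o_ : Sequence → Sequence → Set (c ⊔ ℓ₁ ⊔ ℓ₂)
  f =o g = ∀ ε → 0# < ε → ∃[ N ] ∀ n → N ℕ.≤ n → ∣ f n ∣ ≤ ε * ∣ g n ∣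

  _⟶0 : Sequence → Set (c ⊔ ℓ₂)
  f ⟶0 = ∀ ε → 0# < ε → ∃[ N ] ∀ n → N ℕ.≤ n → ∣ f n ∣ < ε

  record Gargantuan (a : Sequence) : Set (c ⊔ ℓ₁ ⊔ ℓ₂) where
    field
      nonzero     : ∃[ N ] ∀ n → N ℕ.≤ n → a n ≉ 0#
      ratio       : (λ n → a (n ∸ 1) / a n) ⟶0
      convolution : ∀ r → (λ n → ∑[ r ⋯ n ∸ r ] λ k → ∣ a k * a (n ∸ k) ∣) =O (λ n → a (n ∸ r))

  -- x ≈ ∑_{k ≥ 0} f k, where f k n = d k * g k n.  The usual requirements
  --   x = ∑_{k ≤ r} f k + O(f (r + 1))   and   f (k + 1) = o(f k)
  -- are error-term and terms.  They make no sense for a term whose coefficient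
  -- d k is 0 (it would have to bound a nonzero error, or dominate a nonzero next
  -- term), so there they are required of the asymptotic scale g instead, as in
  -- Poincaré's definition: these are the fields error and scale.
  record Expansion (x : Sequence) (d : Sequence) (g : ℕ → Sequence) : Set (c ⊔ ℓ₁ ⊔ ℓ₂) where
    f : ℕ → Sequence
    f k n = d k * g k n

    remainder : ℕ → Sequence
    remainder r n = x n - (∑[ 0 ⋯ r ] λ k → f k n)

    field
      error       : ∀ r → remainder r =O g (suc r)
      scale       : ∀ k → g (suc k) =o g k
      error-term  : ∀ r → d (suc r) ≉ 0# → remainder r =O f (suc r)
      terms       : ∀ k → d k ≉ 0# → f (suc k) =o f k

module WeightedSpecies {c ℓ₁ ℓ₂} (K : ArchimedeanOrderedField c ℓ₁ ℓ₂) where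
  private
    module K = ArchimedeanOrderedField K

  record Species : Set (lsuc 0ℓ ⊔ c ⊔ ℓ₁) where
    infix 10 _[_]
    field
      _[_]      : FinSet → FinSet
      transport : ∀ {U V} → U ≅ V → Carrier (_[_] U) → Carrier (_[_] V)
      w         : ∀ U → Carrier (_[_] U) → K.Scalar

    module On (U : FinSet) = FinSet (_[_] U)

    field
      transport-cong : ∀ {U V} (σ τ : U ≅ V) {s t} → (∀ x → FinSet._≈_ V (to σ x) (to τ x)) →
                       On._≈_ U s t → On._≈_ V (transport σ s) (transport τ t)
      transport-id   : ∀ {U} s → On._≈_ U (transport idᵇ s) s
      transport-∘    : ∀ {U V W} (σ : U ≅ V) (τ : V ≅ W) s →
                       On._≈_ W (transport (τ ∘ᵇ σ) s) (transport τ (transport σ s))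
      w-cong         : ∀ {U s t} → On._≈_ U s t → w U s K.≈ w U t
      w-transport    : ∀ {U V} (σ : U ≅ V) s → w V (transport σ s) K.≈ w U s

    transport-id′ : ∀ {U} (σ : U ≅ U) s → (∀ x → FinSet._≈_ U (to σ x) x) →
                    On._≈_ U (transport σ s) s
    transport-id′ {U} σ s e = On.≈-trans U (transport-cong σ idᵇ e (On.≈-refl U)) (transport-id s)

    transport-∘′ : ∀ {U V W} (σ : U ≅ V) (τ : V ≅ W) (ρ : U ≅ W) s →
                   (∀ x → FinSet._≈_ W (to τ (to σ x)) (to ρ x)) →
                   On._≈_ W (transport τ (transport σ s)) (transport ρ s)
    transport-∘′ {U} {V} {W} σ τ ρ s e =
      On.≈-trans W (On.≈-sym W (transport-∘ σ τ s)) (transport-cong (τ ∘ᵇ σ) ρ e (On.≈-refl U))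

  open Species public using (_[_])

  infix 4 _≃_
  record _≃_ (F G : Species) : Set (lsuc 0ℓ ⊔ ℓ₁) where
    private
      module F = Species F
      module G = Species G
    field
      iso              : ∀ U → F [ U ] ≅ G [ U ]
      natural          : ∀ {U V} (σ : U ≅ V) s →
                         G.On._≈_ V (to (iso V) (F.transport σ s)) (G.transport σ (to (iso U) s))
      weight-preserving : ∀ U s → G.w U (to (iso U) s) K.≈ F.w U s

  ∣_[_]∣ʷ : Species → ℕ → K.Scalar
  ∣ F [ n ]∣ʷ = K.sum (map (Species.w F ⟦ n ⟧) (elements (F [ ⟦ n ⟧ ])))

  Positive : Species → Set (lsuc 0ℓ ⊔ ℓ₂)
  Positive F = ∀ U s → K.0# K.< Species.w F U s

  ℙ : ∀ (F : Species) n {E : Carrier (F [ ⟦ n ⟧ ]) → Set} → (∀ s → Dec (E s)) → K.Scalar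
  ℙ F n E? = K.sum (map (Species.w F ⟦ n ⟧) (filter E? (elements (F [ ⟦ n ⟧ ])))) K./ ∣ F [ n ]∣ʷ

  -- A species whose structures on U consist of a shape on U and of further data
  -- that depend on the shape.
  record Fibration : Set (lsuc 0ℓ ⊔ c ⊔ ℓ₁) where
    field
      shapes : FinSet → DecSetoid 0ℓ 0ℓ
    module Shapes (U : FinSet) = DecSetoid (shapes U)
      using (_≈_; setoid) renaming (Carrier to Shape; refl to ≈-refl; sym to ≈-sym; trans to ≈-trans)
    open Shapes using (Shape)
    field
      move      : ∀ {U V} → U ≅ V → Shape U → Shape V
      move-cong : ∀ {U V} (σ τ : U ≅ V) {i j} → (∀ x → FinSet._≈_ V (to σ x) (to τ x)) →
                  Shapes._≈_ U i j → Shapes._≈_ V (move σ i) (move τ j)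
      move-id   : ∀ {U} i → Shapes._≈_ U (move idᵇ i) i
      move-∘    : ∀ {U V W} (σ : U ≅ V) (τ : V ≅ W) i →
                  Shapes._≈_ W (move (τ ∘ᵇ σ) i) (move τ (move σ i))

      fib : ∀ {U} → Shape U → FinSet
      tr  : ∀ {U V} (σ : U ≅ V) {i j} → Shapes._≈_ V (move σ i) j → Carrier (fib i) → Carrier (fib j)
      tr-cong : ∀ {U V} (σ τ : U ≅ V) {i j} p q {x y} → (∀ u → FinSet._≈_ V (to σ u) (to τ u)) →
                FinSet._≈_ (fib i) x y → FinSet._≈_ (fib j) (tr σ p x) (tr τ q y)
      tr-id   : ∀ {U} (σ : U ≅ U) {i : Shape U} p x → (∀ u → FinSet._≈_ U (to σ u) u) →
                FinSet._≈_ (fib i) (tr σ {i} {i} p x) x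
      tr-∘    : ∀ {U V W} (σ : U ≅ V) (τ : V ≅ W) (ρ : U ≅ W) {i j k} p q r x →
                (∀ u → FinSet._≈_ W (to τ (to σ u)) (to ρ u)) →
                FinSet._≈_ (fib k) (tr τ {j} {k} q (tr σ {i} {j} p x)) (tr ρ {i} {k} r x)

      support   : ∀ U → List (Shape U)
      supported : ∀ {U} i → Carrier (fib i) → Membership._∈_ (Shapes.setoid U) i (support U)

      weight      : ∀ {U} (i : Shape U) → Carrier (fib i) → K.Scalar
      weight-cong : ∀ {U} (i : Shape U) {x y} → FinSet._≈_ (fib i) x y → weight i x K.≈ weight i y
      weight-tr   : ∀ {U V} (σ : U ≅ V) {i j} p x → weight j (tr σ {i} {j} p x) K.≈ weight i x

  module _ (P : Fibration) where
    open Fibration P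

    total : Species
    total = record
      { _[_] = tot
      ; transport = mv
      ; w = λ U (i , x) → weight i x
      ; transport-cong = λ {U} {V} σ τ {(i , x)} {(j , y)} e (p , q) →
          move-cong σ τ e p ,
          FinSet.≈-trans (fib (move τ j))
            (tr-∘ σ idᵇ τ _ _ (move-cong τ τ (λ _ → FinSet.≈-refl V) p) x e)
            (FinSet.≈-trans (fib (move τ j))
              (FinSet.≈-sym (fib (move τ j))
                (tr-∘ idᵇ τ τ (Shapes.≈-trans U (move-id i) p) (Shapes.≈-refl V) (move-cong τ τ (λ _ → FinSet.≈-refl V) p) x (λ _ → FinSet.≈-refl V)))
              (tr-cong τ τ _ _ (λ _ → FinSet.≈-refl V) q))
      ; transport-id = λ {U} (i , x) → move-id i ,
          FinSet.≈-trans (fib i)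
            (tr-∘ idᵇ idᵇ idᵇ _ _ (move-id i) x (λ _ → FinSet.≈-refl U))
            (tr-id idᵇ _ x (λ _ → FinSet.≈-refl U))
      ; transport-∘ = λ {U} {V} {W} σ τ (i , x) → move-∘ σ τ i ,
          FinSet.≈-trans (fib (move τ (move σ i)))
            (tr-∘ (τ ∘ᵇ σ) idᵇ (τ ∘ᵇ σ) _ _ (move-∘ σ τ i) x (λ _ → FinSet.≈-refl W))
            (FinSet.≈-sym (fib (move τ (move σ i)))
              (tr-∘ σ τ (τ ∘ᵇ σ) _ _ (move-∘ σ τ i) x (λ _ → FinSet.≈-refl W)))
      ; w-cong = λ {U} {(i , x)} {(j , y)} (p , q) →
          K.≈-trans (K.≈-sym (weight-tr idᵇ _ x)) (weight-cong j q)
      ; w-transport = λ σ (i , x) → weight-tr σ _ x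
      }
      where
      family : ∀ U → Family (shapes U)
      family U = record
        { fib = fib
        ; tr = λ {i} p → tr idᵇ (Shapes.≈-trans U (move-id i) p)
        ; tr-cong = λ p → tr-cong idᵇ idᵇ _ _ (λ _ → FinSet.≈-refl U)
        ; tr-id = λ p x → tr-id idᵇ _ x (λ _ → FinSet.≈-refl U)
        ; tr-∘ = λ p q r x → tr-∘ idᵇ idᵇ idᵇ _ _ _ x (λ _ → FinSet.≈-refl U)
        }
      tot : FinSet → FinSet
      tot U = ∑-finSet (shapes U) (family U) (support U) supported
      mv : ∀ {U V} → U ≅ V → Carrier (tot U) → Carrier (tot V)
      mv {V = V} σ (i , x) = move σ i , tr σ (Shapes.≈-refl V) x

  -- The species of sets, restricted to the cardinalities that satisfy P.
  ℰ∣ : {P : ℕ → Set} → (∀ k → Dec (P k)) → Species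
  ℰ∣ {P} P? = record
    { _[_] = λ U → truth (P? (card U))
    ; transport = λ σ → ≡.subst P (card-≅ σ)
    ; w = λ _ _ → K.1#
    ; transport-cong = λ _ _ _ _ → tt
    ; transport-id = λ _ → tt
    ; transport-∘ = λ _ _ _ → tt
    ; w-cong = λ _ → K.≈-refl
    ; w-transport = λ _ _ → K.≈-refl
    }

  ℰ : Species
  ℰ = ℰ∣ {λ _ → ⊤} (λ _ → yes tt)

  -- The index is an integer so that ℰ₍ m - 1 ₎ is the zero species when m = 0.
  ℰ₍_₎ : ℤ → Species
  ℰ₍ m ₎ = ℰ∣ (λ k → + k ≟ℤ m)

  ℰ₊ : Species
  ℰ₊ = ℰ∣ {λ k → ¬ k ≡ 0} (λ k → ¬? (k ℕ.≟ 0))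

  𝟙 : Species
  𝟙 = ℰ₍ + 0 ₎

  module _ {I : Set} (_≟_ : DecidableEquality I) (F : I → Species)
           (support : FinSet → List I)
           (supported : ∀ {U} i → Carrier (F i [ U ]) → Any (i ≡_) (support U)) where

    private module F (i : I) = Species (F i)

    sumFibration : Fibration
    sumFibration = record
      { shapes = λ _ → ≡.decSetoid _≟_
      ; move = λ _ i → i
      ; move-cong = λ _ _ _ p → p
      ; move-id = λ _ → refl
      ; move-∘ = λ _ _ _ → refl
      ; fib = λ {U} i → F i [ U ]
      ; tr = λ { σ {i} refl → F.transport i σ }
      ; tr-cong = λ { σ τ {i} refl refl e p → F.transport-cong i σ τ e p }
      ; tr-id = λ { σ {i} refl x e → F.transport-id′ i σ x e }
      ; tr-∘ = λ { σ τ ρ {i} refl refl refl x e → F.transport-∘′ i σ τ ρ x e }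
      ; support = support
      ; supported = supported
      ; weight = λ {U} i → F.w i U
      ; weight-cong = λ i p → F.w-cong i p
      ; weight-tr = λ { σ {i} refl x → F.w-transport i σ x }
      }

    ∑ˢ : Species
    ∑ˢ = total sumFibration

  infixl 6 _⊕_
  _⊕_ : Species → Species → Species
  F ⊕ G = ∑ˢ Bool._≟_ (λ b → if b then F else G) (λ _ → true ∷ false ∷ [])
    λ { true _ → here refl ; false _ → there (here refl) }

  -- A sequence of species with only finitely many structures on each finite set.
  ∑ᵢ : (F : ℕ → Species) → (∀ k U → Carrier (F k [ U ]) → k ℕ.≤ card U) → Species
  ∑ᵢ F bounded = ∑ˢ ℕ._≟_ F (λ U → upTo (suc (card U)))
    λ {U} k s → ∈-upTo⁺ (s≤s (bounded k U s))

  module Product (F G : Species) where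
    private
      module F = Species F
      module G = Species G

    -- U = U₁ ⊔ U₂ is given by the indicator function of U₁.
    subsets : FinSet → FinSet
    subsets U = ∏-finSet U (constant (FinSet.decSetoid U) 𝔹)

    part : ∀ U → Carrier (subsets U) → Bool → FinSet
    part U S b = sub U {λ x → at S x ≡ b} (λ p q → ≡.trans (≡.sym (coh S p)) q) (λ x → at S x Bool.≟ b)

    moveSubset : ∀ {U V} → U ≅ V → Carrier (subsets U) → Carrier (subsets V)
    moveSubset σ S = record { at = λ y → at S (from σ y) ; coh = λ p → coh S (from-cong σ p) }

    partIso : ∀ {U V} (σ : U ≅ V) {S T} → FinSet._≈_ (subsets V) (moveSubset σ S) T →
              ∀ b → part U S b ≅ part V T b
    partIso σ {S} {T} e b = record { inverse = record
      { to = λ (x , p) → to σ x ,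
          ≡.trans (≡.sym (e (to σ x))) (≡.trans (coh S (from-to σ x)) p)
      ; from = λ (y , p) → from σ y , ≡.trans (e y) p
      ; to-cong = to-cong σ
      ; from-cong = from-cong σ
      ; inverse = _≅_.inverseˡ σ , _≅_.inverseʳ σ
      } }

    fibration : Fibration
    fibration = record
      { shapes = λ U → FinSet.decSetoid (subsets U)
      ; move = moveSubset
      ; move-cong = λ {U} {V} σ τ {S} {T} e p y →
          ≡.trans (coh S (from-≈ σ τ e y)) (p (from τ y))
      ; move-id = λ _ _ → refl
      ; move-∘ = λ _ _ _ _ → refl
      ; fib = λ {U} S → F [ part U S true ] ×ᶠ G [ part U S false ]
      ; tr = λ σ e (s , t) → F.transport (partIso σ e true) s , G.transport (partIso σ e false) t
      ; tr-cong = λ σ τ p q e (r , r′) →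
          F.transport-cong (partIso σ p true) (partIso τ q true) (λ (x , _) → e x) r ,
          G.transport-cong (partIso σ p false) (partIso τ q false) (λ (x , _) → e x) r′
      ; tr-id = λ σ p (s , t) e →
          F.transport-id′ (partIso σ p true) s (λ (x , _) → e x) ,
          G.transport-id′ (partIso σ p false) t (λ (x , _) → e x)
      ; tr-∘ = λ σ τ ρ p q r (s , t) e →
          F.transport-∘′ (partIso σ p true) (partIso τ q true) (partIso ρ r true) s (λ (x , _) → e x) ,
          G.transport-∘′ (partIso σ p false) (partIso τ q false) (partIso ρ r false) t (λ (x , _) → e x)
      ; support = λ U → FinSet.enum (subsets U)
      ; supported = λ {U} S _ → FinSet.complete (subsets U) S
      ; weight = λ S (s , t) → F.w _ s K.* G.w _ t
      ; weight-cong = λ S (p , q) → K.*-cong (F.w-cong p) (G.w-cong q)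
      ; weight-tr = λ σ p (s , t) → K.*-cong (F.w-transport _ s) (G.w-transport _ t)
      }

  infixl 7 _·_
  _·_ : Species → Species → Species
  F · G = total (Product.fibration F G)

  ∏[_]_ : (U : FinSet) → (Carrier U → K.Scalar) → K.Scalar
  ∏[ U ] g = K.product (map g (elements U))

  ∏-≅ : ∀ {U V} (σ : U ≅ V) (g : Carrier U → K.Scalar) (h : Carrier V → K.Scalar) →
        (∀ {y y′} → FinSet._≈_ V y y′ → h y K.≈ h y′) → (∀ x → h (to σ x) K.≈ g x) →
        ∏[ V ] h K.≈ ∏[ U ] g
  ∏-≅ {U} {V} σ g h h-cong e = K.≈-trans
    (Permutationₚ.foldr-commMonoid K.setoid K.*-isCommutativeMonoid
      (Permutation.↭-sym K.setoid (Permutationₚ.map⁺ V.setoid K.setoid h-cong (elements-↭ σ))))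
    (pointwise (elements U))
    where
    module V = FinSet V
    pointwise : ∀ xs → K.product (map h (map (to σ) xs)) K.≈ K.product (map g xs)
    pointwise []       = K.≈-refl
    pointwise (x ∷ xs) = K.*-cong (e x) (pointwise xs)

  module Composition (F B : Species) where
    private
      module F = Species F
      module B = Species B

    onBlocks : ∀ U π → Family (FinSet.decSetoid (blocks U π))
    onBlocks U π = record
      { fib = λ x → B [ block U π x ]
      ; tr = λ p → B.transport (iso p)
      ; tr-cong = λ p e → B.transport-cong (iso p) (iso p) (λ _ → FinSet.≈-refl U) e
      ; tr-id = λ p s → B.transport-id′ (iso p) s (λ _ → FinSet.≈-refl U)
      ; tr-∘ = λ p q r s → B.transport-∘′ (iso p) (iso q) (iso r) s (λ _ → FinSet.≈-refl U)
      }
      where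
      iso : ∀ {x y} → Partition._~_ π x y → block U π x ≅ block U π y
      iso = blockIso idᵇ {π} {π} (λ _ _ → refl)

    assemblies : ∀ U → Partition U → FinSet
    assemblies U π = ∏-finSet (blocks U π) (onBlocks U π)

    same : ∀ {U} π (b : Carrier (assemblies U π)) {V x x′}
           (ρ : block U π x ≅ V) (ρ′ : block U π x′ ≅ V) → Partition._~_ π x x′ →
           (∀ z p q → FinSet._≈_ V (to ρ (z , p)) (to ρ′ (z , q))) →
           B.On._≈_ V (B.transport ρ (at b x)) (B.transport ρ′ (at b x′))
    same {U} π b {V} {x} {x′} ρ ρ′ h e = B.On.≈-trans V
      (B.On.≈-sym V (B.transport-∘′ iso ρ′ ρ (at b x) (λ (z , _) → FinSet.≈-sym V (e z _ _))))
      (B.transport-cong ρ′ ρ′ (λ _ → FinSet.≈-refl V) (coh b h))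
      where
      iso : block U π x ≅ block U π x′
      iso = blockIso idᵇ {π} {π} (λ _ _ → refl) h

    module _ {U V} (σ : U ≅ V) {π ρ} (e : FinSet._≈_ (partitions V) (movePartition σ π) ρ) where
      at-from : ∀ y → block U π (from σ y) ≅ block V ρ y
      at-from y = blockIso σ {π} {ρ} e (Partition.~-refl ρ (to-from σ y))

      trᵇ : Carrier (assemblies U π) → Carrier (assemblies V ρ)
      trᵇ b = record
        { at = λ y → B.transport (at-from y) (at b (from σ y))
        ; coh = λ {y} {y′} h → B.On.≈-trans (block V ρ y′)
            (B.transport-∘′ (at-from y) (iso h) (at-from y′ ∘ᵇ mid h) (at b (from σ y))
              (λ _ → FinSet.≈-refl V))
            (B.On.≈-trans (block V ρ y′)
              (B.transport-∘ (mid h) (at-from y′) (at b (from σ y)))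
              (B.transport-cong (at-from y′) (at-from y′) (λ _ → FinSet.≈-refl V)
                (coh b (mid-~ h)))) }
        where
        iso : ∀ {x y} → Partition._~_ ρ x y → block V ρ x ≅ block V ρ y
        iso = blockIso idᵇ {ρ} {ρ} (λ _ _ → refl)
        mid-~ : ∀ {y y′} → Partition._~_ ρ y y′ → Partition._~_ π (from σ y) (from σ y′)
        mid-~ {y} {y′} h = ≡.trans (e y y′) h
        mid : ∀ {y y′} → Partition._~_ ρ y y′ → block U π (from σ y) ≅ block U π (from σ y′)
        mid h = blockIso idᵇ {π} {π} (λ _ _ → refl) (mid-~ h)

    fibration : Fibration
    fibration = record
      { shapes = λ U → FinSet.decSetoid (partitions U)
      ; move = movePartition
      ; move-cong = λ {U} {V} σ τ {π} e p y y′ →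
          ≡.trans (related-cong U π (from-≈ σ τ e y) (from-≈ σ τ e y′)) (p (from τ y) (from τ y′))
      ; move-id = λ _ _ _ → refl
      ; move-∘ = λ _ _ _ _ _ → refl
      ; fib = λ {U} π → F [ blocks U π ] ×ᶠ assemblies U π
      ; tr = λ σ {π} {ρ} e (s , b) → F.transport (blocksIso σ {π} {ρ} e) s , trᵇ σ {π} {ρ} e b
      ; tr-cong = λ {U} {V} σ τ {π} {ρ} p q {(s , b)} {(t , c)} e (h , k) →
          F.transport-cong (blocksIso σ {π} {ρ} p) (blocksIso τ {π} {ρ} q)
            (λ x → Partition.~-refl ρ (e x)) h ,
          λ y → B.On.≈-trans (block V ρ y)
            (same π b (at-from σ {π} {ρ} p y) (at-from τ {π} {ρ} q y)
              (Partition.~-refl π (from-≈ σ τ e y)) (λ z _ _ → e z))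
            (B.transport-cong (at-from τ {π} {ρ} q y) (at-from τ {π} {ρ} q y)
              (λ _ → FinSet.≈-refl V) (k (from τ y)))
      ; tr-id = λ {U} σ {π} p (s , b) e →
          F.transport-id′ (blocksIso σ {π} {π} p) s (λ x → Partition.~-refl π (e x)) ,
          λ y → B.On.≈-trans (block U π y)
            (same π b (at-from σ {π} {π} p y) idᵇ
              (Partition.~-refl π (FinSet.≈-trans U (FinSet.≈-sym U (e (from σ y))) (to-from σ y)))
              (λ z _ _ → e z))
            (B.transport-id (at b y))
      ; tr-∘ = λ {U} {V} {W} σ τ ξ {π} {ρ} {θ} p q r (s , b) e →
          F.transport-∘′ (blocksIso σ {π} {ρ} p) (blocksIso τ {ρ} {θ} q) (blocksIso ξ {π} {θ} r) s
            (λ x → Partition.~-refl θ (e x)) ,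
          λ y → B.On.≈-trans (block W θ y)
            (B.On.≈-sym (block W θ y)
              (B.transport-∘ (at-from σ {π} {ρ} p (from τ y)) (at-from τ {ρ} {θ} q y)
                (at b (from σ (from τ y)))))
            (same π b (at-from τ {ρ} {θ} q y ∘ᵇ at-from σ {π} {ρ} p (from τ y)) (at-from ξ {π} {θ} r y)
              (Partition.~-refl π (from-≈ (τ ∘ᵇ σ) ξ e y)) (λ z _ _ → e z))
      ; support = λ U → FinSet.enum (partitions U)
      ; supported = λ {U} π _ → FinSet.complete (partitions U) π
      ; weight = λ {U} π (s , b) →
          F.w (blocks U π) s K.* ∏[ blocks U π ] (λ x → B.w (block U π x) (at b x))
      ; weight-cong = λ {U} π {(s , b)} {(t , c)} (h , k) → K.*-cong (F.w-cong h)
          (∏-≅ (idᵇ {blocks U π}) _ _ (w-coh π b) (λ x → B.w-cong (k x)))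
      ; weight-tr = λ {U} {V} σ {π} {ρ} e (s , b) → K.*-cong (F.w-transport _ s)
          (∏-≅ (blocksIso σ {π} {ρ} e) _ _ (w-coh ρ (trᵇ σ {π} {ρ} e b)) (λ x →
            K.≈-trans (B.w-transport _ (at b _)) (w-coh π b (Partition.~-refl π (from-to σ x)))))
      }
      where
      w-coh : ∀ {U} π (b : Carrier (assemblies U π)) {x y} → Partition._~_ π x y →
              B.w (block U π x) (at b x) K.≈ B.w (block U π y) (at b y)
      w-coh π b h = K.≈-trans (K.≈-sym (B.w-transport _ (at b _))) (B.w-cong (coh b h))

  infixr 9 _∘ˢ_
  _∘ˢ_ : Species → Species → Species
  F ∘ˢ B = total (Composition.fibration F B)

  components : ∀ (F B : Species) U → Carrier ((F ∘ˢ B) [ U ]) → FinSet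
  components F B U (π , _) = blocks U π

  _^ˢ_ : Species → ℕ → Species
  F ^ˢ zero  = 𝟙
  F ^ˢ suc k = F · (F ^ˢ k)

  ℰ₊^-bounded : ∀ k U → Carrier ((ℰ₊ ^ˢ k) [ U ]) → k ℕ.≤ card U
  ℰ₊^-bounded zero    U _ = z≤n
  ℰ₊^-bounded (suc k) U (S , nonempty , s) = inhabited _ refl
    where
    open Product ℰ₊ (ℰ₊ ^ˢ k) using (part)
    U₁ U₂ : FinSet
    U₁ = part U S true
    U₂ = part U S false
    fresh : ∀ {x} → at S x ≡ true → ∀ (ys : List (Carrier U₂)) →
            All (λ y → ¬ FinSet._≈_ U x y) (map proj₁ ys)
    fresh p []             = []
    fresh p ((y , q) ∷ ys) = (λ e → true≢false (≡.trans (≡.sym p) (≡.trans (coh S e) q))) ∷ fresh p ys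
      where
      true≢false : ¬ true ≡ false
      true≢false ()
    inhabited : ∀ xs → xs ≡ elements U₁ → suc k ℕ.≤ card U
    inhabited [] e = ⊥-elim (nonempty (≡.cong length (≡.sym e)))
    inhabited ((x , p) ∷ _) _ = ℕ.≤-trans
      (s≤s (≡.subst (k ℕ.≤_) (≡.sym (length-map proj₁ (elements U₂))) (ℰ₊^-bounded k U₂ s)))
      (unique⇒≤card U (fresh p (elements U₂) ∷
        Uniqueₚ.map⁺ (FinSet.setoid U₂) (FinSet.setoid U) id (FinSet.elements-unique U₂)))

  record Virtual : Set (lsuc 0ℓ ⊔ c ⊔ ℓ₁) where
    constructor _⊖_
    field
      pos neg : Species

  open Virtual

  ∣_[_]∣ᵛ : Virtual → ℕ → K.Scalar
  ∣ Φ [ n ]∣ᵛ = ∣ pos Φ [ n ]∣ʷ K.- ∣ neg Φ [ n ]∣ʷ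

  infixl 7 _·ᵛ_
  _·ᵛ_ : Species → Virtual → Virtual
  F ·ᵛ Φ = (F · pos Φ) ⊖ (F · neg Φ)

  infixr 9 _∘ᵛ_
  _∘ᵛ_ : Virtual → Species → Virtual
  Φ ∘ᵛ B = (pos Φ ∘ˢ B) ⊖ (neg Φ ∘ˢ B)

  -- ∑_{k ≥ 0} (−1)ᵏ (ℰ₊)ᵏ, the even powers minus the odd ones
  ℰ⁻¹ : Virtual
  ℰ⁻¹ = ∑ᵢ (λ j → ℰ₊ ^ˢ (j ℕ.+ j)) (λ j U s → ℕ.≤-trans (ℕ.m≤m+n j j) (ℰ₊^-bounded _ U s))
      ⊖ ∑ᵢ (λ j → ℰ₊ ^ˢ suc (j ℕ.+ j))
           (λ j U s → ℕ.≤-trans (ℕ.m≤n⇒m≤1+n (ℕ.m≤m+n j j)) (ℰ₊^-bounded _ U s))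

  _⁽_⁾ : Species → ℤ → Species
  B ⁽ m ⁾ = ℰ₍ m ₎ ∘ˢ B

  𝒟 : Species → ℕ → Virtual
  𝒟 B m = B ⁽ + m -ℤ 1ℤ ⁾ ·ᵛ (ℰ⁻¹ ∘ᵛ B)

  GargantuanSpecies : Species → Set (c ⊔ ℓ₁ ⊔ ℓ₂)
  GargantuanSpecies F = Asymptotics.Gargantuan K (λ n → ∣ F [ n ]∣ʷ K./ K.fromℕ (n !))

  -- A structure s of a species represented as ℰ ∘ ℬ belongs to the subspecies
  -- ℬ^{m} when it has exactly m connected components.
  module _ (A B : Species) (φ : A ≃ ℰ ∘ˢ B) (m : ℕ) (U : FinSet) where

    HasComponents : Carrier (A [ U ]) → Set
    HasComponents s = card (components ℰ B U (to (_≃_.iso φ U) s)) ≡ m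

    hasComponents? : ∀ s → Dec (HasComponents s)
    hasComponents? s = card (components ℰ B U (to (_≃_.iso φ U) s)) ℕ.≟ m

{-# OPTIONS --safe #-}
-- Write A, B for the exponential generating functions of 𝒜 and ℬ.  Then A = exp B,
-- the species ℬ^{m} has B^m/m!, and 𝒟(m) has B^{m−1}/(m−1)! · exp(−B).  Say that f has
-- the expansion d if f_n = ∑_{k<r} d_k a_{n−k} + O(a_{n−r}) for every r, where a_n are
-- the coefficients of A.  Since (a_n) is gargantuan, f ↦ d is a derivation on the series
-- dominated by A.  So it suffices that B has the expansion exp(−B): as
-- B · B^m/m! = (m+1) · B^{m+1}/(m+1)!, induction on m gives the theorem.
--
-- For B itself, write B = P + Q with P its part of degree at most r.  The coefficients of
-- E = exp(−P) are O(a_{n−s}) for every s, by bootstrapping E′ = −P′E.  The series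
-- A E = exp Q is 1 + Q up to O(a_{n−r−1}), because (exp Q − 1 − Q)′ = Q′ (exp Q − 1) is a
-- product of two series of order about r.  Hence B, up to a polynomial, is A E up to
-- O(a_{n−r}), and E agrees with exp(−B) in degrees up to r.
--
-- The equations (B^{m+1}/(m+1)!)′ = B′ · B^m/m! come from removing the block of a
-- distinguished point from a partition.
module Submission where

open import Algebra.Bundles using (CommutativeMonoid; CommutativeRing)
import Algebra.Properties.Ring as RingProperties
import Algebra.Properties.Semiring.Mult as SemiringMult
import Algebra.Solver.Ring.NaturalCoefficients.Default as SemiringSolver
open import Data.Bool using (Bool; false; if_then_else_; true)
import Data.Bool.Properties as Bool
open import Data.Empty using (⊥; ⊥-elim)
open import Data.Fin using (Fin; suc; zero)
open import Data.Integer using (+_; 1ℤ) renaming (_-_ to _-ℤ_; _≟_ to _≟ℤ_)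
open import Data.List using (List; []; _∷_; _++_; applyUpTo; cartesianProductWith; concatMap; filter;
  foldr; lookup; map; upTo)
open import Data.List.Membership.Propositional.Properties using (∈-allFin; ∈-upTo⁺)
import Data.List.Membership.Setoid as Membership
import Data.List.Membership.Setoid.Properties as Membershipₚ
open import Data.List.Properties as List using (length-map)
open import Data.List.Relation.Binary.Disjoint.Setoid using (Disjoint)
import Data.List.Relation.Binary.Permutation.Setoid as Permutation
import Data.List.Relation.Binary.Permutation.Setoid.Properties as Permutationₚ
open import Data.List.Relation.Unary.All as All using (All; []; _∷_)
import Data.List.Relation.Unary.All.Properties as All
open import Data.List.Relation.Unary.AllPairs as AllPairs using ([]; _∷_)
import Data.List.Relation.Unary.AllPairs.Properties as AllPairs
open import Data.List.Relation.Unary.Any as Any using (here; there)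
import Data.List.Relation.Unary.Any.Properties as Any
import Data.List.Relation.Unary.Unique.Propositional.Properties as UniqueProp
import Data.List.Relation.Unary.Unique.Setoid as Unique
import Data.List.Relation.Unary.Unique.Setoid.Properties as Uniqueₚ
open import Data.Nat as ℕ using (_!; _∸_; suc; zero; ℕ)
open import Data.Nat.Combinatorics using (_C_; k![n∸k]!∣n!; nCk≡n!/k![n-k]!)
import Data.Nat.DivMod as ℕ
import Data.Nat.Properties as ℕ
open import Data.Product using (_,_; proj₁; proj₂; Σ; ∃-syntax)
open import Data.Sum using (_⊎_; inj₁; inj₂)
open import Data.Unit using (tt)
open import Defs
open import Function.Base using (_∘_)
open import Function.Bundles using (mk⇔)
open import Level using (0ℓ; Level; _⊔_) renaming (suc to lsuc)
open import Relation.Binary using (DecSetoid; IsStrictTotalOrder; Setoid; StrictPartialOrder; tri<; tri>; tri≈)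
import Relation.Binary.Construct.StrictToNonStrict as StrictToNonStrict
open import Relation.Binary.PropositionalEquality as ≡ using (_≡_; refl)
import Relation.Binary.Reasoning.Setoid as SetoidReasoning
import Relation.Binary.Reasoning.StrictPartialOrder as StrictReasoning
open import Relation.Nullary using (Dec; contradiction; does; no; yes; ¬_)
import Relation.Nullary.Decidable as Dec

open FinSet using (Carrier; elements; card)
open _≅_ using (to; from; to-cong; from-cong)

-- The obstacle is that B = log A must be shown to have an expansion at all. The Leibniz rule only
-- computes the expansion of a product whose factors are known to have one, and log A is not a
-- finite product of such series; powers of A - 1 would require estimates uniform in the exponent.
-- Cutting B at degree r replaces this by the single product A E, for each r separately, whose
-- pieces can be bounded directly. The truncated exponential needs no species of its own: sums over
-- partitions make sense for any sequence of block weights, so exp(-P) arises from weights set to 0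
-- beyond size r.
--
-- Majorants come from positivity. Only the weights of 𝒜 are assumed positive, but a ℬ-structure on
-- a nonempty set is an 𝒜-structure with one block, so B has nonnegative coefficients as well. Hence
-- a solution of x′ = p x with |p| ≤ B′ coefficientwise and |x(0)| ≤ 1 is bounded coefficientwise by
-- A. Exponentials are compared through such equations, degree by degree, and no logarithm of a
-- series has to be constructed.

-- Arithmetic, order and absolute value in an ordered field

module FieldProperties {c ℓ₁ ℓ₂} (K : ArchimedeanOrderedField c ℓ₁ ℓ₂) where
  open ArchimedeanOrderedField K hiding (sum; product)
  open IsStrictTotalOrder isStrictTotalOrder
    using (compare; isStrictPartialOrder; <-resp-≈; <-respʳ-≈)
    renaming (irrefl to <-irrefl; trans to <-trans; asym to <-asym)
  module ≤ = StrictToNonStrict _≈_ _<_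
  module RingP = RingProperties ring
  open RingP using (-‿distribˡ-*; -‿distribʳ-*; -‿+-comm; -‿involutive; -0#≈0#)
  open SemiringSolver commutativeSemiring using (solve; _:+_; _:*_; _:=_)

  strictPartialOrder : StrictPartialOrder c ℓ₁ ℓ₂
  strictPartialOrder = record { isStrictPartialOrder = isStrictPartialOrder }

  module ≈-Reasoning = SetoidReasoning setoid
  module ≤-Reasoning = StrictReasoning strictPartialOrder

  private
    variable
      x y z u v : Scalar

  <⇒≤ : x < y → x ≤ y
  <⇒≤ = inj₁

  ≤-reflexive : x ≈ y → x ≤ y
  ≤-reflexive = inj₂

  ≤-refl : x ≤ x
  ≤-refl = inj₂ ≈-refl

  ≤-trans : x ≤ y → y ≤ z → x ≤ z
  ≤-trans = ≤.trans isEquivalence <-resp-≈ <-trans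

  ≤-total : ∀ x y → x ≤ y ⊎ y ≤ x
  ≤-total = ≤.total compare

  <⇒≉ : x < y → ¬ x ≈ y
  <⇒≉ p e = <-irrefl e p

  <-≤-trans : x < y → y ≤ z → x < z
  <-≤-trans = ≤.<-≤-trans <-trans <-respʳ-≈

  <⇒≱ : x < y → ¬ y ≤ x
  <⇒≱ p q = <-irrefl ≈-refl (<-≤-trans p q)

  +-monoʳ-≤ : ∀ z → x ≤ y → z + x ≤ z + y
  +-monoʳ-≤ z (inj₁ p) = inj₁ (+-monoʳ-< z p)
  +-monoʳ-≤ z (inj₂ p) = inj₂ (+-congˡ p)

  +-mono-≤ : x ≤ y → u ≤ v → x + u ≤ y + v
  +-mono-≤ {x} {y} {u} {v} p q = begin
    x + u  ≈⟨ +-comm x u ⟩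
    u + x  ≤⟨ +-monoʳ-≤ u p ⟩
    u + y  ≈⟨ +-comm u y ⟩
    y + u  ≤⟨ +-monoʳ-≤ y q ⟩
    y + v  ∎
    where open ≤-Reasoning

  +-nonneg : 0# ≤ x → 0# ≤ y → 0# ≤ x + y
  +-nonneg p q = ≤-trans (≤-reflexive (≈-sym (+-identityˡ 0#))) (+-mono-≤ p q)

  *-nonneg : 0# ≤ x → 0# ≤ y → 0# ≤ x * y
  *-nonneg (inj₁ p) (inj₁ q) = inj₁ (*-positive p q)
  *-nonneg (inj₂ p) _        = inj₂ (≈-trans (≈-sym (zeroˡ _)) (*-congʳ p))
  *-nonneg (inj₁ p) (inj₂ q) = inj₂ (≈-trans (≈-sym (zeroʳ _)) (*-congˡ q))

  x+y-x≈y : ∀ x y → x + (y - x) ≈ y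
  x+y-x≈y x y = begin
    x + (y - x)    ≈⟨ solve 3 (λ x y n → x :+ (y :+ n) := y :+ (x :+ n)) ≈-refl x y (- x) ⟩
    y + (x - x)    ≈⟨ +-congˡ (-‿inverseʳ x) ⟩
    y + 0#         ≈⟨ +-identityʳ y ⟩
    y              ∎
    where open ≈-Reasoning

  x≤y⇒0≤y-x : x ≤ y → 0# ≤ y - x
  x≤y⇒0≤y-x {x} {y} p = begin
    0#     ≈⟨ -‿inverseˡ x ⟨
    - x + x  ≤⟨ +-monoʳ-≤ (- x) p ⟩
    - x + y  ≈⟨ +-comm _ _ ⟩
    y - x  ∎
    where open ≤-Reasoning

  0≤y-x⇒x≤y : 0# ≤ y - x → x ≤ y
  0≤y-x⇒x≤y {y} {x} p = begin
    x            ≈⟨ +-identityʳ x ⟨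
    x + 0#       ≤⟨ +-monoʳ-≤ x p ⟩
    x + (y - x)  ≈⟨ x+y-x≈y x y ⟩
    y            ∎
    where open ≤-Reasoning

  *-monoˡ-≤ : 0# ≤ z → x ≤ y → z * x ≤ z * y
  *-monoˡ-≤ {z} {x} {y} 0≤z p = 0≤y-x⇒x≤y (≤-trans (*-nonneg 0≤z (x≤y⇒0≤y-x p))
    (≤-reflexive (≈-trans (distribˡ z y (- x)) (+-congˡ (≈-sym (-‿distribʳ-* z x))))))

  *-monoʳ-≤ : 0# ≤ z → x ≤ y → x * z ≤ y * z
  *-monoʳ-≤ 0≤z p = ≤-trans (≤-reflexive (*-comm _ _))
    (≤-trans (*-monoˡ-≤ 0≤z p) (≤-reflexive (*-comm _ _)))

  *-mono-≤ : 0# ≤ x → x ≤ y → 0# ≤ u → u ≤ v → x * u ≤ y * v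
  *-mono-≤ 0≤x p 0≤u q = ≤-trans (*-monoˡ-≤ 0≤x q) (*-monoʳ-≤ (≤-trans 0≤u q) p)

  neg-mono-≤ : x ≤ y → - y ≤ - x
  neg-mono-≤ {x} {y} p = 0≤y-x⇒x≤y (≤-trans (x≤y⇒0≤y-x p)
    (≤-reflexive (≈-trans (+-comm _ _) (+-congˡ (≈-sym (-‿involutive y))))))

  -- If 1 were negative, -1 would be nonnegative, and so would its square 1 = (-1)(-1).
  0<1 : 0# < 1#
  0<1 with compare 0# 1#
  ... | tri< p _ _ = p
  ... | tri≈ _ p _ = contradiction (≈-sym p) 1≉0
  ... | tri> _ _ p = contradiction
    (≤-trans (*-nonneg -1≥0 -1≥0)
      (≤-reflexive (≈-trans (≈-sym (-‿distribˡ-* 1# (- 1#)))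
        (≈-trans (-‿cong (*-identityˡ _)) (-‿involutive 1#)))))
    (<⇒≱ p)
    where
    -1≥0 : 0# ≤ - 1#
    -1≥0 = ≤-trans (≤-reflexive (≈-sym -0#≈0#)) (neg-mono-≤ (inj₁ p))

  0≤1 : 0# ≤ 1#
  0≤1 = <⇒≤ 0<1

  fromℕ-nonneg : ∀ n → 0# ≤ fromℕ n
  fromℕ-nonneg zero    = ≤-refl
  fromℕ-nonneg (suc n) = +-nonneg 0≤1 (fromℕ-nonneg n)

  0<fromℕ-suc : ∀ n → 0# < fromℕ (suc n)
  0<fromℕ-suc n = <-≤-trans 0<1
    (≤-trans (≤-reflexive (≈-sym (+-identityʳ 1#))) (+-monoʳ-≤ 1# (fromℕ-nonneg n)))

  fromℕ≉0 : ∀ n .{{_ : ℕ.NonZero n}} → ¬ fromℕ n ≈ 0#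
  fromℕ≉0 (suc n) e = <⇒≉ (0<fromℕ-suc n) (≈-sym e)

  0<fromℕ : ∀ n .{{_ : ℕ.NonZero n}} → 0# < fromℕ n
  0<fromℕ (suc n) = 0<fromℕ-suc n

  fromℕ-* : ∀ m n → fromℕ (m ℕ.* n) ≈ fromℕ m * fromℕ n
  fromℕ-* = SemiringMult.×1-homo-* semiring

  fromℕ-mono-≤ : ∀ {m n} → m ℕ.≤ n → fromℕ m ≤ fromℕ n
  fromℕ-mono-≤ {n = n} ℕ.z≤n     = fromℕ-nonneg n
  fromℕ-mono-≤ {suc m} {suc n} (ℕ.s≤s p) = +-monoʳ-≤ 1# (fromℕ-mono-≤ {m} {n} p)

  ∣x∣≈x : 0# ≤ x → ∣ x ∣ ≈ x
  ∣x∣≈x {x} p with x <? 0#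
  ... | no _  = ≈-refl
  ... | yes q with p
  ...   | inj₁ r = contradiction r (<-asym q)
  ...   | inj₂ r = contradiction (≈-sym r) (<⇒≉ q)

  -- At 0 the definition takes its other branch, where x and -x agree. Together with `∣x∣≈x` this
  -- lets later proofs split on `≤-total`, whose cases overlap, and forget the boolean test.
  x≤0⇒∣x∣≈-x : x ≤ 0# → ∣ x ∣ ≈ - x
  x≤0⇒∣x∣≈-x {x} p with x <? 0#
  ... | yes _ = ≈-refl
  ... | no ¬q with p
  ...   | inj₁ r = contradiction r ¬q
  ...   | inj₂ r = ≈-trans r (≈-trans (≈-sym -0#≈0#) (-‿cong (≈-sym r)))

  x≤0⇒0≤-x : x ≤ 0# → 0# ≤ - x
  x≤0⇒0≤-x p = ≤-trans (≤-reflexive (≈-sym -0#≈0#)) (neg-mono-≤ p)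

  0≤x⇒-x≤0 : 0# ≤ x → - x ≤ 0#
  0≤x⇒-x≤0 p = ≤-trans (neg-mono-≤ p) (≤-reflexive -0#≈0#)

  ∣∣-nonneg : ∀ x → 0# ≤ ∣ x ∣
  ∣∣-nonneg x with ≤-total 0# x
  ... | inj₁ p = ≤-trans p (≤-reflexive (≈-sym (∣x∣≈x p)))
  ... | inj₂ p = ≤-trans (x≤0⇒0≤-x p) (≤-reflexive (≈-sym (x≤0⇒∣x∣≈-x p)))

  x≤∣x∣ : ∀ x → x ≤ ∣ x ∣
  x≤∣x∣ x with ≤-total 0# x
  ... | inj₁ p = ≤-reflexive (≈-sym (∣x∣≈x p))
  ... | inj₂ p = ≤-trans p (∣∣-nonneg x)

  -x≤∣x∣ : ∀ x → - x ≤ ∣ x ∣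
  -x≤∣x∣ x with ≤-total 0# x
  ... | inj₁ p = ≤-trans (0≤x⇒-x≤0 p) (∣∣-nonneg x)
  ... | inj₂ p = ≤-reflexive (≈-sym (x≤0⇒∣x∣≈-x p))

  ∣∣-least : x ≤ y → - x ≤ y → ∣ x ∣ ≤ y
  ∣∣-least {x} p q with ≤-total 0# x
  ... | inj₁ r = ≤-trans (≤-reflexive (∣x∣≈x r)) p
  ... | inj₂ r = ≤-trans (≤-reflexive (x≤0⇒∣x∣≈-x r)) q

  ∣∣-cong : x ≈ y → ∣ x ∣ ≈ ∣ y ∣
  ∣∣-cong {x} {y} e with ≤-total 0# x
  ... | inj₁ p = ≈-trans (∣x∣≈x p) (≈-trans e (≈-sym (∣x∣≈x (≤-trans p (≤-reflexive e)))))
  ... | inj₂ p = ≈-trans (x≤0⇒∣x∣≈-x p) (≈-trans (-‿cong e)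
                   (≈-sym (x≤0⇒∣x∣≈-x (≤-trans (≤-reflexive (≈-sym e)) p))))

  ∣-x∣≈∣x∣ : ∀ x → ∣ - x ∣ ≈ ∣ x ∣
  ∣-x∣≈∣x∣ x with ≤-total 0# x
  ... | inj₁ p = ≈-trans (x≤0⇒∣x∣≈-x (0≤x⇒-x≤0 p)) (≈-trans (-‿involutive x) (≈-sym (∣x∣≈x p)))
  ... | inj₂ p = ≈-trans (∣x∣≈x (x≤0⇒0≤-x p)) (≈-sym (x≤0⇒∣x∣≈-x p))

  ∣x+y∣≤∣x∣+∣y∣ : ∀ x y → ∣ x + y ∣ ≤ ∣ x ∣ + ∣ y ∣
  ∣x+y∣≤∣x∣+∣y∣ x y = ∣∣-least (+-mono-≤ (x≤∣x∣ x) (x≤∣x∣ y))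
    (≤-trans (≤-reflexive (≈-sym (-‿+-comm x y))) (+-mono-≤ (-x≤∣x∣ x) (-x≤∣x∣ y)))

  private
    nonneg : ∀ {x} y → 0# ≤ x → ∣ x * y ∣ ≈ x * ∣ y ∣
    nonneg {x} y p with ≤-total 0# y
    ... | inj₁ q = ≈-trans (∣x∣≈x (*-nonneg p q)) (*-congˡ (≈-sym (∣x∣≈x q)))
    ... | inj₂ q = begin
      ∣ x * y ∣      ≈⟨ ∣-x∣≈∣x∣ (x * y) ⟨
      ∣ - (x * y) ∣  ≈⟨ ∣∣-cong (-‿distribʳ-* x y) ⟩
      ∣ x * - y ∣    ≈⟨ ∣x∣≈x (*-nonneg p (x≤0⇒0≤-x q)) ⟩
      x * - y        ≈⟨ *-congˡ (x≤0⇒∣x∣≈-x q) ⟨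
      x * ∣ y ∣      ∎
      where open ≈-Reasoning

  ∣x*y∣≈∣x∣*∣y∣ : ∀ x y → ∣ x * y ∣ ≈ ∣ x ∣ * ∣ y ∣
  ∣x*y∣≈∣x∣*∣y∣ x y with ≤-total 0# x
  ... | inj₁ p = ≈-trans (nonneg y p) (*-congʳ (≈-sym (∣x∣≈x p)))
  ... | inj₂ p = begin
    ∣ x * y ∣        ≈⟨ ∣-x∣≈∣x∣ (x * y) ⟨
    ∣ - (x * y) ∣    ≈⟨ ∣∣-cong (-‿distribˡ-* x y) ⟩
    ∣ - x * y ∣      ≈⟨ nonneg y (x≤0⇒0≤-x p) ⟩
    - x * ∣ y ∣      ≈⟨ *-congʳ (x≤0⇒∣x∣≈-x p) ⟨
    ∣ x ∣ * ∣ y ∣    ∎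
    where open ≈-Reasoning

  ⁻¹-inverseˡ : ¬ x ≈ 0# → x ⁻¹ * x ≈ 1#
  ⁻¹-inverseˡ p = ≈-trans (*-comm _ _) (⁻¹-inverse p)

  0<⇒≉0 : 0# < x → ¬ x ≈ 0#
  0<⇒≉0 p e = <⇒≉ p (≈-sym e)

  ⁻¹-positive : 0# < x → 0# < x ⁻¹
  ⁻¹-positive {x} p with compare 0# (x ⁻¹)
  ... | tri< q _ _ = q
  ... | tri≈ _ q _ = contradiction
    (≈-trans (≈-sym (⁻¹-inverse (0<⇒≉0 p))) (≈-trans (*-congˡ (≈-sym q)) (zeroʳ x))) 1≉0
  ... | tri> _ _ q = contradiction (≤-trans (*-nonneg (<⇒≤ p) (x≤0⇒0≤-x (<⇒≤ q)))
    (≤-reflexive (≈-trans (≈-sym (-‿distribʳ-* x (x ⁻¹))) (-‿cong (⁻¹-inverse (0<⇒≉0 p))))))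
    λ r → <⇒≱ 0<1 (≤-trans (≤-reflexive (≈-sym (-‿involutive 1#))) (0≤x⇒-x≤0 r))

  x/y*y≈x : ∀ x → ¬ y ≈ 0# → x / y * y ≈ x
  x/y*y≈x x p = ≈-trans (*-assoc _ _ _) (≈-trans (*-congˡ (⁻¹-inverseˡ p)) (*-identityʳ x))

  *-cancelˡ-≤ : 0# < z → z * x ≤ z * y → x ≤ y
  *-cancelˡ-≤ {z} {x} {y} 0<z p = ≤-trans (≤-reflexive (≈-sym (cancel x)))
    (≤-trans (*-monoˡ-≤ (<⇒≤ (⁻¹-positive 0<z)) p) (≤-reflexive (cancel y)))
    where
    cancel : ∀ x → z ⁻¹ * (z * x) ≈ x
    cancel x = ≈-trans (≈-sym (*-assoc _ _ _))
      (≈-trans (*-congʳ (⁻¹-inverseˡ (0<⇒≉0 0<z))) (*-identityˡ x))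

  *-cancelˡ-≈ : ¬ z ≈ 0# → z * x ≈ z * y → x ≈ y
  *-cancelˡ-≈ {z} {x} {y} z≉0 p = ≈-trans (≈-sym (cancel x)) (≈-trans (*-congˡ p) (cancel y))
    where
    cancel : ∀ x → z ⁻¹ * (z * x) ≈ x
    cancel x = ≈-trans (≈-sym (*-assoc _ _ _))
      (≈-trans (*-congʳ (⁻¹-inverseˡ z≉0)) (*-identityˡ x))

  0<∣x∣ : ¬ x ≈ 0# → 0# < ∣ x ∣
  0<∣x∣ {x} x≉0 with ∣∣-nonneg x
  ... | inj₁ p = p
  ... | inj₂ p = contradiction x≈0 x≉0
    where
    x≈0 : x ≈ 0#
    x≈0 with ≤-total 0# x
    ... | inj₁ q = ≈-trans (≈-sym (∣x∣≈x q)) (≈-sym p)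
    ... | inj₂ q = ≈-trans (≈-sym (RingP.-‿involutive x))
      (≈-trans (-‿cong (≈-trans (≈-sym (x≤0⇒∣x∣≈-x q)) (≈-sym p))) -0#≈0#)

-- Formal power series, truncation and linear differential equations

module PowerSeries {c ℓ₁ ℓ₂} (K : ArchimedeanOrderedField c ℓ₁ ℓ₂) where
  open ArchimedeanOrderedField K hiding (sum; product)
  open FieldProperties K
  open SemiringSolver commutativeSemiring using (solve; _:+_; _:*_; _:=_)

  Series : Set c
  Series = ℕ → Scalar

  infix 4 _≋_
  _≋_ : Series → Series → Set ℓ₁
  f ≋ g = ∀ n → f n ≈ g n

  infixl 6 _⊞_
  infixl 7 _⊛_ _•_
  infix 8 ⊟_

  _⊞_ : Series → Series → Series
  (f ⊞ g) n = f n + g n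

  ⊟_ : Series → Series
  (⊟ f) n = - f n

  _•_ : Scalar → Series → Series
  (a • f) n = a * f n

  -- The Cauchy product, recursive in the left factor: `f ∘ suc` is the tail of f, and the ring laws
  -- follow by induction without arithmetic on indices n - k.
  _⊛_ : Series → Series → Series
  (f ⊛ g) zero    = f 0 * g 0
  (f ⊛ g) (suc n) = f 0 * g (suc n) + (f ∘ suc ⊛ g) n

  0ˢ 1ˢ : Series
  0ˢ _ = 0#
  1ˢ zero    = 1#
  1ˢ (suc _) = 0#

  ∂ : Series → Series
  ∂ f n = fromℕ (suc n) * f (suc n)

  -- Coefficient n of a product sees only degrees up to n; the inductions that compare solutions of
  -- differential equations rest on this.
  ⊛-cong≤ : ∀ n {f f′ g g′} → (∀ k → k ℕ.≤ n → f k ≈ f′ k) → (∀ k → k ℕ.≤ n → g k ≈ g′ k) →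
            (f ⊛ g) n ≈ (f′ ⊛ g′) n
  ⊛-cong≤ zero    p q = *-cong (p 0 ℕ.z≤n) (q 0 ℕ.z≤n)
  ⊛-cong≤ (suc n) p q = +-cong (*-cong (p 0 ℕ.z≤n) (q (suc n) ℕ.≤-refl))
    (⊛-cong≤ n (λ k k≤n → p (suc k) (ℕ.s≤s k≤n)) (λ k k≤n → q k (ℕ.m≤n⇒m≤1+n k≤n)))

  ⊛-cong : ∀ {f f′ g g′} → f ≋ f′ → g ≋ g′ → f ⊛ g ≋ f′ ⊛ g′
  ⊛-cong p q n = ⊛-cong≤ n (λ k _ → p k) (λ k _ → q k)

  ⊛-congˡ : ∀ {f g g′} → g ≋ g′ → f ⊛ g ≋ f ⊛ g′
  ⊛-congˡ q = ⊛-cong (λ _ → ≈-refl) q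

  ⊛-congʳ : ∀ {f f′ g} → f ≋ f′ → f ⊛ g ≋ f′ ⊛ g
  ⊛-congʳ p = ⊛-cong p (λ _ → ≈-refl)

  ⊛-distribʳ : ∀ h f g → (f ⊞ g) ⊛ h ≋ f ⊛ h ⊞ g ⊛ h
  ⊛-distribʳ h f g zero    = distribʳ (h 0) (f 0) (g 0)
  ⊛-distribʳ h f g (suc n) = ≈-trans (+-congˡ (⊛-distribʳ h (f ∘ suc) (g ∘ suc) n))
    (solve 5 (λ a b c x y → (a :+ b) :* c :+ (x :+ y) := (a :* c :+ x) :+ (b :* c :+ y)) ≈-refl
      (f 0) (g 0) (h (suc n)) ((f ∘ suc ⊛ h) n) ((g ∘ suc ⊛ h) n))

  ⊛-distribˡ : ∀ h f g → h ⊛ (f ⊞ g) ≋ h ⊛ f ⊞ h ⊛ g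
  ⊛-distribˡ h f g zero    = distribˡ (h 0) (f 0) (g 0)
  ⊛-distribˡ h f g (suc n) = ≈-trans (+-congˡ (⊛-distribˡ (h ∘ suc) f g n))
    (solve 5 (λ a b c x y → c :* (a :+ b) :+ (x :+ y) := (c :* a :+ x) :+ (c :* b :+ y)) ≈-refl
      (f (suc n)) (g (suc n)) (h 0) ((h ∘ suc ⊛ f) n) ((h ∘ suc ⊛ g) n))

  •-⊛ : ∀ a f g → (a • f) ⊛ g ≋ a • (f ⊛ g)
  •-⊛ a f g zero    = *-assoc a (f 0) (g 0)
  •-⊛ a f g (suc n) = ≈-trans (+-congˡ (•-⊛ a (f ∘ suc) g n))
    (solve 4 (λ a x y z → (a :* x) :* y :+ a :* z := a :* (x :* y :+ z)) ≈-refl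
      a (f 0) (g (suc n)) ((f ∘ suc ⊛ g) n))

  ⊛-zeroˡ : ∀ f → 0ˢ ⊛ f ≋ 0ˢ
  ⊛-zeroˡ f zero    = zeroˡ (f 0)
  ⊛-zeroˡ f (suc n) = ≈-trans (+-cong (zeroˡ _) (⊛-zeroˡ f n)) (+-identityˡ 0#)

  ⊛-identityˡ : ∀ f → 1ˢ ⊛ f ≋ f
  ⊛-identityˡ f zero    = *-identityˡ (f 0)
  ⊛-identityˡ f (suc n) = ≈-trans (+-cong (*-identityˡ _) (⊛-zeroˡ f n)) (+-identityʳ _)

  ⊛-suc : ∀ f g n → (f ⊛ g) (suc n) ≈ (f ⊛ g ∘ suc) n + f (suc n) * g 0
  ⊛-suc f g zero    = ≈-refl
  ⊛-suc f g (suc n) = ≈-trans (+-congˡ (⊛-suc (f ∘ suc) g n)) (≈-sym (+-assoc _ _ _))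

  ⊛-comm : ∀ f g → f ⊛ g ≋ g ⊛ f
  ⊛-comm f g zero    = *-comm (f 0) (g 0)
  ⊛-comm f g (suc n) = begin
    f 0 * g (suc n) + (f ∘ suc ⊛ g) n  ≈⟨ +-cong (*-comm _ _) (⊛-comm (f ∘ suc) g n) ⟩
    g (suc n) * f 0 + (g ⊛ f ∘ suc) n  ≈⟨ +-comm _ _ ⟩
    (g ⊛ f ∘ suc) n + g (suc n) * f 0  ≈⟨ ⊛-suc g f n ⟨
    (g ⊛ f) (suc n)                    ∎
    where open ≈-Reasoning

  ⊛-assoc : ∀ f g h → (f ⊛ g) ⊛ h ≋ f ⊛ (g ⊛ h)
  ⊛-assoc f g h zero    = *-assoc _ _ _
  ⊛-assoc f g h (suc n) = begin
    f 0 * g 0 * h (suc n) + ((f 0 • (g ∘ suc) ⊞ f ∘ suc ⊛ g) ⊛ h) n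
      ≈⟨ +-congˡ (⊛-distribʳ h (f 0 • (g ∘ suc)) (f ∘ suc ⊛ g) n) ⟩
    f 0 * g 0 * h (suc n) + (((f 0 • (g ∘ suc)) ⊛ h) n + ((f ∘ suc ⊛ g) ⊛ h) n)
      ≈⟨ +-congˡ (+-cong (•-⊛ (f 0) (g ∘ suc) h n) (⊛-assoc (f ∘ suc) g h n)) ⟩
    f 0 * g 0 * h (suc n) + (f 0 * (g ∘ suc ⊛ h) n + (f ∘ suc ⊛ (g ⊛ h)) n)
      ≈⟨ solve 5 (λ a b c x y → a :* b :* c :+ (a :* x :+ y) := a :* (b :* c :+ x) :+ y) ≈-refl
           (f 0) (g 0) (h (suc n)) _ _ ⟩
    f 0 * (g 0 * h (suc n) + (g ∘ suc ⊛ h) n) + (f ∘ suc ⊛ (g ⊛ h)) n  ∎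
    where open ≈-Reasoning

  seriesRing : CommutativeRing c ℓ₁
  seriesRing = record
    { Carrier = Series ; _≈_ = _≋_ ; _+_ = _⊞_ ; _*_ = _⊛_ ; -_ = ⊟_ ; 0# = 0ˢ ; 1# = 1ˢ
    ; isCommutativeRing = record
      { isRing = record
        { +-isAbelianGroup = record
          { isGroup = record
            { isMonoid = record
              { isSemigroup = record
                { isMagma = record
                  { isEquivalence = record
                    { refl = λ _ → ≈-refl ; sym = λ p n → ≈-sym (p n)
                    ; trans = λ p q n → ≈-trans (p n) (q n) }
                  ; ∙-cong = λ p q n → +-cong (p n) (q n) }
                ; assoc = λ f g h n → +-assoc (f n) (g n) (h n) }
              ; identity = (λ f n → +-identityˡ (f n)) , (λ f n → +-identityʳ (f n)) }
            ; inverse = (λ f n → -‿inverseˡ (f n)) , (λ f n → -‿inverseʳ (f n))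
            ; ⁻¹-cong = λ p n → -‿cong (p n) }
          ; comm = λ f g n → +-comm (f n) (g n) }
        ; *-cong = ⊛-cong
        ; *-assoc = ⊛-assoc
        ; *-identity = ⊛-identityˡ , λ f n → ≈-trans (⊛-comm f 1ˢ n) (⊛-identityˡ f n)
        ; distrib = ⊛-distribˡ , ⊛-distribʳ }
      ; *-comm = ⊛-comm } }

  module Ser = CommutativeRing seriesRing
  module SerP = RingProperties Ser.ring
  module SerSolver = SemiringSolver Ser.commutativeSemiring

  -- In degree n + 1 the factor n + 2 splits as (n + 1) + 1. The first part turns `P` into the
  -- inductive case for the tail of f; the second supplies the difference, recorded in `shift`,
  -- between the tail of ∂ f and ∂ of the tail.
  ∂-⊛ : ∀ f g → ∂ (f ⊛ g) ≋ ∂ f ⊛ g ⊞ f ⊛ ∂ g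
  ∂-⊛ f g zero    =
    solve 5 (λ o a b c d → o :* (a :* d :+ b :* c) := (o :* b) :* c :+ a :* (o :* d)) ≈-refl
      (fromℕ 1) (f 0) (f 1) (g 0) (g 1)
  ∂-⊛ f g (suc n) = begin
    (1# + N) * (f 0 * g (2 ℕ.+ n) + P)
      ≈⟨ solve 5 (λ o m a c P → (o :+ m) :* (a :* c :+ P) := a :* ((o :+ m) :* c) :+ (m :* P :+ o :* P))
           ≈-refl 1# N (f 0) (g (2 ℕ.+ n)) P ⟩
    f 0 * ∂ g (suc n) + (N * P + 1# * P)
      ≈⟨ +-congˡ (+-cong (∂-⊛ (f ∘ suc) g n) (*-identityˡ P)) ⟩
    f 0 * ∂ g (suc n) + (((∂ (f ∘ suc) ⊛ g) n + (f ∘ suc ⊛ ∂ g) n) + (f 1 * g (suc n) + (f ∘ (2 ℕ.+_) ⊛ g) n))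
      ≈⟨ solve 6 (λ a x y b c z → a :+ ((x :+ y) :+ (b :* c :+ z)) := (b :* c :+ (x :+ z)) :+ (a :+ y)) ≈-refl
           (f 0 * ∂ g (suc n)) _ _ (f 1) (g (suc n)) _ ⟩
    (f 1 * g (suc n) + ((∂ (f ∘ suc) ⊛ g) n + (f ∘ (2 ℕ.+_) ⊛ g) n)) + (f ⊛ ∂ g) (suc n)
      ≈⟨ +-congʳ (+-cong (*-congʳ (≈-sym (≈-trans (*-congʳ (+-identityʳ 1#)) (*-identityˡ (f 1)))))
           (≈-sym (≈-trans (⊛-congʳ shift n) (⊛-distribʳ g (∂ (f ∘ suc)) (f ∘ (2 ℕ.+_)) n)))) ⟩
    (∂ f ⊛ g) (suc n) + (f ⊛ ∂ g) (suc n)  ∎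
    where
    open ≈-Reasoning
    N P : Scalar
    N = fromℕ (suc n)
    P = (f ∘ suc ⊛ g) (suc n)
    shift : ∂ f ∘ suc ≋ ∂ (f ∘ suc) ⊞ f ∘ (2 ℕ.+_)
    shift k = ≈-trans (distribʳ _ 1# _) (≈-trans (+-comm _ _) (+-congˡ (*-identityˡ _)))

  ∂-• : ∀ a f → ∂ (a • f) ≋ a • ∂ f
  ∂-• a f n = solve 3 (λ m a x → m :* (a :* x) := a :* (m :* x)) ≈-refl (fromℕ (suc n)) a (f (suc n))

  ∂-⊞ : ∀ f g → ∂ (f ⊞ g) ≋ ∂ f ⊞ ∂ g
  ∂-⊞ f g n = distribˡ _ _ _

  ∂-⊟ : ∀ f → ∂ (⊟ f) ≋ ⊟ ∂ f
  ∂-⊟ f n = ≈-sym (RingP.-‿distribʳ-* _ _)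

  ∂-1ˢ : ∂ 1ˢ ≋ 0ˢ
  ∂-1ˢ n = zeroʳ _

  ∂-injective : ∀ {f g} → f 0 ≈ g 0 → ∂ f ≋ ∂ g → f ≋ g
  ∂-injective p q zero    = p
  ∂-injective p q (suc n) = *-cancelˡ-≈ (fromℕ≉0 (suc n)) (q n)

  low high : ℕ → Series → Series
  low zero    f _       = 0#
  low (suc N) f zero    = f 0
  low (suc N) f (suc k) = low N (f ∘ suc) k
  high zero    f k       = f k
  high (suc N) f zero    = 0#
  high (suc N) f (suc k) = high N (f ∘ suc) k

  low+high : ∀ N f → low N f ⊞ high N f ≋ f
  low+high zero    f k       = +-identityˡ (f k)
  low+high (suc N) f zero    = +-identityʳ (f 0)
  low+high (suc N) f (suc k) = low+high N (f ∘ suc) k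

  low-< : ∀ N f k → k ℕ.< N → low N f k ≈ f k
  low-< (suc N) f zero    _         = ≈-refl
  low-< (suc N) f (suc k) (ℕ.s≤s p) = low-< N (f ∘ suc) k p

  low-≥ : ∀ N f k → N ℕ.≤ k → low N f k ≈ 0#
  low-≥ zero    f k       _         = ≈-refl
  low-≥ (suc N) f (suc k) (ℕ.s≤s p) = low-≥ N (f ∘ suc) k p

  high-< : ∀ N f k → k ℕ.< N → high N f k ≈ 0#
  high-< (suc N) f zero    _         = ≈-refl
  high-< (suc N) f (suc k) (ℕ.s≤s p) = high-< N (f ∘ suc) k p

  high-≥ : ∀ N f k → N ℕ.≤ k → high N f k ≈ f k
  high-≥ zero    f k       _         = ≈-refl
  high-≥ (suc N) f (suc k) (ℕ.s≤s p) = high-≥ N (f ∘ suc) k p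

  ⊛-mono-≤ : ∀ n {f f′ g g′} → (∀ k → 0# ≤ f k) → (∀ k → k ℕ.≤ n → f k ≤ f′ k) →
             (∀ k → 0# ≤ g k) → (∀ k → k ℕ.≤ n → g k ≤ g′ k) → (f ⊛ g) n ≤ (f′ ⊛ g′) n
  ⊛-mono-≤ zero    f≥0 p g≥0 q = *-mono-≤ (f≥0 0) (p 0 ℕ.z≤n) (g≥0 0) (q 0 ℕ.z≤n)
  ⊛-mono-≤ (suc n) f≥0 p g≥0 q =
    +-mono-≤ (*-mono-≤ (f≥0 0) (p 0 ℕ.z≤n) (g≥0 (suc n)) (q (suc n) ℕ.≤-refl))
      (⊛-mono-≤ n (f≥0 ∘ suc) (λ k k≤n → p (suc k) (ℕ.s≤s k≤n)) g≥0 (λ k k≤n → q k (ℕ.m≤n⇒m≤1+n k≤n)))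

  ∣_∣ˢ : Series → Series
  ∣ f ∣ˢ n = ∣ f n ∣

  ∣⊛∣≤ : ∀ n f g → ∣ (f ⊛ g) n ∣ ≤ (∣ f ∣ˢ ⊛ ∣ g ∣ˢ) n
  ∣⊛∣≤ zero    f g = ≤-reflexive (∣x*y∣≈∣x∣*∣y∣ (f 0) (g 0))
  ∣⊛∣≤ (suc n) f g = ≤-trans (∣x+y∣≤∣x∣+∣y∣ _ _)
    (+-mono-≤ (≤-reflexive (∣x*y∣≈∣x∣*∣y∣ (f 0) (g (suc n)))) (∣⊛∣≤ n (f ∘ suc) g))

  ∣⊛∣-mono-≤ : ∀ n {f f′ g g′} → (∀ k → k ℕ.≤ n → ∣ f k ∣ ≤ f′ k) →
               (∀ k → k ℕ.≤ n → ∣ g k ∣ ≤ g′ k) → ∣ (f ⊛ g) n ∣ ≤ (f′ ⊛ g′) n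
  ∣⊛∣-mono-≤ n {f} {g = g} p q =
    ≤-trans (∣⊛∣≤ n f g) (⊛-mono-≤ n (λ k → ∣∣-nonneg (f k)) p (λ k → ∣∣-nonneg (g k)) q)

  ∣∂∣≈ : ∀ f n → ∣ ∂ f n ∣ ≈ fromℕ (suc n) * ∣ f (suc n) ∣
  ∣∂∣≈ f n = ≈-trans (∣x*y∣≈∣x∣*∣y∣ _ _) (*-congʳ (∣x∣≈x (fromℕ-nonneg (suc n))))

  -- The equation computes coefficient n + 1 from those up to n, with a positive factor n + 1 to
  -- divide by, so the inequality propagates from each degree to the next.
  ode-majorant : ∀ {p q x y} → ∂ x ≋ p ⊛ x → ∂ y ≋ q ⊛ y → (∀ k → ∣ p k ∣ ≤ q k) →
                 ∣ x 0 ∣ ≤ y 0 → ∀ n → ∣ x n ∣ ≤ y n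
  ode-majorant {p} {q} {x} {y} ∂x ∂y p≤q x₀≤y₀ n = below n n ℕ.≤-refl
    where
    -- `N` only bounds the strong induction on n.
    below : ∀ N n → n ℕ.≤ N → ∣ x n ∣ ≤ y n
    below _       zero    _             = x₀≤y₀
    below (suc N) (suc n) (ℕ.s≤s n≤N) = *-cancelˡ-≤ (0<fromℕ-suc n) (begin
      fromℕ (suc n) * ∣ x (suc n) ∣  ≈⟨ ∣∂∣≈ x n ⟨
      ∣ ∂ x n ∣                      ≈⟨ ∣∣-cong (∂x n) ⟩
      ∣ (p ⊛ x) n ∣                  ≤⟨ ∣⊛∣-mono-≤ n (λ k _ → p≤q k) (λ k k≤n → below N k (ℕ.≤-trans k≤n n≤N)) ⟩
      (q ⊛ y) n                      ≈⟨ ∂y n ⟨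
      fromℕ (suc n) * y (suc n)      ∎)
      where open ≤-Reasoning

  -- Integration gains one degree: the coefficients of p and q below N determine x and y through
  -- degree N.
  ode-agree : ∀ N {p q x y} → ∂ x ≋ p ⊛ x → ∂ y ≋ q ⊛ y → (∀ k → k ℕ.< N → p k ≈ q k) →
              x 0 ≈ y 0 → ∀ n → n ℕ.≤ N → x n ≈ y n
  ode-agree N {p} {q} {x} {y} ∂x ∂y p≈q x₀≈y₀ = λ n n≤N → below n n ℕ.≤-refl n≤N
    where
    below : ∀ M n → n ℕ.≤ M → n ℕ.≤ N → x n ≈ y n
    below _       zero    _           _   = x₀≈y₀
    below (suc M) (suc n) (ℕ.s≤s n≤M) n<N = *-cancelˡ-≈ (fromℕ≉0 (suc n)) (begin
      ∂ x n      ≈⟨ ∂x n ⟩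
      (p ⊛ x) n  ≈⟨ ⊛-cong≤ n (λ k k≤n → p≈q k (ℕ.≤-<-trans k≤n n<N))
                     (λ k k≤n → below M k (ℕ.≤-trans k≤n n≤M) (ℕ.≤-trans k≤n (ℕ.<⇒≤ n<N))) ⟩
      (q ⊛ y) n  ≈⟨ ∂y n ⟨
      ∂ y n      ∎)
      where open ≈-Reasoning

-- Asymptotics relative to a gargantuan scale

module Bender {c ℓ₁ ℓ₂} (K : ArchimedeanOrderedField c ℓ₁ ℓ₂) where
  open ArchimedeanOrderedField K hiding (product)
  open Asymptotics K
  open FieldProperties K
  open PowerSeries K
  open SemiringSolver commutativeSemiring using (solve; _:+_; _:*_; _:=_)

  ⊛-as-sum : ∀ n f g → (f ⊛ g) n ≈ sum (applyUpTo (λ i → f i * g (n ∸ i)) (suc n))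
  ⊛-as-sum zero    f g = ≈-sym (+-identityʳ _)
  ⊛-as-sum (suc n) f g = +-congˡ (⊛-as-sum n (f ∘ suc) g)

  sum-applyUpTo-cong : ∀ n {f g : Series} → (∀ i → i ℕ.< n → f i ≈ g i) →
                       sum (applyUpTo f n) ≈ sum (applyUpTo g n)
  sum-applyUpTo-cong zero    p = ≈-refl
  sum-applyUpTo-cong (suc n) p = +-cong (p 0 (ℕ.s≤s ℕ.z≤n)) (sum-applyUpTo-cong n (λ i i<n → p (suc i) (ℕ.s≤s i<n)))

  -- Connects the product form of an expansion with the partial sums of the theorem. The condition
  -- `R ℕ.≤ suc n` keeps every `n ∸ k` a genuine difference.
  low-⊛-as-sum : ∀ R n f g → R ℕ.≤ suc n → (low R f ⊛ g) n ≈ sum (applyUpTo (λ k → f k * g (n ∸ k)) R)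
  low-⊛-as-sum zero          n       f g _          = ⊛-zeroˡ g n
  low-⊛-as-sum (suc zero)    zero    f g _          = ≈-sym (+-identityʳ _)
  low-⊛-as-sum (suc (suc R)) zero    f g (ℕ.s≤s ())
  low-⊛-as-sum (suc R)       (suc n) f g (ℕ.s≤s R≤) = +-congˡ (low-⊛-as-sum R n (f ∘ suc) g R≤)

  sum-applyUpTo-*ʳ : ∀ z (f : Series) n → sum (applyUpTo f n) * z ≈ sum (applyUpTo (λ k → f k * z) n)
  sum-applyUpTo-*ʳ z f zero    = zeroˡ z
  sum-applyUpTo-*ʳ z f (suc n) = ≈-trans (distribʳ z _ _) (+-congˡ (sum-applyUpTo-*ʳ z (f ∘ suc) n))

  sum-applyUpTo-last : ∀ n (f : ℕ → Scalar) → sum (applyUpTo f (suc n)) ≈ sum (applyUpTo f n) + f n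
  sum-applyUpTo-last zero    f = +-comm _ _
  sum-applyUpTo-last (suc n) f = ≈-trans (+-congˡ (sum-applyUpTo-last n (f ∘ suc))) (≈-sym (+-assoc _ _ _))

  high-⊛ : ∀ r f g n → (high r f ⊛ g) (r ℕ.+ n) ≈ (f ∘ (r ℕ.+_) ⊛ g) n
  high-⊛ zero    f g n = ≈-refl
  high-⊛ (suc r) f g n =
    ≈-trans (+-cong (zeroˡ _) (high-⊛ r (f ∘ suc) g n)) (+-identityˡ _)

  ⊛-high : ∀ r f g n → (f ⊛ high r g) (r ℕ.+ n) ≈ (f ⊛ g ∘ (r ℕ.+_)) n
  ⊛-high r f g n = ≈-trans (⊛-comm f (high r g) (r ℕ.+ n)) (≈-trans (high-⊛ r g f n) (⊛-comm _ f n))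

  high-mono : ∀ r {f g : Series} → (∀ n → ∣ f n ∣ ≤ g n) → ∀ n → ∣ high r f n ∣ ≤ high r g n
  high-mono zero    p n       = p n
  high-mono (suc r) p zero    = ≤-reflexive (∣x∣≈x ≤-refl)
  high-mono (suc r) p (suc n) = high-mono r (p ∘ suc) n

  low-cong : ∀ r {f g : Series} → (∀ n → n ℕ.< r → f n ≈ g n) → low r f ≋ low r g
  low-cong zero    p n       = ≈-refl
  low-cong (suc r) p zero    = p 0 (ℕ.s≤s ℕ.z≤n)
  low-cong (suc r) p (suc n) = low-cong r (λ k k<r → p (suc k) (ℕ.s≤s k<r)) n

  Supported : ℕ → Series → Set ℓ₁
  Supported R p = ∀ k → R ℕ.≤ k → p k ≈ 0#

  module WithScale (α : Series) (α≥0 : ∀ n → 0# ≤ α n) (gargantuan : Gargantuan α) where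
    open Gargantuan gargantuan

    α-positive : ∃[ N ] ∀ n → N ℕ.≤ n → 0# < α n
    α-positive = proj₁ nonzero , λ n N≤n → pos (α≥0 n) (proj₂ nonzero n N≤n)
      where
      pos : ∀ {x} → 0# ≤ x → ¬ x ≈ 0# → 0# < x
      pos (inj₁ p) _ = p
      pos (inj₂ p) q = contradiction (≈-sym p) q

    -- The ratio condition multiplied out, so that later estimates contain no division.
    α-ratio : ∀ ε → 0# < ε → ∃[ N ] ∀ n → N ℕ.≤ n → α (n ∸ 1) ≤ ε * α n
    α-ratio ε 0<ε with α-positive | ratio ε 0<ε
    ... | N , pos | M , small = N ℕ.⊔ M , λ n p → bound n (pos n (ℕ.m⊔n≤o⇒m≤o N M p)) (small n (ℕ.m⊔n≤o⇒n≤o N M p))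
      where
      bound : ∀ n → 0# < α n → ∣ α (n ∸ 1) / α n ∣ < ε → α (n ∸ 1) ≤ ε * α n
      bound n 0<αn p = begin
        α (n ∸ 1)              ≈⟨ x/y*y≈x (α (n ∸ 1)) (0<⇒≉0 0<αn) ⟨
        α (n ∸ 1) / α n * α n  ≤⟨ *-monoʳ-≤ (<⇒≤ 0<αn) (≤-trans (x≤∣x∣ _) (<⇒≤ p)) ⟩
        ε * α n                ∎
        where open ≤-Reasoning

    α-mono : ∃[ N ] ∀ n → N ℕ.≤ n → α (n ∸ 1) ≤ α n
    α-mono with α-ratio 1# 0<1
    ... | N , p = N , λ n N≤n → ≤-trans (p n N≤n) (≤-reflexive (*-identityˡ _))

    -- x n = O(α (n − r))
    record O (r : ℕ) (x : Series) : Set (c ⊔ ℓ₁ ⊔ ℓ₂) where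
      constructor bounded
      field
        κ         : Scalar
        κ-nonneg  : 0# ≤ κ
        N         : ℕ
        bound     : ∀ n → N ℕ.≤ n → ∣ x n ∣ ≤ κ * α (n ∸ r)

    O-resp : ∀ {r x y} → x ≋ y → O r x → O r y
    O-resp e (bounded κ κ≥0 N p) = bounded κ κ≥0 N λ n N≤n → ≤-trans (≤-reflexive (∣∣-cong (≈-sym (e n)))) (p n N≤n)

    O-⊞ : ∀ {r x y} → O r x → O r y → O r (x ⊞ y)
    O-⊞ {r} {x} {y} (bounded κ κ≥0 N p) (bounded D D≥0 M q) = bounded (κ + D) (+-nonneg κ≥0 D≥0) (N ℕ.⊔ M) λ n N≤n →
      ≤-trans (∣x+y∣≤∣x∣+∣y∣ (x n) (y n))
        (≤-trans (+-mono-≤ (p n (ℕ.m⊔n≤o⇒m≤o N M N≤n)) (q n (ℕ.m⊔n≤o⇒n≤o N M N≤n)))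
          (≤-reflexive (≈-sym (distribʳ _ κ D))))

    O-⊟ : ∀ {r x} → O r x → O r (⊟ x)
    O-⊟ {x = x} (bounded κ κ≥0 N p) = bounded κ κ≥0 N λ n N≤n → ≤-trans (≤-reflexive (∣-x∣≈∣x∣ (x n))) (p n N≤n)

    O-• : ∀ {r x} a → O r x → O r (a • x)
    O-• {x = x} a (bounded κ κ≥0 N p) = bounded (∣ a ∣ * κ) (*-nonneg (∣∣-nonneg a) κ≥0) N λ n N≤n →
      ≤-trans (≤-reflexive (∣x*y∣≈∣x∣*∣y∣ a (x n)))
        (≤-trans (*-monoˡ-≤ (∣∣-nonneg a) (p n N≤n)) (≤-reflexive (≈-sym (*-assoc _ _ _))))

    O-weaken : ∀ {r x} → O (suc r) x → O r x
    O-weaken {r} {x} (bounded κ κ≥0 N p) with α-mono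
    -- The threshold M + r gives n - r ≥ M, where the monotonicity of α holds.
    ... | M , mono = bounded κ κ≥0 (N ℕ.⊔ (M ℕ.+ r)) λ n N≤n →
      ≤-trans (p n (ℕ.m⊔n≤o⇒m≤o N _ N≤n)) (*-monoˡ-≤ κ≥0
        (≡.subst (λ k → α k ≤ α (n ∸ r)) (≡.trans (ℕ.∸-+-assoc n r 1) (≡.cong (n ∸_) (ℕ.+-comm r 1)))
          (mono (n ∸ r) (ℕ.m+n≤o⇒m≤o∸n M (ℕ.m⊔n≤o⇒n≤o N _ N≤n)))))

    O-dominated : ∀ {r x y} → (∀ n → ∣ x n ∣ ≤ y n) → O r y → O r x
    O-dominated p (bounded κ κ≥0 N q) = bounded κ κ≥0 N λ n N≤n → ≤-trans (p n) (≤-trans (x≤∣x∣ _) (q n N≤n))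

    O-supported : ∀ {r x} R → Supported R x → O r x
    O-supported {r} R p = bounded 0# ≤-refl R λ n R≤n →
      ≤-reflexive (≈-trans (∣∣-cong (p n R≤n)) (≈-trans (∣x∣≈x ≤-refl) (≈-sym (zeroˡ _))))

    α∈O : O 0 α
    α∈O = bounded 1# 0≤1 0 λ n _ → ≤-reflexive (≈-trans (∣x∣≈x (α≥0 n)) (≈-sym (*-identityˡ _)))

    O-shift : ∀ {r x y} → (∀ n → x (suc n) ≈ y n) → O r y → O (suc r) x
    O-shift {r} {x} e (bounded κ κ≥0 N p) = bounded κ κ≥0 (suc N) bound
      where
      bound : ∀ n → suc N ℕ.≤ n → ∣ x n ∣ ≤ κ * α (n ∸ suc r)
      bound (suc n) (ℕ.s≤s N≤n) = ≤-trans (≤-reflexive (∣∣-cong (e n))) (p n N≤n)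

    -- Write p = p(0) + z p₁. Multiplication by z improves the bound by one order, and `O-weaken`
    -- gives this gain back.
    O-polynomial : ∀ R {r p x} → Supported R p → O r x → O r (p ⊛ x)
    O-polynomial zero    {p = p} {x} p≈0 _ =
      O-supported 0 λ n _ → ≈-trans (⊛-congʳ (λ k → p≈0 k ℕ.z≤n) n) (⊛-zeroˡ x n)
    O-polynomial (suc R) {p = p} {x} p≈0 x∈O = O-resp split
      (O-⊞ (O-• (p 0) x∈O)
           (O-weaken (O-shift {x = tail} (λ _ → ≈-refl)
             (O-polynomial R (λ k R≤k → p≈0 (suc k) (ℕ.s≤s R≤k)) x∈O))))
      where
      tail : Series
      tail zero    = 0#
      tail (suc n) = (p ∘ suc ⊛ x) n
      split : p 0 • x ⊞ tail ≋ p ⊛ x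
      split zero    = +-identityʳ _
      split (suc n) = ≈-refl

    -- Each vanishing initial coefficient is a factor z, and each factor z replaces α(n - s) by α(n
    -- - s - 1).
    O-polynomial-high : ∀ r R {p} → Supported R p → (∀ k → k ℕ.< r → p k ≈ 0#) → O r (p ⊛ α)
    O-polynomial-high zero    R p≈0 _ = O-polynomial R p≈0 α∈O
    O-polynomial-high (suc r) R {p} p≈0 low≈0 = O-shift
      (λ n → ≈-trans (+-congʳ (≈-trans (*-congʳ (low≈0 0 (ℕ.s≤s ℕ.z≤n))) (zeroˡ _))) (+-identityˡ _))
      (O-polynomial-high r R (λ k R≤k → p≈0 (suc k) (ℕ.m≤n⇒m≤1+n R≤k)) (λ k k<r → low≈0 (suc k) (ℕ.s≤s k<r)))

    low-supported : ∀ r f → Supported r (low r f)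
    low-supported r f = low-≥ r f

    high-O : ∀ r {s x} → O s x → O s (high r x)
    high-O r {x = x} x∈O = O-resp (λ n → ≈-trans (+-congʳ (≈-sym (low+high r x n)))
        (≈-trans (+-congʳ (+-comm _ _)) (≈-trans (+-assoc _ _ _) (≈-trans (+-congˡ (-‿inverseʳ _)) (+-identityʳ _)))))
      (O-⊞ x∈O (O-⊟ (O-supported r (low-supported r x))))

    -- This is condition (ii) on gargantuan sequences: for n ≥ 2r, coefficient n of the product of
    -- the two tails is the convolution over r ≤ k ≤ n - r.
    high⊛high∈O : ∀ r → O r (high r α ⊛ high r α)
    high⊛high∈O r with convolution r
    -- `convolution` gives a constant of unknown sign, hence the absolute value. The threshold r + r
    -- lets n be written as r + (r + t).
    ... | κ , N , p = bounded ∣ κ ∣ (∣∣-nonneg κ) (N ℕ.⊔ (r ℕ.+ r)) λ n N≤n →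
      bound n (ℕ.m⊔n≤o⇒n≤o N _ N≤n) (p n (ℕ.m⊔n≤o⇒m≤o N _ N≤n))
      where
      S : Series
      S n = ∑[ r ⋯ n ∸ r ] λ k → ∣ α k * α (n ∸ k) ∣
      as-sum : ∀ t → (high r α ⊛ high r α) (r ℕ.+ (r ℕ.+ t)) ≈ S (r ℕ.+ (r ℕ.+ t))
      as-sum t = begin
        (high r α ⊛ high r α) (r ℕ.+ (r ℕ.+ t))           ≈⟨ high-⊛ r α (high r α) (r ℕ.+ t) ⟩
        (α ∘ (r ℕ.+_) ⊛ high r α) (r ℕ.+ t)               ≈⟨ ⊛-high r _ α t ⟩
        (α ∘ (r ℕ.+_) ⊛ α ∘ (r ℕ.+_)) t                   ≈⟨ ⊛-as-sum t _ _ ⟩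
        sum (applyUpTo (λ i → α (r ℕ.+ i) * α (r ℕ.+ (t ∸ i))) (suc t))
          ≈⟨ sum-applyUpTo-cong (suc t) term ⟩
        sum (applyUpTo (λ i → ∣ α (r ℕ.+ i) * α (r ℕ.+ (r ℕ.+ t) ∸ (r ℕ.+ i)) ∣) (suc t))
          ≡⟨ ≡.cong (λ u → sum (applyUpTo (λ i → ∣ α (r ℕ.+ i) * α (r ℕ.+ (r ℕ.+ t) ∸ (r ℕ.+ i)) ∣) u)) count ⟨
        S (r ℕ.+ (r ℕ.+ t))                               ∎
        where
        open ≈-Reasoning
        count : suc (r ℕ.+ (r ℕ.+ t) ∸ r) ∸ r ≡ suc t
        count = ≡.trans (≡.cong (λ u → suc u ∸ r) (ℕ.m+n∸m≡n r (r ℕ.+ t)))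
                  (≡.trans (≡.cong (_∸ r) (≡.sym (ℕ.+-suc r t))) (ℕ.m+n∸m≡n r (suc t)))
        term : ∀ i → i ℕ.< suc t → α (r ℕ.+ i) * α (r ℕ.+ (t ∸ i)) ≈
               ∣ α (r ℕ.+ i) * α (r ℕ.+ (r ℕ.+ t) ∸ (r ℕ.+ i)) ∣
        term i (ℕ.s≤s i≤t) = ≈-trans (≈-sym (∣x∣≈x (*-nonneg (α≥0 _) (α≥0 _))))
          (reflexive (≡.cong (λ u → ∣ α (r ℕ.+ i) * α u ∣)
            (≡.sym (≡.trans (ℕ.[m+n]∸[m+o]≡n∸o r (r ℕ.+ t) i) (ℕ.+-∸-assoc r i≤t)))))
      bound : ∀ n → r ℕ.+ r ℕ.≤ n → ∣ S n ∣ ≤ κ * ∣ α (n ∸ r) ∣ →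
              ∣ (high r α ⊛ high r α) n ∣ ≤ ∣ κ ∣ * α (n ∸ r)
      bound n 2r≤n q = begin
        ∣ (high r α ⊛ high r α) n ∣  ≈⟨ ∣∣-cong eq ⟩
        ∣ S n ∣                      ≤⟨ q ⟩
        κ * ∣ α (n ∸ r) ∣            ≈⟨ *-congˡ (∣x∣≈x (α≥0 _)) ⟩
        κ * α (n ∸ r)                ≤⟨ *-monoʳ-≤ (α≥0 _) (x≤∣x∣ κ) ⟩
        ∣ κ ∣ * α (n ∸ r)            ∎
        where
        open ≤-Reasoning
        n≡ : r ℕ.+ (r ℕ.+ (n ∸ (r ℕ.+ r))) ≡ n
        n≡ = ≡.trans (≡.sym (ℕ.+-assoc r r _)) (ℕ.m+[n∸m]≡n 2r≤n)
        eq : (high r α ⊛ high r α) n ≈ S n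
        eq = ≡.subst (λ n → (high r α ⊛ high r α) n ≈ S n) n≡ (as-sum (n ∸ (r ℕ.+ r)))

    Dominated : Series → Set _
    Dominated f = ∀ n → ∣ f n ∣ ≤ α n

    high⊛high-dominated : ∀ r {f g} → Dominated f → Dominated g → O r (high r f ⊛ high r g)
    high⊛high-dominated r p q = O-dominated
      (λ n → ∣⊛∣-mono-≤ n (λ k _ → high-mono r p k) (λ k _ → high-mono r q k)) (high⊛high∈O r)

    -- f n = ∑_{k < r} d k * α (n − k) + O(α (n − r)) for every r, written as a
    -- product of series so that it can be manipulated algebraically.
    Expands : Series → Series → Set _
    Expands f d = ∀ r → O r (f ⊞ ⊟ (low r d ⊛ α))

    Expands-resp : ∀ {f f′ d d′} → f ≋ f′ → d ≋ d′ → Expands f d → Expands f′ d′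
    Expands-resp e e′ p r = O-resp (λ n → +-cong (e n) (-‿cong (⊛-congʳ (low-cong r (λ k _ → e′ k)) n))) (p r)

    low-• : ∀ r a f → low r (a • f) ≋ a • low r f
    low-• zero    a f n       = ≈-sym (zeroʳ a)
    low-• (suc r) a f zero    = ≈-refl
    low-• (suc r) a f (suc n) = low-• r a (f ∘ suc) n

    Expands-• : ∀ {f d} a → Expands f d → Expands (a • f) (a • d)
    Expands-• {f} {d} a p r = O-resp
      (λ n → ≈-trans (distribˡ a _ _) (+-congˡ (≈-trans (≈-sym (RingP.-‿distribʳ-* _ _))
        (-‿cong (≈-sym (≈-trans (⊛-congʳ (low-• r a d) n) (•-⊛ a (low r d) α n)))))))
      (O-• a (p r))

    1ˢ-expands : Expands 1ˢ 0ˢ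
    1ˢ-expands r = O-supported 1 λ { (suc k) _ →
      ≈-trans (+-identityˡ _) (≈-trans (-‿cong (≈-trans (⊛-congʳ (low-0 r) (suc k)) (⊛-zeroˡ α (suc k)))) RingP.-0#≈0#) }
      where
      low-0 : ∀ r → low r 0ˢ ≋ 0ˢ
      low-0 zero    n       = ≈-refl
      low-0 (suc r) zero    = ≈-refl
      low-0 (suc r) (suc n) = low-0 r n

    -- The map f ↦ c is Borinsky's alien derivative; this is its Leibniz rule.
    Expands-⊛ : ∀ {f g c d} → Dominated f → Dominated g → Expands f c → Expands g d →
                Expands (f ⊛ g) (f ⊛ d ⊞ g ⊛ c)
    Expands-⊛ {f} {g} {c} {d} f≤α g≤α f~c g~d r = O-resp regroup
      (O-⊞ (O-⊞ (O-⊞ (O-⊞ (high⊛high-dominated r f≤α g≤α)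
                             (O-⊟ (O-supported (r ℕ.+ r) (low⊛low r r f g))))
                      (O-polynomial r (low-supported r f) (g~d r)))
               (O-polynomial r (low-supported r g) (f~c r)))
        (O-polynomial-high r (r ℕ.+ r) excess-supported excess-low))
      where
      open SetoidReasoning Ser.setoid
      open SerSolver using () renaming (solve to solveˢ; _:+_ to _:⊞_; _:*_ to _:⊛_; _:=_ to _:≋_)
      low⊛low : ∀ R S f g → Supported (R ℕ.+ S) (low R f ⊛ low S g)
      low⊛low zero    S f g k p = ⊛-zeroˡ (low S g) k
      low⊛low (suc R) S f g (suc k) (ℕ.s≤s p) = ≈-trans (+-cong
        (≈-trans (*-congˡ (low-≥ S g (suc k) (ℕ.m≤n⇒m≤1+n (ℕ.m+n≤o⇒n≤o R p)))) (zeroʳ _))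
        (low⊛low R S (f ∘ suc) g k p)) (+-identityʳ _)
      f₀ f₁ g₀ g₁ c₀ d₀ e excess : Series
      f₀ = low r f
      f₁ = high r f
      g₀ = low r g
      g₁ = high r g
      c₀ = low r c
      d₀ = low r d
      e = low r (f ⊛ d ⊞ g ⊛ c)
      -- A polynomial that vanishes below degree r, where truncated and full products agree; its
      -- product with α is therefore O(α(n - r)).
      excess = (f₀ ⊛ d₀ ⊞ g₀ ⊛ c₀) ⊞ ⊟ e
      excess-supported : Supported (r ℕ.+ r) excess
      excess-supported k p = ≈-trans (+-cong (+-cong (low⊛low r r f d k p) (low⊛low r r g c k p))
        (-‿cong (low-≥ r _ k (ℕ.m+n≤o⇒m≤o r p)))) (≈-trans (+-cong (+-identityˡ 0#) RingP.-0#≈0#) (+-identityˡ 0#))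
      excess-low : ∀ k → k ℕ.< r → excess k ≈ 0#
      excess-low k k<r = ≈-trans (+-cong (+-cong (below f d) (below g c)) (-‿cong (low-< r _ k k<r))) (-‿inverseʳ _)
        where
        below : ∀ f d → (low r f ⊛ low r d) k ≈ (f ⊛ d) k
        below f d = ⊛-cong≤ k (λ j j≤k → low-< r f j (ℕ.≤-<-trans j≤k k<r)) (λ j j≤k → low-< r d j (ℕ.≤-<-trans j≤k k<r))
      -- Only f₁ g₁ has two high factors; f₀ g + g₀ f covers everything else but counts f₀ g₀ twice.
      product-split : f₁ ⊛ g₁ ⊞ ⊟ (f₀ ⊛ g₀) ⊞ f₀ ⊛ g ⊞ g₀ ⊛ f ≋ f ⊛ g
      product-split = begin
        f₁ ⊛ g₁ ⊞ ⊟ (f₀ ⊛ g₀) ⊞ f₀ ⊛ g ⊞ g₀ ⊛ f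
          ≈⟨ Ser.+-cong (Ser.+-congˡ {f₁ ⊛ g₁ ⊞ ⊟ (f₀ ⊛ g₀)} (Ser.*-congˡ {f₀} (low+high r g))) (Ser.*-congˡ {g₀} (low+high r f)) ⟨
        f₁ ⊛ g₁ ⊞ ⊟ (f₀ ⊛ g₀) ⊞ f₀ ⊛ (g₀ ⊞ g₁) ⊞ g₀ ⊛ (f₀ ⊞ f₁)
          ≈⟨ solveˢ 5 (λ f₀ f₁ g₀ g₁ n →
               f₁ :⊛ g₁ :⊞ n :⊞ f₀ :⊛ (g₀ :⊞ g₁) :⊞ g₀ :⊛ (f₀ :⊞ f₁)
               :≋ (f₀ :⊞ f₁) :⊛ (g₀ :⊞ g₁) :⊞ (f₀ :⊛ g₀ :⊞ n)) Ser.refl f₀ f₁ g₀ g₁ (⊟ (f₀ ⊛ g₀)) ⟩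
        (f₀ ⊞ f₁) ⊛ (g₀ ⊞ g₁) ⊞ (f₀ ⊛ g₀ ⊞ ⊟ (f₀ ⊛ g₀))
          ≈⟨ Ser.+-cong (Ser.*-cong (low+high r f) (low+high r g)) (Ser.-‿inverseʳ (f₀ ⊛ g₀)) ⟩
        f ⊛ g ⊞ 0ˢ
          ≈⟨ Ser.+-identityʳ _ ⟩
        f ⊛ g  ∎
      minus : ∀ p g d → p ⊛ (g ⊞ ⊟ (d ⊛ α)) ≋ p ⊛ g ⊞ ⊟ (p ⊛ d ⊛ α)
      minus p g d = Ser.trans (⊛-distribˡ p g (⊟ (d ⊛ α)))
        (Ser.+-congˡ {p ⊛ g} (Ser.trans (Ser.sym (SerP.-‿distribʳ-* p (d ⊛ α))) (Ser.-‿cong (Ser.sym (⊛-assoc p d α)))))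
      excess⊛α : excess ⊛ α ≋ f₀ ⊛ d₀ ⊛ α ⊞ g₀ ⊛ c₀ ⊛ α ⊞ ⊟ (e ⊛ α)
      excess⊛α = Ser.trans (⊛-distribʳ α (f₀ ⊛ d₀ ⊞ g₀ ⊛ c₀) (⊟ e))
        (Ser.+-cong (⊛-distribʳ α (f₀ ⊛ d₀) (g₀ ⊛ c₀)) (Ser.sym (SerP.-‿distribˡ-* e α)))
      regroup : f₁ ⊛ g₁ ⊞ ⊟ (f₀ ⊛ g₀) ⊞ f₀ ⊛ (g ⊞ ⊟ (d₀ ⊛ α)) ⊞ g₀ ⊛ (f ⊞ ⊟ (c₀ ⊛ α)) ⊞ excess ⊛ α ≋
                f ⊛ g ⊞ ⊟ (e ⊛ α)
      regroup n = ≈-trans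
        (+-cong (+-cong (+-congˡ (minus f₀ g d₀ n)) (minus g₀ f c₀ n)) (excess⊛α n))
        (≈-trans (cancel _ _ _ _ _ _) (+-congʳ (product-split n)))
        where
        cancel : ∀ x p q s t z → (x + (p - s)) + (q - t) + (s + t + z) ≈ (x + p + q) + z
        cancel x p q s t z = ≈-trans
          (solve 8 (λ x p q s t s⁻ t⁻ z → (x :+ (p :+ s⁻)) :+ (q :+ t⁻) :+ (s :+ t :+ z) :=
                     ((x :+ p :+ q) :+ z) :+ ((s :+ s⁻) :+ (t :+ t⁻))) ≈-refl x p q s t (- s) (- t) z)
          (≈-trans (+-congˡ (≈-trans (+-cong (-‿inverseʳ s) (-‿inverseʳ t)) (+-identityˡ 0#))) (+-identityʳ _))

    module Exponential
      (α₀≈1 : α 0 ≈ 1#) (b : Series) (b≥0 : ∀ n → 0# ≤ b n) (∂α : ∂ α ≋ ∂ b ⊛ α) where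

      ∂b≥0 : ∀ k → 0# ≤ ∂ b k
      ∂b≥0 k = *-nonneg (fromℕ-nonneg (suc k)) (b≥0 (suc k))

      1ˢ-dominated : Dominated 1ˢ
      1ˢ-dominated zero    = ≤-reflexive (≈-trans (∣x∣≈x 0≤1) (≈-sym α₀≈1))
      1ˢ-dominated (suc n) = ≤-trans (≤-reflexive (∣x∣≈x ≤-refl)) (α≥0 (suc n))

      -- α itself satisfies ∂ α = ∂ b ⊛ α with ∂ b nonnegative, so a dominated g in place of α can
      -- only make the primitive smaller.
      primitive-dominated : ∀ {f g} → f 0 ≈ 0# → ∂ f ≋ ∂ b ⊛ g → Dominated g → Dominated f
      primitive-dominated {f} {g} f₀≈0 ∂f g≤α zero = ≤-trans (≤-reflexive (≈-trans (∣∣-cong f₀≈0) (∣x∣≈x ≤-refl))) (α≥0 0)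
      primitive-dominated {f} {g} f₀≈0 ∂f g≤α (suc n) = *-cancelˡ-≤ (0<fromℕ-suc n) (begin
        fromℕ (suc n) * ∣ f (suc n) ∣  ≈⟨ ∣∂∣≈ f n ⟨
        ∣ ∂ f n ∣                      ≈⟨ ∣∣-cong (∂f n) ⟩
        ∣ (∂ b ⊛ g) n ∣                ≤⟨ ∣⊛∣-mono-≤ n (λ k _ → ≤-reflexive (∣x∣≈x (∂b≥0 k))) (λ k _ → g≤α k) ⟩
        (∂ b ⊛ α) n                    ≈⟨ ∂α n ⟨
        ∂ α n                          ∎)
        where open ≤-Reasoning

      -- Here E = exp(−P), where P = low (suc r) b, and α⁻¹ = exp(−b).
      module _ (r : ℕ) (E α⁻¹ : Series)
        (E₀≈1 : E 0 ≈ 1#) (∂E : ∂ E ≋ ⊟ ∂ (low (suc r) b) ⊛ E)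
        (α⁻¹₀≈1 : α⁻¹ 0 ≈ 1#) (∂α⁻¹ : ∂ α⁻¹ ≋ ⊟ ∂ b ⊛ α⁻¹) where
        private
          N : ℕ
          N = suc r
          P Q X : Series
          P = low N b
          Q = high N b
          X = α ⊛ E

          ∣P∣≤b : ∀ k → ∣ P k ∣ ≤ b k
          ∣P∣≤b k with N ℕ.≤? k
          ... | yes N≤k = ≤-trans (≤-reflexive (≈-trans (∣∣-cong (low-≥ N b k N≤k)) (∣x∣≈x ≤-refl))) (b≥0 k)
          ... | no N≰k  = ≤-reflexive (≈-trans (∣∣-cong (low-< N b k (ℕ.≰⇒> N≰k))) (∣x∣≈x (b≥0 k)))

          ∣Q∣≤b : ∀ k → ∣ Q k ∣ ≤ b k
          ∣Q∣≤b k with N ℕ.≤? k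
          ... | yes N≤k = ≤-reflexive (≈-trans (∣∣-cong (high-≥ N b k N≤k)) (∣x∣≈x (b≥0 k)))
          ... | no N≰k  = ≤-trans (≤-reflexive (≈-trans (∣∣-cong (high-< N b k (ℕ.≰⇒> N≰k))) (∣x∣≈x ≤-refl))) (b≥0 k)

          ∂-mono : ∀ {f g} → (∀ k → ∣ f k ∣ ≤ g k) → ∀ k → ∣ ∂ f k ∣ ≤ ∂ g k
          ∂-mono {f} p k = ≤-trans (≤-reflexive (∣∂∣≈ f k)) (*-monoˡ-≤ (fromℕ-nonneg (suc k)) (p (suc k)))

          E-dominated : Dominated E
          E-dominated = ode-majorant ∂E ∂α
            (λ k → ≤-trans (≤-reflexive (∣-x∣≈∣x∣ (∂ P k))) (∂-mono {P} ∣P∣≤b k))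
            (≤-reflexive (≈-trans (∣∣-cong E₀≈1) (≈-trans (∣x∣≈x 0≤1) (≈-sym α₀≈1))))

          -- ∂ E = − ∂ P ⊛ E with P a polynomial: each estimate for E improves itself
          -- by one step.
          E∈O : ∀ s → O s E
          E∈O zero    = O-dominated E-dominated α∈O
          E∈O (suc s) = bounded D D≥0 (suc M) small
            where
            ⊟∂P-supported : Supported N (⊟ ∂ P)
            ⊟∂P-supported k N≤k = ≈-trans (-‿cong (≈-trans (*-congˡ (low-≥ N b (suc k) (ℕ.m≤n⇒m≤1+n N≤k))) (zeroʳ _))) RingP.-0#≈0#
            open O (O-polynomial N {p = ⊟ ∂ P} {x = E} ⊟∂P-supported (E∈O s)) renaming (κ to D; κ-nonneg to D≥0; N to M)
            open ≤-Reasoning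
            small : ∀ n → suc M ℕ.≤ n → ∣ E n ∣ ≤ D * α (n ∸ suc s)
            small (suc n) (ℕ.s≤s M≤n) = begin
              ∣ E (suc n) ∣                  ≈⟨ *-identityˡ _ ⟨
              1# * ∣ E (suc n) ∣             ≤⟨ *-monoʳ-≤ (∣∣-nonneg _) (≤-trans (≤-reflexive (≈-sym (+-identityʳ 1#))) (+-monoʳ-≤ 1# (fromℕ-nonneg n))) ⟩
              fromℕ (suc n) * ∣ E (suc n) ∣  ≈⟨ ∣∂∣≈ E n ⟨
              ∣ ∂ E n ∣                      ≈⟨ ∣∣-cong (∂E n) ⟩
              ∣ (⊟ ∂ P ⊛ E) n ∣              ≤⟨ bound n M≤n ⟩
              D * α (n ∸ s)                  ∎

          -- P keeps degree r of b, so the derivatives of P and b agree below degree r; integrating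
          -- the equations gives agreement through r.
          E≈α⁻¹ : ∀ n → n ℕ.≤ r → E n ≈ α⁻¹ n
          E≈α⁻¹ = ode-agree r ∂E ∂α⁻¹ (λ k k<r → -‿cong (*-congˡ (low-< N b (suc k) (ℕ.s≤s k<r)))) (≈-trans E₀≈1 (≈-sym α⁻¹₀≈1))

          ∂Q : ∂ b ⊞ ⊟ ∂ P ≋ ∂ Q
          ∂Q n = begin
            ∂ b n - ∂ P n             ≈⟨ +-congʳ (*-congˡ (low+high N b (suc n))) ⟨
            ∂ (P ⊞ Q) n - ∂ P n       ≈⟨ +-congʳ (≈-trans (∂-⊞ P Q n) (+-comm _ _)) ⟩
            ∂ Q n + ∂ P n - ∂ P n     ≈⟨ +-assoc _ _ _ ⟩
            ∂ Q n + (∂ P n - ∂ P n)   ≈⟨ +-congˡ (-‿inverseʳ _) ⟩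
            ∂ Q n + 0#                ≈⟨ +-identityʳ _ ⟩
            ∂ Q n                     ∎
            where open ≈-Reasoning

          ∂X : ∂ X ≋ ∂ Q ⊛ X
          ∂X = begin
            ∂ (α ⊛ E)                              ≈⟨ ∂-⊛ α E ⟩
            ∂ α ⊛ E ⊞ α ⊛ ∂ E                      ≈⟨ Ser.+-cong (⊛-congʳ ∂α) (⊛-congˡ {α} ∂E) ⟩
            ∂ b ⊛ α ⊛ E ⊞ α ⊛ (⊟ ∂ P ⊛ E)          ≈⟨ SerSolver.solve 4 (λ b α E P →
                (b SerSolver.:* α SerSolver.:* E) SerSolver.:+ (α SerSolver.:* (P SerSolver.:* E)) SerSolver.:=
                (b SerSolver.:+ P) SerSolver.:* (α SerSolver.:* E)) Ser.refl (∂ b) α E (⊟ ∂ P) ⟩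
            (∂ b ⊞ ⊟ ∂ P) ⊛ X                      ≈⟨ ⊛-congʳ ∂Q ⟩
            ∂ Q ⊛ X                                ∎
            where open SetoidReasoning Ser.setoid

          X₀≈1 : X 0 ≈ 1#
          X₀≈1 = ≈-trans (*-cong α₀≈1 E₀≈1) (*-identityˡ 1#)

          X-dominated : Dominated X
          X-dominated = ode-majorant ∂X ∂α (∂-mono {Q} ∣Q∣≤b)
            (≤-reflexive (≈-trans (∣∣-cong X₀≈1) (≈-trans (∣x∣≈x 0≤1) (≈-sym α₀≈1))))

          X≈1 : ∀ n → n ℕ.≤ r → X n ≈ 1ˢ n
          X≈1 = ode-agree r ∂X (λ n → ≈-trans (∂-1ˢ n) (≈-sym (⊛-zeroˡ 1ˢ n)))
            (λ k k<r → ≈-trans (*-congˡ (high-< N b (suc k) (ℕ.s≤s k<r))) (zeroʳ _)) X₀≈1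

          Y R : Series
          Y = X ⊞ ⊟ 1ˢ
          R = Y ⊞ ⊟ Q

          -- Q starts in degree r + 1, so X = exp Q agrees with 1 through degree r. Beyond that `1ˢ`
          -- is 0 and X is dominated by α.
          ∣Y∣≤ : ∀ k → ∣ Y k ∣ ≤ high N α k
          ∣Y∣≤ k with N ℕ.≤? k
          ∣Y∣≤ (suc k) | yes N≤k = ≤-trans
            (≤-reflexive (∣∣-cong (≈-trans (+-congˡ RingP.-0#≈0#) (+-identityʳ _))))
            (≤-trans (X-dominated (suc k)) (≤-reflexive (≈-sym (high-≥ N α (suc k) N≤k))))
          ∣Y∣≤ k | no N≰k with ℕ.≰⇒> N≰k
          ... | ℕ.s≤s k≤r = ≤-reflexive (≈-trans
            (∣∣-cong (≈-trans (+-congʳ (X≈1 k k≤r)) (-‿inverseʳ _)))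
            (≈-trans (∣x∣≈x ≤-refl) (≈-sym (high-< N α k (ℕ.s≤s k≤r)))))

          ∂R : ∂ R ≋ ∂ Q ⊛ Y
          ∂R = begin
            ∂ R                          ≈⟨ ∂-⊞ Y (⊟ Q) ⟩
            ∂ Y ⊞ ∂ (⊟ Q)                ≈⟨ Ser.+-cong (∂-⊞ X (⊟ 1ˢ)) (∂-⊟ Q) ⟩
            ∂ X ⊞ ∂ (⊟ 1ˢ) ⊞ ⊟ ∂ Q       ≈⟨ Ser.+-congʳ {⊟ ∂ Q} (Ser.+-cong ∂X (λ n → ≈-trans (∂-⊟ 1ˢ n) (≈-trans (-‿cong (∂-1ˢ n)) RingP.-0#≈0#))) ⟩
            ∂ Q ⊛ X ⊞ 0ˢ ⊞ ⊟ ∂ Q         ≈⟨ Ser.+-cong (Ser.+-identityʳ (∂ Q ⊛ X))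
              (Ser.trans (Ser.-‿cong (Ser.sym (Ser.*-identityʳ (∂ Q)))) (SerP.-‿distribʳ-* (∂ Q) 1ˢ)) ⟩
            ∂ Q ⊛ X ⊞ ∂ Q ⊛ ⊟ 1ˢ         ≈⟨ ⊛-distribˡ (∂ Q) X (⊟ 1ˢ) ⟨
            ∂ Q ⊛ Y                      ∎
            where open SetoidReasoning Ser.setoid

        module _ (b≤α : Dominated b) where
          private
            -- Differentiating costs nothing: for k ≤ n the factor k + 1 in ∂ Q is at most n + 1,
            -- which is the factor that ∂ puts on coefficient n + 1 of R. After cancelling it, a
            -- product of two tails of α remains.
            R∈O : O N R
            R∈O = bounded D D≥0 (suc M) small
              where
              open O (high⊛high∈O N) renaming (κ to D; κ-nonneg to D≥0; N to M)
              open ≤-Reasoning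
              ∂Q≤ : ∀ n k → k ℕ.≤ n → ∣ ∂ Q k ∣ ≤ (fromℕ (suc n) • (high N α ∘ suc)) k
              ∂Q≤ n k k≤n = ≤-trans (≤-reflexive (∣∂∣≈ Q k)) (*-mono-≤ (fromℕ-nonneg (suc k))
                (fromℕ-mono-≤ (ℕ.s≤s k≤n)) (∣∣-nonneg _) (high-mono N b≤α (suc k)))
              ∣R∣≤ : ∀ n → ∣ R (suc n) ∣ ≤ (high N α ⊛ high N α) (suc n)
              ∣R∣≤ n = *-cancelˡ-≤ (0<fromℕ-suc n) (begin
                fromℕ (suc n) * ∣ R (suc n) ∣                 ≈⟨ ∣∂∣≈ R n ⟨
                ∣ ∂ R n ∣                                     ≈⟨ ∣∣-cong (∂R n) ⟩
                ∣ (∂ Q ⊛ Y) n ∣                               ≤⟨ ∣⊛∣-mono-≤ n (∂Q≤ n) (λ k _ → ∣Y∣≤ k) ⟩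
                ((fromℕ (suc n) • (high N α ∘ suc)) ⊛ high N α) n ≈⟨ •-⊛ (fromℕ (suc n)) (high N α ∘ suc) (high N α) n ⟩
                -- Since N = r + 1, `high N α` has no constant term, so the first summand of the
                -- product vanishes.
                fromℕ (suc n) * (high N α ∘ suc ⊛ high N α) n ≈⟨ *-congˡ (≈-trans (+-congʳ (zeroˡ _)) (+-identityˡ _)) ⟨
                fromℕ (suc n) * (high N α ⊛ high N α) (suc n) ∎)
              small : ∀ n → suc M ℕ.≤ n → ∣ R n ∣ ≤ D * α (n ∸ N)
              small (suc n) (ℕ.s≤s M≤n) = ≤-trans (∣R∣≤ n) (≤-trans (x≤∣x∣ _) (bound (suc n) (ℕ.m≤n⇒m≤1+n M≤n)))

            -- Split α at r. Against its high part the convolution condition applies; against its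
            -- low part, a polynomial, the smallness of E does.
            tail∈O : O r (high r E ⊛ α)
            tail∈O = O-resp
              (λ n → ≈-trans (+-comm _ _) (≈-trans (≈-sym (⊛-distribˡ (high r E) (low r α) (high r α) n))
                (⊛-congˡ {high r E} (low+high r α) n)))
              (O-⊞ (high⊛high-dominated r E-dominated (λ n → ≤-reflexive (∣x∣≈x (α≥0 n))))
                   (O-resp (⊛-comm (low r α) (high r E)) (O-polynomial r (low-supported r α) (high-O r (E∈O r)))))

          -- With Q = X - 1 - R and X = E α, the error equals P - 1 - R + `high r E ⊛ α`, because E
          -- and α⁻¹ agree below r. The polynomials P and 1 are negligible to every order; `R∈O` and
          -- `tail∈O` bound the rest.
          log-expansion : O r (b ⊞ ⊟ (low r α⁻¹ ⊛ α))
          log-expansion = O-resp regroup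
            (O-⊞ (O-⊞ (O-⊞ (O-supported N (low-supported N b)) (O-⊟ (O-supported 1 1ˢ-supported))) (O-⊟ (O-weaken R∈O))) tail∈O)
            where
            1ˢ-supported : Supported 1 1ˢ
            1ˢ-supported (suc k) _ = ≈-refl
            regroup : P ⊞ ⊟ 1ˢ ⊞ ⊟ R ⊞ high r E ⊛ α ≋ b ⊞ ⊟ (low r α⁻¹ ⊛ α)
            regroup n = begin
              P n - 1ˢ n - (X n - 1ˢ n - Q n) + T
                ≈⟨ +-congʳ (+-congˡ (≈-trans (≈-sym (RingP.-‿+-comm _ _)) (+-cong (≈-sym (RingP.-‿+-comm _ _)) (RingP.-‿involutive _)))) ⟩
              P n - 1ˢ n + (- X n - - 1ˢ n + Q n) + T
                ≈⟨ solve 6 (λ p o x u q t → ((p :+ o) :+ ((x :+ u) :+ q)) :+ t := (p :+ q) :+ (x :+ t) :+ (o :+ u)) ≈-refl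
                     (P n) (- 1ˢ n) (- X n) (- - 1ˢ n) (Q n) T ⟩
              (P n + Q n) + (- X n + T) + (- 1ˢ n - - 1ˢ n)
                ≈⟨ ≈-trans (+-cong (+-cong (low+high N b n) X-T) (-‿inverseʳ _)) (+-identityʳ _) ⟩
              b n - (low r α⁻¹ ⊛ α) n  ∎
              where
              open ≈-Reasoning
              T : Scalar
              T = (high r E ⊛ α) n
              L : Scalar
              L = (low r α⁻¹ ⊛ α) n
              X≈ : X n ≈ L + T
              X≈ = ≈-trans (⊛-comm α E n) (≈-trans (⊛-congʳ (λ k → ≈-sym (low+high r E k)) n)
                (≈-trans (⊛-distribʳ α (low r E) (high r E) n)
                  (+-congʳ (⊛-congʳ (low-cong r (λ k k<r → E≈α⁻¹ k (ℕ.<⇒≤ k<r))) n))))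
              X-T : - X n + T ≈ - L
              X-T = begin
                - X n + T        ≈⟨ +-congʳ (≈-trans (-‿cong X≈) (≈-sym (RingP.-‿+-comm L T))) ⟩
                - L - T + T      ≈⟨ +-assoc _ _ _ ⟩
                - L + (- T + T)  ≈⟨ +-congˡ (-‿inverseˡ T) ⟩
                - L + 0#         ≈⟨ +-identityʳ _ ⟩
                - L              ∎

  module _ {d : Sequence} {g : ℕ → Sequence} where
    =O-coefficient : ∀ {y : Sequence} k → ¬ d k ≈ 0# → y =O g k → y =O (λ n → d k * g k n)
    =O-coefficient {y} k d≉0 (E , N , p) = E / ∣ d k ∣ , N , λ n N≤n → ≤-trans (p n N≤n) (≤-reflexive (begin
      E * ∣ g k n ∣                              ≈⟨ *-congʳ (x/y*y≈x E (0<⇒≉0 (0<∣x∣ d≉0))) ⟨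
      E / ∣ d k ∣ * ∣ d k ∣ * ∣ g k n ∣          ≈⟨ *-assoc _ _ _ ⟩
      E / ∣ d k ∣ * (∣ d k ∣ * ∣ g k n ∣)        ≈⟨ *-congˡ (∣x*y∣≈∣x∣*∣y∣ (d k) (g k n)) ⟨
      E / ∣ d k ∣ * ∣ d k * g k n ∣              ∎))
      where open ≈-Reasoning

    =o-coefficients : ∀ k → ¬ d k ≈ 0# → g (suc k) =o g k → (λ n → d (suc k) * g (suc k) n) =o (λ n → d k * g k n)
    =o-coefficients k d≉0 g=o ε 0<ε = proj₁ small , bound
      where
      open ≤-Reasoning
      E ε′ : Scalar
      -- The summand 1 keeps this divisor positive when `d (suc k)` is 0.
      E = 1# + ∣ d (suc k) ∣
      0<E : 0# < E
      0<E = <-≤-trans 0<1 (≤-trans (≤-reflexive (≈-sym (+-identityʳ 1#))) (+-monoʳ-≤ 1# (∣∣-nonneg (d (suc k)))))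
      ε′ = ε * ∣ d k ∣ / E
      small : _
      small = g=o ε′ (*-positive (*-positive 0<ε (0<∣x∣ d≉0)) (⁻¹-positive 0<E))
      bound : ∀ n → proj₁ small ℕ.≤ n → ∣ d (suc k) * g (suc k) n ∣ ≤ ε * ∣ d k * g k n ∣
      bound n le = begin
        ∣ d (suc k) * g (suc k) n ∣        ≈⟨ ∣x*y∣≈∣x∣*∣y∣ _ _ ⟩
        ∣ d (suc k) ∣ * ∣ g (suc k) n ∣    ≤⟨ *-mono-≤ (∣∣-nonneg _)
          (≤-trans (≤-reflexive (≈-sym (+-identityˡ _))) (+-mono-≤ 0≤1 ≤-refl)) (∣∣-nonneg _) (proj₂ small n le) ⟩
        E * (ε′ * ∣ g k n ∣)               ≈⟨ *-assoc _ _ _ ⟨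
        E * ε′ * ∣ g k n ∣                 ≈⟨ *-congʳ (≈-trans (*-comm _ _) (x/y*y≈x _ (0<⇒≉0 0<E))) ⟩
        ε * ∣ d k ∣ * ∣ g k n ∣            ≈⟨ *-assoc _ _ _ ⟩
        ε * (∣ d k ∣ * ∣ g k n ∣)          ≈⟨ *-congˡ (∣x*y∣≈∣x∣*∣y∣ _ _) ⟨
        ε * ∣ d k * g k n ∣                ∎

-- Finite sets up to bijection

elements-↭-list : ∀ U {xs} → Unique.Unique (FinSet.setoid U) xs → (∀ x → Membership._∈_ (FinSet.setoid U) x xs) →
                  Permutation._↭_ (FinSet.setoid U) (elements U) xs
elements-↭-list U uxs all = unique-↭ (FinSet.setoid U) (FinSet.elements-unique U) uxs
  (λ {z} _ → all z) (λ {z} _ → FinSet.elements-complete U z)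

module _ (S : Setoid 0ℓ 0ℓ) where
  open Setoid S using (_≈_)
  private module S = Setoid S

  lookup-injective : ∀ {xs} → Unique.Unique S xs → ∀ i j → lookup xs i ≈ lookup xs j → i ≡ j
  lookup-injective (_ ∷ _)   zero    zero    _ = refl
  lookup-injective (x≉ ∷ _)  zero    (suc j) e = ⊥-elim (All.lookupₛ S (λ y≈z x≉y x≈z → x≉y (S.trans x≈z (S.sym y≈z)))
    x≉ (Membershipₚ.∈-lookup S _ j) e)
  lookup-injective (x≉ ∷ _)  (suc i) zero    e = ⊥-elim (All.lookupₛ S (λ y≈z x≉y x≈z → x≉y (S.trans x≈z (S.sym y≈z)))
    x≉ (Membershipₚ.∈-lookup S _ i) (S.sym e))
  lookup-injective (_ ∷ uxs) (suc i) (suc j) e = ≡.cong suc (lookup-injective uxs i j e)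

enumeration : ∀ U → U ≅ ⟦ card U ⟧
enumeration U = record { inverse = record
  { to = index ; from = lookup (elements U)
  ; to-cong = λ {x} {y} p → lookup-injective setoid elements-unique (index x) (index y)
      (≈-trans (≈-sym (lookup-index x)) (≈-trans p (lookup-index y)))
  ; from-cong = λ { refl → ≈-refl }
  ; inverse = (λ {i} {x} p → lookup-injective setoid elements-unique (index x) i
                (≈-trans (≈-sym (lookup-index x)) p))
            , (λ {x} {i} p → ≈-trans (≈-reflexive (≡.cong (lookup (elements U)) p)) (≈-sym (lookup-index x))) } }
  where
  open FinSet U hiding (Carrier; elements; card)
  ≈-reflexive : ∀ {x y} → x ≡ y → x ≈ y
  ≈-reflexive refl = ≈-refl
  index : Carrier U → Fin (card U)
  index x = Any.index (elements-complete x)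
  lookup-index : ∀ x → x ≈ lookup (elements U) (index x)
  lookup-index x = Any.lookup-index (elements-complete x)

_⁻¹ᵇ : ∀ {U V} → U ≅ V → V ≅ U
σ ⁻¹ᵇ = record { inverse = record
  { to = from σ ; from = to σ ; to-cong = from-cong σ ; from-cong = to-cong σ
  ; inverse = _≅_.inverseʳ σ , _≅_.inverseˡ σ } }

-- V is W with one more element, up to the equality of V. A map ι on representatives is used because
-- the record serves both subsets of `⟦ n ⟧` and sets of blocks, whose equality is a partition
-- relation.
record AddsPoint (W V : FinSet) : Set where
  field
    point     : Carrier V
    ι         : Carrier W → Carrier V
    ι-cong    : ∀ {x y} → FinSet._≈_ W x y → FinSet._≈_ V (ι x) (ι y)
    ι-inj     : ∀ {x y} → FinSet._≈_ V (ι x) (ι y) → FinSet._≈_ W x y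
    fresh     : ∀ x → ¬ FinSet._≈_ V point (ι x)
    cover     : ∀ y → FinSet._≈_ V y point ⊎ (∃[ x ] FinSet._≈_ V y (ι x))

  elements-split : Permutation._↭_ (FinSet.setoid V) (elements V) (point ∷ map ι (elements W))
  elements-split = elements-↭-list V
    (All.map⁺ (All.universal fresh (elements W)) ∷
      Uniqueₚ.map⁺ (FinSet.setoid W) (FinSet.setoid V) ι-inj (FinSet.elements-unique W))
    λ y → find (cover y)
    where
    find : ∀ {y} → FinSet._≈_ V y point ⊎ (∃[ x ] FinSet._≈_ V y (ι x)) →
           Membership._∈_ (FinSet.setoid V) y (point ∷ map ι (elements W))
    find (inj₁ p)       = here p
    find (inj₂ (x , p)) = there (Membershipₚ.∈-resp-≈ (FinSet.setoid V) (FinSet.≈-sym V p)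
      (Membershipₚ.∈-map⁺ (FinSet.setoid W) (FinSet.setoid V) ι-cong (FinSet.elements-complete W x)))

  card-suc : card V ≡ suc (card W)
  card-suc = ≡.trans (Permutationₚ.xs↭ys⇒|xs|≡|ys| (FinSet.setoid V) elements-split)
    (≡.cong suc (length-map ι (elements W)))

-- Sums and products over finite sets, in an arbitrary commutative monoid

Congruent : ∀ {a ℓ} (S : Setoid a ℓ) (U : FinSet) → (Carrier U → Setoid.Carrier S) → Set ℓ
Congruent S U g = ∀ {x y} → FinSet._≈_ U x y → Setoid._≈_ S (g x) (g y)

module Folding {c ℓ} (M : CommutativeMonoid c ℓ) where
  open CommutativeMonoid M renaming (Carrier to X; refl to ≈-refl; sym to ≈-sym; trans to ≈-trans)

  fold : List X → X
  fold = foldr _∙_ ε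

  private
    variable
      a b : Level
      A : Set a
      B : Set b

  fold-map-cong : ∀ {f g : A → X} xs → (∀ x → f x ≈ g x) → fold (map f xs) ≈ fold (map g xs)
  fold-map-cong []       p = ≈-refl
  fold-map-cong (x ∷ xs) p = ∙-cong (p x) (fold-map-cong xs p)

  fold-map-++ : ∀ (g : A → X) xs ys → fold (map g (xs ++ ys)) ≈ fold (map g xs) ∙ fold (map g ys)
  fold-map-++ g []       ys = ≈-sym (identityˡ _)
  fold-map-++ g (x ∷ xs) ys = ≈-trans (∙-congˡ (fold-map-++ g xs ys)) (≈-sym (assoc _ _ _))

  fold-map-map : ∀ (g : B → X) (h : A → B) xs → fold (map g (map h xs)) ≈ fold (map (g ∘ h) xs)
  fold-map-map g h []       = ≈-refl
  fold-map-map g h (x ∷ xs) = ∙-congˡ (fold-map-map g h xs)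

  fold-map-concatMap : ∀ (g : B → X) (h : A → List B) xs →
                       fold (map g (concatMap h xs)) ≈ fold (map (λ x → fold (map g (h x))) xs)
  fold-map-concatMap g h []       = ≈-refl
  fold-map-concatMap g h (x ∷ xs) =
    ≈-trans (fold-map-++ g (h x) _) (∙-congˡ (fold-map-concatMap g h xs))

  fold-map-cartesianProductWith : ∀ {D : Set b} (g : D → X) (h : A → B → D) xs ys →
    fold (map g (cartesianProductWith h xs ys)) ≈ fold (map (λ x → fold (map (λ y → g (h x y)) ys)) xs)
  fold-map-cartesianProductWith g h []       ys = ≈-refl
  fold-map-cartesianProductWith g h (x ∷ xs) ys = ≈-trans (fold-map-++ g (map (h x) ys) _)
    (∙-cong (fold-map-map g (h x) ys) (fold-map-cartesianProductWith g h xs ys))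

  fold-map-∙ : ∀ (f g : A → X) xs → fold (map (λ x → f x ∙ g x) xs) ≈ fold (map f xs) ∙ fold (map g xs)
  fold-map-∙ f g []       = ≈-sym (identityˡ ε)
  fold-map-∙ f g (x ∷ xs) = begin
    (f x ∙ g x) ∙ F               ≈⟨ ∙-congˡ (fold-map-∙ f g xs) ⟩
    (f x ∙ g x) ∙ (Fs ∙ Gs)       ≈⟨ assoc _ _ _ ⟩
    f x ∙ (g x ∙ (Fs ∙ Gs))       ≈⟨ ∙-congˡ (≈-sym (assoc _ _ _)) ⟩
    f x ∙ ((g x ∙ Fs) ∙ Gs)       ≈⟨ ∙-congˡ (∙-congʳ (comm _ _)) ⟩
    f x ∙ ((Fs ∙ g x) ∙ Gs)       ≈⟨ ∙-congˡ (assoc _ _ _) ⟩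
    f x ∙ (Fs ∙ (g x ∙ Gs))       ≈⟨ assoc _ _ _ ⟨
    (f x ∙ Fs) ∙ (g x ∙ Gs)       ∎
    where
    open SetoidReasoning setoid
    F Fs Gs : X
    F  = fold (map (λ x → f x ∙ g x) xs)
    Fs = fold (map f xs)
    Gs = fold (map g xs)

  fold-map-ε : ∀ (xs : List A) → fold (map (λ _ → ε) xs) ≈ ε
  fold-map-ε []       = ≈-refl
  fold-map-ε (x ∷ xs) = ≈-trans (identityˡ _) (fold-map-ε xs)

  fold-map-swap : ∀ (g : A → B → X) xs ys →
    fold (map (λ x → fold (map (g x) ys)) xs) ≈ fold (map (λ y → fold (map (λ x → g x y) xs)) ys)
  fold-map-swap g []       ys = ≈-sym (fold-map-ε ys)
  fold-map-swap g (x ∷ xs) ys =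
    ≈-trans (∙-congˡ (fold-map-swap g xs ys)) (≈-sym (fold-map-∙ (g x) _ ys))

  fold-map-filter : ∀ {P : A → Set} (P? : ∀ x → Dec (P x)) (g : A → X) xs →
    fold (map g (filter P? xs)) ≈ fold (map (λ x → if does (P? x) then g x else ε) xs)
  fold-map-filter P? g []       = ≈-refl
  fold-map-filter P? g (x ∷ xs) with does (P? x)
  ... | true  = ∙-congˡ (fold-map-filter P? g xs)
  ... | false = ≈-trans (fold-map-filter P? g xs) (≈-sym (identityˡ _))

  fold-map-↭ : ∀ (S : Setoid 0ℓ 0ℓ) {g : Setoid.Carrier S → X} →
               (∀ {x y} → Setoid._≈_ S x y → g x ≈ g y) →
               ∀ {xs ys} → Permutation._↭_ S xs ys → fold (map g xs) ≈ fold (map g ys)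
  fold-map-↭ S g-cong π = Permutationₚ.foldr-commMonoid setoid isCommutativeMonoid
    (Permutationₚ.map⁺ S setoid g-cong π)

  ⨁[_]_ : (U : FinSet) → (Carrier U → X) → X
  ⨁[ U ] g = fold (map g (elements U))

  ⨁-cong : ∀ U {f g : Carrier U → X} → (∀ x → f x ≈ g x) → ⨁[ U ] f ≈ ⨁[ U ] g
  ⨁-cong U = fold-map-cong (elements U)

  ⨁-list : ∀ U {g} → Congruent setoid U g → ∀ {xs} → Unique.Unique (FinSet.setoid U) xs →
           (∀ x → Membership._∈_ (FinSet.setoid U) x xs) → ⨁[ U ] g ≈ fold (map g xs)
  ⨁-list U g-cong uxs all = fold-map-↭ (FinSet.setoid U) g-cong (elements-↭-list U uxs all)

  ⨁-≅ : ∀ {U V} (σ : U ≅ V) {g h} → Congruent setoid V h → (∀ x → g x ≈ h (to σ x)) → ⨁[ U ] g ≈ ⨁[ V ] h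
  ⨁-≅ {U} {V} σ {g} {h} h-cong e = ≈-trans (⨁-cong U e)
    (≈-trans (≈-sym (fold-map-map h (to σ) (elements U))) (fold-map-↭ (FinSet.setoid V) h-cong (elements-↭ σ)))

  ⨁-point : ∀ {W V} (p : AddsPoint W V) {g} → Congruent setoid V g →
            ⨁[ V ] g ≈ g (AddsPoint.point p) ∙ ⨁[ W ] (g ∘ AddsPoint.ι p)
  ⨁-point {W} {V} p {g} g-cong = ≈-trans (fold-map-↭ (FinSet.setoid V) g-cong (AddsPoint.elements-split p))
    (∙-congˡ (fold-map-map g (AddsPoint.ι p) (elements W)))

  ⨁-× : ∀ U V {g} → Congruent setoid (U ×ᶠ V) g → ⨁[ U ×ᶠ V ] g ≈ ⨁[ U ] λ x → ⨁[ V ] λ y → g (x , y)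
  ⨁-× U V {g} g-cong = ≈-trans
    (⨁-list (U ×ᶠ V) g-cong
      (Uniqueₚ.cartesianProduct⁺ (FinSet.setoid U) (FinSet.setoid V) (FinSet.elements-unique U) (FinSet.elements-unique V))
      (λ (x , y) → Membershipₚ.∈-cartesianProduct⁺ (FinSet.setoid U) (FinSet.setoid V)
        (FinSet.elements-complete U x) (FinSet.elements-complete V y)))
    (fold-map-cartesianProductWith g _,_ (elements U) (elements V))

  module _ (I : DecSetoid 0ℓ 0ℓ) (A : Family I) (support : List (DecSetoid.Carrier I))
           (supported : ∀ i → Carrier (Family.fib A i) → Membership._∈_ (DecSetoid.setoid I) i support) where
    private
      module I = DecSetoid I
    open Family A using (fib; tr; tr-id)

    private
      total′ : FinSet
      total′ = ∑-finSet I A support supported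
      fibre : ∀ i → List (Carrier total′)
      fibre i = map (i ,_) (elements (fib i))

      disjoint : ∀ {i j} → ¬ (i I.≈ j) → Disjoint (FinSet.setoid total′) (fibre i) (fibre j)
      disjoint {i} {j} i≉j {v} (v∈i , v∈j) with
          Membershipₚ.∈-map⁻ (FinSet.setoid (fib i)) (FinSet.setoid total′) v∈i
        | Membershipₚ.∈-map⁻ (FinSet.setoid (fib j)) (FinSet.setoid total′) v∈j
      ... | _ , _ , (p , _) | _ , _ , (q , _) = i≉j (I.trans (I.sym p) q)

    -- `support` may contain repetitions; any duplicate-free list that covers the inhabited fibres
    -- gives the same sum, so each use can choose a convenient one.
    ⨁-∑ : ∀ {L} → Unique.Unique I.setoid L → (∀ i → Carrier (fib i) → Membership._∈_ I.setoid i L) →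
          ∀ {g} → Congruent setoid (∑-finSet I A support supported) g →
          ⨁[ ∑-finSet I A support supported ] g ≈ fold (map (λ i → ⨁[ fib i ] (λ x → g (i , x))) L)
    ⨁-∑ {L} uL L-covers {g} g-cong = ≈-trans
      (⨁-list total′ g-cong
        (Uniqueₚ.concat⁺ (FinSet.setoid total′)
          (All.map⁺ (All.universal (λ i → Uniqueₚ.map⁺ (FinSet.setoid (fib i)) (FinSet.setoid total′)
            (λ {x} {y} (p , q) → FinSet.≈-trans (fib i) (FinSet.≈-sym (fib i) (tr-id p x)) q)
            (FinSet.elements-unique (fib i))) L))
          (AllPairs.map⁺ (AllPairs.map disjoint uL)))
        (λ (i , x) → Membershipₚ.∈-concatMap⁺ I.setoid (FinSet.setoid total′)
          (Any.map (λ {j} p → Any.map⁺ (Any.map (p ,_) (FinSet.elements-complete (fib j) (tr p x)))) (L-covers i x))))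
      (≈-trans (fold-map-concatMap g fibre L)
        (fold-map-cong L (λ i → fold-map-map g (i ,_) (elements (fib i)))))

  ⨁-filter : ∀ U {P : Carrier U → Set} (P? : ∀ x → Dec (P x)) (g : Carrier U → X) →
             fold (map g (filter P? (elements U))) ≈ ⨁[ U ] λ x → if does (P? x) then g x else ε
  ⨁-filter U P? g = fold-map-filter P? g (elements U)

  ⨁-δ : ∀ V v {x} → ⨁[ V ] (λ v′ → if does (FinSet._≟_ V v v′) then x else ε) ≈ x
  ⨁-δ V v {x} = begin
    ⨁[ V ] (λ v′ → if does (v ≟ v′) then x else ε)  ≈⟨ ⨁-filter V (v ≟_) (λ _ → x) ⟨
    fold (map (λ _ → x) (filter (v ≟_) (elements V)))  ≈⟨ fold-map-↭ (FinSet.setoid V) (λ _ → ≈-refl) single ⟩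
    x ∙ ε  ≈⟨ identityʳ x ⟩
    x      ∎
    where
    open FinSet V using (_≟_; elements-unique; elements-complete) renaming (setoid to V-setoid; ≈-trans to V-trans; ≈-sym to V-sym)
    open SetoidReasoning setoid
    single : Permutation._↭_ V-setoid (filter (v ≟_) (elements V)) (v ∷ [])
    single = unique-↭ V-setoid (Uniqueₚ.filter⁺ V-setoid (v ≟_) elements-unique) ([] ∷ [])
      (λ z∈ → here (V-sym (proj₂ (Membershipₚ.∈-filter⁻ V-setoid (v ≟_) (λ p q → V-trans q p) {xs = elements V} z∈))))
      (λ { (here z≈v) → Membershipₚ.∈-filter⁺ V-setoid (v ≟_) (λ p q → V-trans q p) (elements-complete _) (V-sym z≈v) })

  -- Insert a Kronecker delta over V and exchange the two sums.
  ⨁-fibres : ∀ U V (p : Carrier U → Carrier V) (g : Carrier U → X) →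
             ⨁[ U ] g ≈ ⨁[ V ] λ v → ⨁[ U ] λ u → if does (FinSet._≟_ V (p u) v) then g u else ε
  ⨁-fibres U V p g = ≈-trans (⨁-cong U (λ u → ≈-sym (⨁-δ V (p u))))
    (fold-map-swap (λ u v → if does (FinSet._≟_ V (p u) v) then g u else ε) (elements U) (elements V))

  -- The elements of U that satisfy P form the image of the injection f, so the filtered list and
  -- the mapped list are permutations of each other.
  ⨁-image : ∀ U W (f : Carrier W → Carrier U) {P : Carrier U → Set} (P? : ∀ x → Dec (P x)) →
    (∀ {x y} → FinSet._≈_ U x y → P x → P y) →
    (∀ {x y} → FinSet._≈_ U (f x) (f y) → FinSet._≈_ W x y) →
    (∀ {x y} → FinSet._≈_ W x y → FinSet._≈_ U (f x) (f y)) →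
    (∀ x → P (f x)) → (∀ y → P y → ∃[ x ] FinSet._≈_ U y (f x)) →
    ∀ {g} → Congruent setoid U g →
    (⨁[ U ] λ x → if does (P? x) then g x else ε) ≈ ⨁[ W ] (g ∘ f)
  ⨁-image U W f {P} P? P-resp f-inj f-cong Pf onto {g} g-cong = begin
    (⨁[ U ] λ x → if does (P? x) then g x else ε)    ≈⟨ ⨁-filter U P? g ⟨
    fold (map g (filter P? (elements U)))            ≈⟨ fold-map-↭ U-setoid g-cong image ⟩
    fold (map g (map f (elements W)))                ≈⟨ fold-map-map g f (elements W) ⟩
    ⨁[ W ] (g ∘ f)                                   ∎
    where
    open SetoidReasoning setoid
    U-setoid W-setoid : Setoid 0ℓ 0ℓ
    U-setoid = FinSet.setoid U
    W-setoid = FinSet.setoid W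
    image : Permutation._↭_ U-setoid (filter P? (elements U)) (map f (elements W))
    image = unique-↭ U-setoid (Uniqueₚ.filter⁺ U-setoid P? (FinSet.elements-unique U))
      (Uniqueₚ.map⁺ W-setoid U-setoid f-inj (FinSet.elements-unique W))
      (λ {z} z∈ → let x , z≈fx = onto z (proj₂ (Membershipₚ.∈-filter⁻ U-setoid P? P-resp {xs = elements U} z∈)) in
        Membershipₚ.∈-resp-≈ U-setoid (FinSet.≈-sym U z≈fx)
          (Membershipₚ.∈-map⁺ W-setoid U-setoid f-cong (FinSet.elements-complete W x)))
      (λ z∈ → let x , _ , z≈fx = Membershipₚ.∈-map⁻ W-setoid U-setoid z∈ in
        Membershipₚ.∈-filter⁺ U-setoid P? P-resp (FinSet.elements-complete U _) (P-resp (FinSet.≈-sym U z≈fx) (Pf x)))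

-- Sections of a family, each listed exactly once

module Choices (I : FinSet) (A : Family (FinSet.decSetoid I)) where
  open FinSet I using (_≈_; _∈_; ≈-refl; ≈-sym; ≈-trans; setoid; elements-unique; elements-complete) renaming (Carrier to Index)
  open Family A
  private
    module Fib (i : Index) = FinSet (fib i)

  Choice : List Index → Set
  Choice is = All (λ i → Carrier (fib i)) is

  find : ∀ {is} → Choice is → ∀ {i} → i ∈ is → Carrier (fib i)
  find (x ∷ xs) (here p)   = tr (≈-sym p) x
  find (x ∷ xs) (there i∈) = find xs i∈

  -- In a duplicate-free list equal indices sit at the same position, which refutes the two mixed
  -- cases.
  find-coh : ∀ {is} → Unique.Unique setoid is → ∀ (xs : Choice is) {i j} (i∈ : i ∈ is) (j∈ : j ∈ is) (p : i ≈ j) →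
             Fib._≈_ j (tr p (find xs i∈)) (find xs j∈)
  find-coh _        (x ∷ xs) (here q)   (here r)   p = tr-∘ (≈-sym q) p (≈-sym r) x
  find-coh (k∉ ∷ _) (x ∷ xs) (here q)   (there j∈) p =
    ⊥-elim (All.All¬⇒¬Any k∉ (Membershipₚ.∈-resp-≈ setoid (≈-trans (≈-sym p) q) j∈))
  find-coh (k∉ ∷ _) (x ∷ xs) (there i∈) (here r)   p =
    ⊥-elim (All.All¬⇒¬Any k∉ (Membershipₚ.∈-resp-≈ setoid (≈-trans p r) i∈))
  find-coh (_ ∷ u)  (x ∷ xs) (there i∈) (there j∈) p = find-coh u xs i∈ j∈ p

  find-irrelevant : ∀ {is} → Unique.Unique setoid is → ∀ (xs : Choice is) {i} (p q : i ∈ is) →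
                    Fib._≈_ i (find xs p) (find xs q)
  find-irrelevant u xs {i} p q = Fib.≈-trans i (Fib.≈-sym i (tr-id ≈-refl (find xs p))) (find-coh u xs p q ≈-refl)

  infix 4 _≈ᶜ_
  _≈ᶜ_ : ∀ {is} → Choice is → Choice is → Set
  _≈ᶜ_ {is} xs ys = ∀ {i} (i∈ : i ∈ is) → Fib._≈_ i (find xs i∈) (find ys i∈)

  choiceSetoid : List Index → Setoid 0ℓ 0ℓ
  choiceSetoid is = record
    { Carrier = Choice is ; _≈_ = _≈ᶜ_
    ; isEquivalence = record
      { refl = λ {_} {i} _ → Fib.≈-refl i
      ; sym = λ e {i} i∈ → Fib.≈-sym i (e i∈)
      ; trans = λ e e′ {i} i∈ → Fib.≈-trans i (e i∈) (e′ i∈) } }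

  -- Built from the duplicate-free `elements`, so that no family of choices is counted twice when a
  -- product of sums is expanded.
  choices : ∀ is → List (Choice is)
  choices []       = [] ∷ []
  choices (i ∷ is) = cartesianProductWith _∷_ (Fib.elements i) (choices is)

  private
    head-≈ : ∀ {i is} {x y : Carrier (fib i)} {xs ys : Choice is} → (x ∷ xs) ≈ᶜ (y ∷ ys) → Fib._≈_ i x y
    head-≈ {i} {x = x} {y} e =
      Fib.≈-trans i (Fib.≈-sym i (tr-id _ x)) (Fib.≈-trans i (e (here ≈-refl)) (tr-id _ y))

    ∷-cong : ∀ {i is} {x y : Carrier (fib i)} {xs ys : Choice is} →
             Fib._≈_ i x y → xs ≈ᶜ ys → (x ∷ xs) ≈ᶜ (y ∷ ys)
    ∷-cong p e (here q)   = tr-cong (≈-sym q) p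
    ∷-cong p e (there i∈) = e i∈

  choices-unique : ∀ is → Unique.Unique (choiceSetoid is) (choices is)
  choices-unique []       = [] ∷ []
  choices-unique (i ∷ is) = Uniqueₚ.cartesianProductWith⁺ (Fib.setoid i) (choiceSetoid is) (choiceSetoid (i ∷ is))
    _∷_ (λ {w} {x} {y} {z} e → head-≈ {xs = y} {z} e , (λ i∈ → e (there i∈)))
    (Fib.elements-unique i) (choices-unique is)

  choices-complete : ∀ {is} (xs : Choice is) → Membership._∈_ (choiceSetoid is) xs (choices is)
  choices-complete []                       = here λ ()
  choices-complete {i ∷ is} (x ∷ xs) =
    Membershipₚ.∈-cartesianProductWith⁺ (Fib.setoid i) (choiceSetoid is) (choiceSetoid (i ∷ is))
      (λ {_} {_} {ys} {zs} p e → ∷-cong {xs = ys} {zs} p e)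
      (Fib.elements-complete i x) (choices-complete xs)

  restrict : Section I A → ∀ is → Choice is
  restrict s []       = []
  restrict s (i ∷ is) = at s i ∷ restrict s is

  find-restrict : ∀ s is {i} (i∈ : i ∈ is) → Fib._≈_ i (find (restrict s is) i∈) (at s i)
  find-restrict s (_ ∷ is) (here p)   = coh s (≈-sym p)
  find-restrict s (_ ∷ is) (there i∈) = find-restrict s is i∈

  section : Choice (elements I) → Section I A
  section xs = record
    { at  = λ i → find xs (elements-complete i)
    ; coh = λ {i} {j} p → find-coh elements-unique xs (elements-complete i) (elements-complete j) p }

  restrict-section : ∀ xs → restrict (section xs) (elements I) ≈ᶜ xs
  restrict-section xs {i} i∈ = Fib.≈-trans i (find-restrict (section xs) (elements I) i∈)
    (find-irrelevant elements-unique xs (elements-complete i) i∈)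

  sections : List (Section I A)
  sections = map section (choices (elements I))

  sections-unique : Unique.Unique (FinSet.setoid (∏-finSet I A)) sections
  sections-unique = Uniqueₚ.map⁺ (choiceSetoid (elements I)) (FinSet.setoid (∏-finSet I A))
    (λ {xs} {ys} e {i} i∈ → Fib.≈-trans i (find-irrelevant elements-unique xs i∈ (elements-complete i))
      (Fib.≈-trans i (e i) (find-irrelevant elements-unique ys (elements-complete i) i∈)))
    (choices-unique (elements I))

  sections-complete : ∀ s → Membership._∈_ (FinSet.setoid (∏-finSet I A)) s sections
  sections-complete s = Membershipₚ.∈-resp-≈ (FinSet.setoid (∏-finSet I A)) {sections} {section (restrict s (elements I))} {s}
    (λ i → find-restrict s (elements I) (elements-complete i))
    (Membershipₚ.∈-map⁺ (choiceSetoid (elements I)) (FinSet.setoid (∏-finSet I A))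
      (λ e i → e (elements-complete i)) {restrict s (elements I)} (choices-complete (restrict s (elements I))))

-- Subsets, and partitions with a prescribed block

Subsets : FinSet → FinSet
Subsets U = ∏-finSet U (constant (FinSet.decSetoid U) 𝔹)

Subset : FinSet → Set
Subset U = Carrier (Subsets U)

-- The same construction as `Product.part`, as `Subsets` is the same as `Product.subsets`, but free
-- of the two species; sums over product structures become sums over it by computation.
side : ∀ U → Subset U → Bool → FinSet
side U S b = sub U {λ x → at S x ≡ b} (λ p q → ≡.trans (≡.sym (coh S p)) q) (λ x → at S x Bool.≟ b)

side-≅ : ∀ U {S T : Subset U} → FinSet._≈_ (Subsets U) S T → ∀ b → side U S b ≅ side U T b
side-≅ U e b = record { inverse = record
  { to = λ (x , p) → x , ≡.trans (≡.sym (e x)) p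
  ; from = λ (x , p) → x , ≡.trans (e x) p
  ; to-cong = λ p → p ; from-cong = λ p → p ; inverse = (λ p → p) , (λ p → p) } }

module _ {n : ℕ} where
  infixr 5 _∷ˢ_
  _∷ˢ_ : Bool → Subset ⟦ n ⟧ → Subset ⟦ suc n ⟧
  b ∷ˢ S = record { at = λ { zero → b ; (suc i) → at S i } ; coh = λ { refl → refl } }

  subsets-suc : (𝔹 ×ᶠ Subsets ⟦ n ⟧) ≅ Subsets ⟦ suc n ⟧
  subsets-suc = record { inverse = record
    { to = λ (b , S) → b ∷ˢ S
    ; from = λ S → at S zero , record { at = λ i → at S (suc i) ; coh = λ { refl → refl } }
    ; to-cong = λ { (p , e) zero → p ; (p , e) (suc i) → e i }
    ; from-cong = λ e → e zero , λ i → e (suc i)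
    ; inverse = (λ { (p , e) zero → p ; (p , e) (suc i) → e i }) , (λ e → e zero , λ i → e (suc i)) } }

  side-suc : ∀ b S → card (side ⟦ suc n ⟧ (b ∷ˢ S) b) ≡ suc (card (side ⟦ n ⟧ S b))
  side-suc b S = AddsPoint.card-suc {side ⟦ n ⟧ S b} {side ⟦ suc n ⟧ (b ∷ˢ S) b} record
    { point = zero , refl
    ; ι = λ (i , p) → suc i , p
    ; ι-cong = λ { refl → refl }
    ; ι-inj = λ { refl → refl }
    ; fresh = λ { _ () }
    ; cover = λ { (zero , _) → inj₁ refl ; (suc i , p) → inj₂ ((i , p) , refl) } }

  side-other : ∀ b c S → ¬ c ≡ b → card (side ⟦ n ⟧ S b) ≡ card (side ⟦ suc n ⟧ (c ∷ˢ S) b)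
  side-other b c S c≢b = card-≅ {side ⟦ n ⟧ S b} {side ⟦ suc n ⟧ (c ∷ˢ S) b} record { inverse = record
    { to = λ (i , p) → suc i , p
    ; from = λ { (zero , p) → ⊥-elim (c≢b p) ; (suc i , p) → i , p }
    ; to-cong = λ { refl → refl }
    ; from-cong = λ { {zero , p} → ⊥-elim (c≢b p) ; {suc i , p} {suc .i , q} refl → refl }
    ; inverse = (λ { {zero , p} → ⊥-elim (c≢b p) ; {suc i , p} refl → refl })
              , (λ { {i , p} {zero , q} () ; {i , p} {suc .i , q} refl → refl }) } }

-- Partitions of U in which S is a block, as partitions of the complement of S.
module Glue (U : FinSet) (x₀ : Carrier U) where
  open FinSet U using (_≈_; ≈-refl; ≈-sym; ≈-trans)
  open Partition using (related)

  class : Partition U → Subset U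
  class π = record { at = λ y → related π x₀ y ; coh = λ p → related-cong U π ≈-refl p }

  module _ (S : Subset U) (x₀∈S : at S x₀ ≡ true) where
    private
      V : FinSet
      V = side U S false

      t≢f : ∀ {b} → b ≡ true → b ≡ false → ⊥
      t≢f refl ()

      module _ (π : Partition V) where
        private module π = Partition π
        -- The values of the indicator of S at x and y are separate arguments with equations, so
        -- that every case analysis is plain pattern matching; `glue` supplies the values themselves
        -- and `refl`.
        rel : ∀ x y b c → at S x ≡ b → at S y ≡ c → Bool
        rel x y true  true  p q = true
        rel x y true  false p q = false
        rel x y false true  p q = false
        rel x y false false p q = related π (x , p) (y , q)

        rel-refl : ∀ {x y} → x ≈ y → ∀ b c p q → rel x y b c p q ≡ true
        rel-refl e true  true  p q = refl
        rel-refl e true  false p q = ⊥-elim (t≢f p (≡.trans (coh S e) q))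
        rel-refl e false true  p q = ⊥-elim (t≢f q (≡.trans (≡.sym (coh S e)) p))
        rel-refl e false false p q = π.~-refl e

        rel-sym : ∀ x y b c p q → rel x y b c p q ≡ true → rel y x c b q p ≡ true
        rel-sym x y true  true  p q r = refl
        rel-sym x y false false p q r = π.~-sym r

        rel-trans : ∀ x y z b c d p q r → rel x y b c p q ≡ true → rel y z c d q r ≡ true → rel x z b d p r ≡ true
        rel-trans x y z true  true  true  p q r s t = refl
        rel-trans x y z false false false p q r s t = π.~-trans s t

        rel-false : ∀ x y b c p q (p′ : at S x ≡ false) (q′ : at S y ≡ false) →
                    rel x y b c p q ≡ related π (x , p′) (y , q′)
        rel-false x y true  c     p q p′ q′ = ⊥-elim (t≢f p p′)
        rel-false x y false true  p q p′ q′ = ⊥-elim (t≢f q q′)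
        rel-false x y false false p q p′ q′ = related-cong V π ≈-refl ≈-refl

        rel-true : ∀ x y b c p q → at S x ≡ true → rel x y b c p q ≡ c
        rel-true x y true  true  p q p′ = refl
        rel-true x y true  false p q p′ = refl
        rel-true x y false c     p q p′ = ⊥-elim (t≢f p′ p)

    glue : Partition V → Partition U
    glue π = record
      { related = λ x y → rel π x y (at S x) (at S y) refl refl
      ; ~-refl  = λ {x} {y} e → rel-refl π e (at S x) (at S y) refl refl
      ; ~-sym   = λ {x} {y} → rel-sym π x y (at S x) (at S y) refl refl
      ; ~-trans = λ {x} {y} {z} → rel-trans π x y z (at S x) (at S y) (at S z) refl refl refl }

    glue-outside : ∀ π x y → related (glue π) (proj₁ x) (proj₁ y) ≡ related π x y
    glue-outside π (x , p) (y , q) = rel-false π x y (at S x) (at S y) refl refl p q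

    glue-inside : ∀ π x y → at S x ≡ true → related (glue π) x y ≡ at S y
    glue-inside π x y p = rel-true π x y (at S x) (at S y) refl refl p

    glue-injective : ∀ {π ρ} → FinSet._≈_ (partitions U) (glue π) (glue ρ) → FinSet._≈_ (partitions V) π ρ
    glue-injective {π} {ρ} e x y =
      ≡.trans (≡.sym (glue-outside π x y)) (≡.trans (e (proj₁ x) (proj₁ y)) (glue-outside ρ x y))

    glue-cong : ∀ {π ρ} → FinSet._≈_ (partitions V) π ρ → FinSet._≈_ (partitions U) (glue π) (glue ρ)
    glue-cong {π} {ρ} e x y = lemma (at S x) (at S y) refl refl
      where
      lemma : ∀ b c p q → rel π x y b c p q ≡ rel ρ x y b c p q
      lemma true  true  p q = refl
      lemma true  false p q = refl
      lemma false true  p q = refl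
      lemma false false p q = e _ _

    class-glue : ∀ π → FinSet._≈_ (Subsets U) (class (glue π)) S
    class-glue π y = glue-inside π x₀ y x₀∈S

    unglue : Partition U → Partition V
    unglue π = record
      { related = λ x y → related π (proj₁ x) (proj₁ y)
      ; ~-refl = Partition.~-refl π ; ~-sym = Partition.~-sym π ; ~-trans = Partition.~-trans π }

    -- The hypothesis makes S the block of x₀, so π relates all of S and nothing in S to anything
    -- outside.
    glue-unglue : ∀ π → FinSet._≈_ (Subsets U) (class π) S → FinSet._≈_ (partitions U) π (glue (unglue π))
    glue-unglue π e x y = lemma (at S x) (at S y) refl refl
      where
      open Partition π using (~-trans; ~-sym)
      lemma : ∀ b c p q → related π x y ≡ rel (unglue π) x y b c p q
      lemma true  true  p q = ~-trans (~-sym (≡.trans (e x) p)) (≡.trans (e y) q)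
      lemma true  false p q = Bool.¬-not λ r → t≢f (~-trans (≡.trans (e x) p) r) (≡.trans (e y) q)
      lemma false true  p q = Bool.¬-not λ r → t≢f (~-trans (≡.trans (e y) q) (~-sym r)) (≡.trans (e x) p)
      lemma false false p q = refl

    blocks-glue : ∀ π → AddsPoint (blocks V π) (blocks U (glue π))
    blocks-glue π = record
      { point = x₀
      ; ι = proj₁
      ; ι-cong = λ {x} {y} r → ≡.trans (glue-outside π x y) r
      ; ι-inj = λ {x} {y} r → ≡.trans (≡.sym (glue-outside π x y)) r
      ; fresh = λ (x , p) r → t≢f r (≡.trans (class-glue π x) p)
      ; cover = λ y → cover y (at S y) refl }
      where
      cover : ∀ y b → at S y ≡ b → FinSet._≈_ (blocks U (glue π)) y x₀ ⊎ (Σ (Carrier V) λ x → FinSet._≈_ (blocks U (glue π)) y (proj₁ x))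
      cover y true  p = inj₁ (≡.trans (glue-inside π y x₀ p) x₀∈S)
      cover y false p = inj₂ ((y , p) , Partition.~-refl (glue π) {y} {y} ≈-refl)

    block-inside : ∀ π → block U (glue π) x₀ ≅ side U S true
    block-inside π = record { inverse = record
      { to = λ (y , r) → y , ≡.trans (≡.sym (class-glue π y)) r
      ; from = λ (y , p) → y , ≡.trans (class-glue π y) p
      ; to-cong = λ p → p ; from-cong = λ p → p ; inverse = (λ p → p) , (λ p → p) } }

    block-outside : ∀ π x → block V π x ≅ block U (glue π) (proj₁ x)
    block-outside π x = record { inverse = record
      { to = λ (y , r) → proj₁ y , ≡.trans (glue-outside π x y) r
      ; from = λ (y , r) → (y , outside y r) , ≡.trans (≡.sym (glue-outside π x (y , outside y r))) r
      ; to-cong = λ p → p ; from-cong = λ p → p ; inverse = (λ p → p) , (λ p → p) } }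
      where
      outside : ∀ y → related (glue π) (proj₁ x) y ≡ true → at S y ≡ false
      outside y r = Bool.¬-not λ p → t≢f
        (≡.trans (≡.sym (glue-inside π y (proj₁ x) p)) (Partition.~-sym (glue π) {proj₁ x} {y} r)) (proj₂ x)

-- Weighted sums over subsets and partitions

module PartitionSums {c ℓ₁ ℓ₂} (K : ArchimedeanOrderedField c ℓ₁ ℓ₂) where
  open ArchimedeanOrderedField K hiding (sum; product; zero)
  open FieldProperties K
  open PowerSeries K
  open SemiringSolver commutativeSemiring using (solve; _:+_; _:*_; _:=_)
  module Sum = Folding +-commutativeMonoid
  module Prod = Folding *-commutativeMonoid
  open Sum using () renaming (⨁[_]_ to ∑ᶠ[_]_) public
  open Prod using () renaming (⨁[_]_ to ∏ᶠ[_]_) public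

  fold-*ˡ : ∀ {a} {A : Set a} z (g : A → Scalar) xs → z * Sum.fold (map g xs) ≈ Sum.fold (map (λ x → z * g x) xs)
  fold-*ˡ z g []       = zeroʳ z
  fold-*ˡ z g (x ∷ xs) = ≈-trans (distribˡ z _ _) (+-congˡ (fold-*ˡ z g xs))

  fold-*ʳ : ∀ {a} {A : Set a} z (g : A → Scalar) xs → Sum.fold (map g xs) * z ≈ Sum.fold (map (λ x → g x * z) xs)
  fold-*ʳ z g []       = zeroˡ z
  fold-*ʳ z g (x ∷ xs) = ≈-trans (distribʳ z _ _) (+-congˡ (fold-*ʳ z g xs))

  module _ (I : FinSet) (A : Family (FinSet.decSetoid I))
           (wt : ∀ i → Carrier (Family.fib A i) → Scalar)
           (wt-cong : ∀ i {x y} → FinSet._≈_ (Family.fib A i) x y → wt i x ≈ wt i y)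
           (wt-tr : ∀ {i j} (p : FinSet._≈_ I i j) x → wt j (Family.tr A p x) ≈ wt i x) where
    open Family A using (fib)
    open Choices I A
    private
      value : ∀ {is} → Choice is → Scalar
      value []                   = 1#
      value (_∷_ {x = i} x xs) = wt i x * value xs

      value-cong : ∀ {is} {xs ys : Choice is} → xs ≈ᶜ ys → value xs ≈ value ys
      value-cong {xs = []}     {[]}     e = ≈-refl
      value-cong {i ∷ is} {x ∷ xs} {y ∷ ys} e = *-cong
        (≈-trans (≈-sym (wt-tr _ x)) (≈-trans (wt-cong i (e (here (FinSet.≈-refl I)))) (wt-tr _ y)))
        (value-cong {xs = xs} {ys} (λ i∈ → e (there i∈)))

      value-restrict : ∀ s is → Prod.fold (map (λ i → wt i (at s i)) is) ≈ value (restrict s is)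
      value-restrict s []       = ≈-refl
      value-restrict s (i ∷ is) = *-congˡ (value-restrict s is)

      sum-choices : ∀ is → Sum.fold (map value (choices is)) ≈ Prod.fold (map (λ i → ∑ᶠ[ fib i ] wt i) is)
      sum-choices []       = +-identityʳ 1#
      sum-choices (i ∷ is) = begin
        Sum.fold (map value (choices (i ∷ is)))
          ≈⟨ Sum.fold-map-cartesianProductWith value _∷_ (elements (fib i)) (choices is) ⟩
        Sum.fold (map (λ x → Sum.fold (map (λ xs → wt i x * value xs) (choices is))) (elements (fib i)))
          ≈⟨ Sum.fold-map-cong (elements (fib i)) (λ x → fold-*ˡ (wt i x) value (choices is)) ⟨
        Sum.fold (map (λ x → wt i x * Sum.fold (map value (choices is))) (elements (fib i)))
          ≈⟨ fold-*ʳ _ (wt i) (elements (fib i)) ⟨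
        ∑ᶠ[ fib i ] wt i * Sum.fold (map value (choices is))
          ≈⟨ *-congˡ (sum-choices is) ⟩
        Prod.fold (map (λ i → ∑ᶠ[ fib i ] wt i) (i ∷ is))  ∎
        where open ≈-Reasoning

    -- Distributivity: expanding a product of sums picks one structure in each factor, and the
    -- coherent picks are the sections.
    ∑-sections : ∑ᶠ[ ∏-finSet I A ] (λ s → ∏ᶠ[ I ] λ i → wt i (at s i)) ≈ ∏ᶠ[ I ] λ i → ∑ᶠ[ fib i ] wt i
    ∑-sections = begin
      ∑ᶠ[ ∏-finSet I A ] g
        ≈⟨ Sum.⨁-list (∏-finSet I A) {g} (λ e → Prod.⨁-cong I (λ i → wt-cong i (e i))) sections-unique sections-complete ⟩
      Sum.fold (map g (map section (choices (elements I))))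
        ≈⟨ Sum.fold-map-map g section (choices (elements I)) ⟩
      Sum.fold (map (g ∘ section) (choices (elements I)))
        ≈⟨ Sum.fold-map-cong (choices (elements I)) (λ xs → ≈-trans (value-restrict (section xs) (elements I))
             (value-cong {xs = restrict (section xs) (elements I)} {xs} (restrict-section xs))) ⟩
      Sum.fold (map value (choices (elements I)))
        ≈⟨ sum-choices (elements I) ⟩
      ∏ᶠ[ I ] (λ i → ∑ᶠ[ fib i ] wt i)  ∎
      where
      open ≈-Reasoning
      g : Section I A → Scalar
      g s = ∏ᶠ[ I ] λ i → wt i (at s i)

  subsetSum : ℕ → (ℕ → ℕ → Scalar) → Scalar
  subsetSum n φ = ∑ᶠ[ Subsets ⟦ n ⟧ ] λ S → φ (card (side ⟦ n ⟧ S true)) (card (side ⟦ n ⟧ S false))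

  ∑-subsets-suc : ∀ n {g} → Congruent setoid (Subsets ⟦ suc n ⟧) g →
    ∑ᶠ[ Subsets ⟦ suc n ⟧ ] g ≈ ∑ᶠ[ Subsets ⟦ n ⟧ ] (λ S → g (true ∷ˢ S)) + ∑ᶠ[ Subsets ⟦ n ⟧ ] (λ S → g (false ∷ˢ S))
  ∑-subsets-suc n {g} g-cong = begin
    ∑ᶠ[ Subsets ⟦ suc n ⟧ ] g
      ≈⟨ Sum.⨁-≅ (subsets-suc {n}) {λ (b , S) → g (b ∷ˢ S)} {g} g-cong (λ _ → ≈-refl) ⟨
    ∑ᶠ[ 𝔹 ×ᶠ Subsets ⟦ n ⟧ ] (λ (b , S) → g (b ∷ˢ S))
      ≈⟨ Sum.⨁-× 𝔹 (Subsets ⟦ n ⟧) (λ e → g-cong (to-cong (subsets-suc {n}) e)) ⟩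
    G true + (G false + 0#)
      ≈⟨ +-congˡ (+-identityʳ _) ⟩
    G true + G false  ∎
    where
    open ≈-Reasoning
    G : Bool → Scalar
    G b = ∑ᶠ[ Subsets ⟦ n ⟧ ] λ S → g (b ∷ˢ S)

  side-card-cong : ∀ U (φ : ℕ → ℕ → Scalar) →
    Congruent setoid (Subsets U) (λ S → φ (card (side U S true)) (card (side U S false)))
  side-card-cong U φ {S} {T} e = reflexive (≡.cong₂ φ
    (card-≅ {side U S true} {side U T true} (side-≅ U {S} {T} e true))
    (card-≅ {side U S false} {side U T false} (side-≅ U {S} {T} e false)))

  subsetSum-suc : ∀ n φ → subsetSum (suc n) φ ≈ subsetSum n (λ i j → φ (suc i) j) + subsetSum n (λ i j → φ i (suc j))
  subsetSum-suc n φ = ≈-trans (∑-subsets-suc n (λ {S} {T} → side-card-cong ⟦ suc n ⟧ φ {S} {T}))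
    (+-cong (Sum.⨁-cong (Subsets ⟦ n ⟧) (λ S → reflexive (≡.cong₂ φ (side-suc true S) (≡.sym (side-other false true S (λ ()))))))
            (Sum.⨁-cong (Subsets ⟦ n ⟧) (λ S → reflexive (≡.cong₂ φ (≡.sym (side-other true false S (λ ()))) (side-suc false S)))))

  fromℕ-! : ∀ n → fromℕ (suc n !) ≈ fromℕ (n !) * fromℕ (suc n)
  fromℕ-! n = ≈-trans (fromℕ-* (suc n) (n !)) (*-comm _ _)

  infix 4 _isEGFof_
  -- Written without division, so that a shift of F is visibly a derivative of f.
  _isEGFof_ : Series → (ℕ → Scalar) → Set ℓ₁
  f isEGFof F = ∀ n → F n ≈ fromℕ (n !) * f n

  isEGF-suc : ∀ {f F} → f isEGFof F → ∂ f isEGFof (F ∘ suc)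
  isEGF-suc {f} {F} e n = ≈-trans (e (suc n)) (≈-trans (*-congʳ (fromℕ-! n)) (*-assoc _ _ _))

  -- The point 0 lies in the subset or in its complement, which shifts F or G, that is,
  -- differentiates f or g. The induction is thus the Leibniz rule, and no binomial coefficients
  -- appear.
  subsetSum-⊛ : ∀ n {f g F G} → f isEGFof F → g isEGFof G →
                subsetSum n (λ i j → F i * G j) ≈ fromℕ (n !) * (f ⊛ g) n
  subsetSum-⊛ zero {f} {g} {F} {G} f~F g~G = begin
    F 0 * G 0 + 0#                        ≈⟨ +-identityʳ _ ⟩
    F 0 * G 0                             ≈⟨ *-cong (f~F 0) (g~G 0) ⟩
    fromℕ 1 * f 0 * (fromℕ 1 * g 0)       ≈⟨ *-cong (≈-trans (*-congʳ (+-identityʳ 1#)) (*-identityˡ _)) ≈-refl ⟩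
    f 0 * (fromℕ 1 * g 0)                 ≈⟨ solve 3 (λ x y o → x :* (o :* y) := o :* (x :* y)) ≈-refl (f 0) (g 0) (fromℕ 1) ⟩
    fromℕ 1 * (f 0 * g 0)                 ∎
    where open ≈-Reasoning
  subsetSum-⊛ (suc n) {f} {g} {F} {G} f~F g~G = begin
    subsetSum (suc n) (λ i j → F i * G j)
      ≈⟨ subsetSum-suc n (λ i j → F i * G j) ⟩
    subsetSum n (λ i j → F (suc i) * G j) + subsetSum n (λ i j → F i * G (suc j))
      ≈⟨ +-cong (subsetSum-⊛ n {∂ f} {g} (isEGF-suc f~F) g~G) (subsetSum-⊛ n {f} {∂ g} f~F (isEGF-suc g~G)) ⟩
    fromℕ (n !) * (∂ f ⊛ g) n + fromℕ (n !) * (f ⊛ ∂ g) n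
      ≈⟨ distribˡ _ _ _ ⟨
    fromℕ (n !) * ((∂ f ⊛ g) n + (f ⊛ ∂ g) n)
      ≈⟨ *-congˡ (∂-⊛ f g n) ⟨
    fromℕ (n !) * (fromℕ (suc n) * (f ⊛ g) (suc n))
      ≈⟨ *-assoc _ _ _ ⟨
    fromℕ (n !) * fromℕ (suc n) * (f ⊛ g) (suc n)
      ≈⟨ *-congʳ (fromℕ-! n) ⟨
    fromℕ (suc n !) * (f ⊛ g) (suc n)  ∎
    where open ≈-Reasoning

  module _ (v : ℕ → Scalar) where
    blockProduct : ∀ U → Partition U → Scalar
    blockProduct U π = ∏ᶠ[ blocks U π ] λ x → v (card (block U π x))

    v-block-cong : ∀ U π → Congruent setoid (blocks U π) (λ x → v (card (block U π x)))
    v-block-cong U π {x} {y} r = reflexive (≡.cong v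
      (card-≅ {block U π x} {block U π y} (blockIso idᵇ {π} {π} (λ _ _ → refl) r)))

    term : (ℕ → Scalar) → ∀ U → Partition U → Scalar
    term f U π = f (card (blocks U π)) * blockProduct U π

    term-≅ : ∀ f {U V} (σ : U ≅ V) {π ρ} → FinSet._≈_ (partitions V) (movePartition σ π) ρ → term f U π ≈ term f V ρ
    term-≅ f {U} {V} σ {π} {ρ} e = *-cong
      (reflexive (≡.cong f (card-≅ {blocks U π} {blocks V ρ} (blocksIso σ {π} {ρ} e))))
      (Prod.⨁-≅ {blocks U π} {blocks V ρ} (blocksIso σ {π} {ρ} e) (v-block-cong V ρ)
        (λ x → reflexive (≡.cong v (card-≅ {block U π x} {block V ρ (to σ x)}
          (blockIso σ {π} {ρ} e (Partition.~-refl ρ (FinSet.≈-refl V)))))))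

    term-cong : ∀ f U → Congruent setoid (partitions U) (term f U)
    term-cong f U {π} {ρ} e = term-≅ f (idᵇ {U}) {π} {ρ} e

    -- On `⟦ n ⟧` this is the Bell polynomial formula for n! times coefficient n of f̂ ∘ v̂; the
    -- value v 0 is never read, since blocks are nonempty. Both sequences are arbitrary, so
    -- truncated and signed weights are allowed.
    partitionSum : (ℕ → Scalar) → FinSet → Scalar
    partitionSum f U = ∑ᶠ[ partitions U ] term f U

    partitionsIso : ∀ {U V} → U ≅ V → partitions U ≅ partitions V
    partitionsIso {U} {V} σ = record { inverse = record
      { to = movePartition σ
      ; from = movePartition (σ ⁻¹ᵇ)
      ; to-cong = λ e y y′ → e _ _
      ; from-cong = λ e x x′ → e _ _
      ; inverse = (λ {π} {ρ} e y y′ → ≡.trans (e _ _) (related-cong V π (to-from σ y) (to-from σ y′)))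
                , (λ {π} {ρ} e x x′ → ≡.trans (e _ _) (related-cong U π (from-to σ x) (from-to σ x′))) } }

    partitionSum-≅ : ∀ f {U V} → U ≅ V → partitionSum f U ≈ partitionSum f V
    partitionSum-≅ f {U} {V} σ = Sum.⨁-≅ (partitionsIso σ) (λ {π} {ρ} → term-cong f V {π} {ρ})
      (λ π → term-≅ f σ {π} {movePartition σ π} (λ _ _ → refl))

    partitionSum-card : ∀ f U → partitionSum f U ≈ partitionSum f ⟦ card U ⟧
    partitionSum-card f U = partitionSum-≅ f (enumeration U)

    partitionSum-0 : ∀ f → partitionSum f ⟦ 0 ⟧ ≈ f 0
    partitionSum-0 f = begin
      partitionSum f ⟦ 0 ⟧        ≈⟨ Sum.⨁-list (partitions ⟦ 0 ⟧) (λ {π} {ρ} → term-cong f ⟦ 0 ⟧ {π} {ρ}) {π₀ ∷ []} ([] ∷ []) (λ _ → here λ ()) ⟩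
      f 0 * 1# + 0#               ≈⟨ +-identityʳ _ ⟩
      f 0 * 1#                    ≈⟨ *-identityʳ _ ⟩
      f 0                         ∎
      where
      open ≈-Reasoning
      π₀ : Partition ⟦ 0 ⟧
      π₀ = record { related = λ () ; ~-refl = λ { {()} } ; ~-sym = λ { {()} } ; ~-trans = λ { {()} } }

    -- The glued block contributes v of its size and raises the number of blocks by one, which
    -- shifts f.
    term-glue : ∀ f U x₀ S x₀∈S π → let open Glue U x₀ in
      term f U (glue S x₀∈S π) ≈ v (card (side U S true)) * term (f ∘ suc) (side U S false) π
    term-glue f U x₀ S x₀∈S π = begin
      f (card (blocks U (glue S x₀∈S π))) * blockProduct U (glue S x₀∈S π)
        ≈⟨ *-cong (reflexive (≡.cong f (AddsPoint.card-suc bg)))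
             (≈-trans (Prod.⨁-point bg (v-block-cong U (glue S x₀∈S π)))
               (*-cong (reflexive (≡.cong v (card-≅ (block-inside S x₀∈S π))))
                       (Prod.⨁-cong (blocks V π) (λ x → reflexive (≡.cong v (≡.sym (card-≅ (block-outside S x₀∈S π x)))))))) ⟩
      f (suc (card (blocks V π))) * (v (card (side U S true)) * blockProduct V π)
        ≈⟨ solve 3 (λ a b c → a :* (b :* c) := b :* (a :* c)) ≈-refl _ _ _ ⟩
      v (card (side U S true)) * term (f ∘ suc) V π  ∎
      where
      open ≈-Reasoning
      open Glue U x₀
      V : FinSet
      V = side U S false
      bg : AddsPoint (blocks V π) (blocks U (glue S x₀∈S π))
      bg = blocks-glue S x₀∈S π

    -- The chain rule in combinatorial form, grouping partitions by the block of `zero`. Here i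
    -- counts the other elements of that block, hence `v (suc i)`, and j the elements outside it.
    partitionSum-suc : ∀ f n → partitionSum f ⟦ suc n ⟧ ≈
                       subsetSum n (λ i j → v (suc i) * partitionSum (f ∘ suc) ⟦ j ⟧)
    partitionSum-suc f n = begin
      partitionSum f U
        ≈⟨ Sum.⨁-fibres (partitions U) (Subsets U) class (term f U) ⟩
      ∑ᶠ[ Subsets U ] G
        ≈⟨ ∑-subsets-suc n {G} (λ {S} {T} → G-cong {S} {T}) ⟩
      ∑ᶠ[ Subsets ⟦ n ⟧ ] (λ S → G (true ∷ˢ S)) + ∑ᶠ[ Subsets ⟦ n ⟧ ] (λ S → G (false ∷ˢ S))
        ≈⟨ +-cong (Sum.⨁-cong (Subsets ⟦ n ⟧) with-block) (≈-trans (Sum.⨁-cong (Subsets ⟦ n ⟧) without-block) (Sum.fold-map-ε (elements (Subsets ⟦ n ⟧)))) ⟩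
      subsetSum n (λ i j → v (suc i) * partitionSum (f ∘ suc) ⟦ j ⟧) + 0#
        ≈⟨ +-identityʳ _ ⟩
      subsetSum n (λ i j → v (suc i) * partitionSum (f ∘ suc) ⟦ j ⟧)  ∎
      where
      open ≈-Reasoning
      U : FinSet
      U = ⟦ suc n ⟧
      open Glue U zero
      _≟ˢ_ : (S T : Subset U) → Dec (FinSet._≈_ (Subsets U) S T)
      _≟ˢ_ = FinSet._≟_ (Subsets U)
      G : Subset U → Scalar
      G S = ∑ᶠ[ partitions U ] λ π → if does (class π ≟ˢ S) then term f U π else 0#
      G-cong : Congruent setoid (Subsets U) G
      G-cong {S} {T} e = Sum.⨁-cong (partitions U) λ π → reflexive (≡.cong (λ b → if b then term f U π else 0#)
        (Dec.does-⇔ (mk⇔ (λ p y → ≡.trans (p y) (e y)) (λ p y → ≡.trans (p y) (≡.sym (e y)))) (class π ≟ˢ S) (class π ≟ˢ T)))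
      with-block : ∀ S → G (true ∷ˢ S) ≈ v (suc (card (side ⟦ n ⟧ S true))) * partitionSum (f ∘ suc) ⟦ card (side ⟦ n ⟧ S false) ⟧
      with-block S = begin
        G (true ∷ˢ S)
          ≈⟨ Sum.⨁-image (partitions U) (partitions V) (glue S′ refl) (λ π → class π ≟ˢ S′)
               (λ {π} {ρ} e p y → ≡.trans (≡.sym (e zero y)) (p y))
               (λ {π} {ρ} → glue-injective S′ refl {π} {ρ}) (λ {π} {ρ} → glue-cong S′ refl {π} {ρ})
               (class-glue S′ refl) (λ π e → unglue S′ refl π , glue-unglue S′ refl π e) {term f U} (λ {π} {ρ} → term-cong f U {π} {ρ}) ⟩
        ∑ᶠ[ partitions V ] (λ π → term f U (glue S′ refl π))
          ≈⟨ Sum.⨁-cong (partitions V) (term-glue f U zero S′ refl) ⟩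
        ∑ᶠ[ partitions V ] (λ π → v (card (side U S′ true)) * term (f ∘ suc) V π)
          ≈⟨ fold-*ˡ _ (term (f ∘ suc) V) (elements (partitions V)) ⟨
        v (card (side U S′ true)) * partitionSum (f ∘ suc) V
          ≈⟨ *-cong (reflexive (≡.cong v (side-suc true S))) (partitionSum-card (f ∘ suc) V) ⟩
        v (suc (card (side ⟦ n ⟧ S true))) * partitionSum (f ∘ suc) ⟦ card V ⟧
          ≈⟨ *-congˡ (reflexive (≡.cong (λ k → partitionSum (f ∘ suc) ⟦ k ⟧) (side-other false true S (λ ())))) ⟨
        v (suc (card (side ⟦ n ⟧ S true))) * partitionSum (f ∘ suc) ⟦ card (side ⟦ n ⟧ S false) ⟧  ∎
        where
        S′ : Subset U
        S′ = true ∷ˢ S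
        V : FinSet
        V = side U S′ false
      -- The block of `zero` contains `zero`, so no partition is assigned to such a subset.
      without-block : ∀ S → G (false ∷ˢ S) ≈ 0#
      without-block S = ≈-trans (Sum.⨁-cong (partitions U) λ π →
          reflexive (≡.cong (λ b → if b then term f U π else 0#)
            (Dec.dec-false (class π ≟ˢ (false ∷ˢ S)) (λ e → t≢f (≡.trans (≡.sym (Partition.~-refl π refl)) (e zero))))))
        (Sum.fold-map-ε (elements (partitions U)))
        where
        t≢f : ¬ true ≡ false
        t≢f ()

-- Total weights of products, compositions and sums of species

card-⟦⟧ : ∀ n → card ⟦ n ⟧ ≡ n
card-⟦⟧ n = ≡.trans (Permutationₚ.xs↭ys⇒|xs|≡|ys| (FinSet.setoid ⟦ n ⟧) (elements-↭-list ⟦ n ⟧ (UniqueProp.allFin⁺ n) ∈-allFin))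
  (List.length-tabulate {n = n} (λ i → i))

module _ {c ℓ₁ ℓ₂} (K : ArchimedeanOrderedField c ℓ₁ ℓ₂) where
  open WeightedSpecies

  AssembledFrom : Species K → Species K → Set (lsuc 0ℓ ⊔ ℓ₁)
  AssembledFrom A B = _≃_ K A (_∘ˢ_ K (ℰ K) B)

module SpeciesTotals {c ℓ₁ ℓ₂} (K : ArchimedeanOrderedField c ℓ₁ ℓ₂) where
  open ArchimedeanOrderedField K hiding (product; zero)
  open WeightedSpecies K
  open FieldProperties K
  open PartitionSums K

  indicator : Bool → Scalar
  indicator b = if b then 1# else 0#

  weightOn : Species → FinSet → Scalar
  weightOn F U = ∑ᶠ[ F [ U ] ] Species.w F U

  transportIso : ∀ F {U V} → U ≅ V → F [ U ] ≅ F [ V ]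
  transportIso F {U} {V} σ = record { inverse = record
    { to = F.transport σ
    ; from = F.transport (σ ⁻¹ᵇ)
    ; to-cong = F.transport-cong σ σ (λ _ → FinSet.≈-refl V)
    ; from-cong = F.transport-cong (σ ⁻¹ᵇ) (σ ⁻¹ᵇ) (λ _ → FinSet.≈-refl U)
    ; inverse = (λ {s} {t} e → F.On.≈-trans V (F.transport-cong σ σ (λ _ → FinSet.≈-refl V) e)
                  (F.On.≈-trans V (F.transport-∘′ (σ ⁻¹ᵇ) σ idᵇ s (to-from σ)) (F.transport-id s)))
              , (λ {s} {t} e → F.On.≈-trans U (F.transport-cong (σ ⁻¹ᵇ) (σ ⁻¹ᵇ) (λ _ → FinSet.≈-refl U) e)
                  (F.On.≈-trans U (F.transport-∘′ σ (σ ⁻¹ᵇ) idᵇ s (from-to σ)) (F.transport-id s))) } }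
    where module F = Species F

  -- Transport along an enumeration of U preserves weights.
  weightOn-card : ∀ F U → weightOn F U ≈ ∣ F [ card U ]∣ʷ
  weightOn-card F U = Sum.⨁-≅ (transportIso F (enumeration U)) (Species.w-cong F)
    (λ s → ≈-sym (Species.w-transport F (enumeration U) s))

  ∑-none : ∀ {A : Set} (g : A → Scalar) → (A → ⊥) → ∀ xs → Sum.fold (map g xs) ≈ 0#
  ∑-none g none []      = ≈-refl
  ∑-none g none (x ∷ _) = ⊥-elim (none x)

  module _ (P : Fibration) where
    open Fibration P

    ∑-total : ∀ U {L} → Unique.Unique (DecSetoid.setoid (shapes U)) L →
      (∀ (i : DecSetoid.Carrier (shapes U)) → Carrier (fib i) → Membership._∈_ (DecSetoid.setoid (shapes U)) i L) →
      ∀ {g : Carrier (total P [ U ]) → Scalar} → Congruent setoid (total P [ U ]) g →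
      ∑ᶠ[ total P [ U ] ] g ≈ sum (map (λ i → ∑ᶠ[ fib i ] (λ x → g (i , x))) L)
    ∑-total U uL covers {g} g-cong = Sum.⨁-∑ (shapes U) _ (support U) supported uL covers {g} g-cong

  ∣·∣ʷ : ∀ F G n → ∣ F · G [ n ]∣ʷ ≈ subsetSum n (λ i j → ∣ F [ i ]∣ʷ * ∣ G [ j ]∣ʷ)
  ∣·∣ʷ F G n = ≈-trans
    (∑-total (Product.fibration F G) U (FinSet.elements-unique (Subsets U))
      (λ S _ → FinSet.elements-complete (Subsets U) S)
      {Species.w (F · G) U} (λ {s} {t} → Species.w-cong (F · G) {U} {s} {t}))
    (Sum.⨁-cong (Subsets U) on-subset)
    where
    open ≈-Reasoning
    U : FinSet
    U = ⟦ n ⟧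
    on-subset : ∀ S → ∑ᶠ[ F [ side U S true ] ×ᶠ G [ side U S false ] ] (λ (s , t) → Species.w F _ s * Species.w G _ t) ≈
                ∣ F [ card (side U S true) ]∣ʷ * ∣ G [ card (side U S false) ]∣ʷ
    on-subset S = begin
      ∑ᶠ[ F [ V ] ×ᶠ G [ W ] ] (λ (s , t) → Species.w F V s * Species.w G W t)
        ≈⟨ Sum.⨁-× (F [ V ]) (G [ W ]) {λ (s , t) → Species.w F V s * Species.w G W t}
             (λ { {s , t} {s′ , t′} (p , q) → *-cong (Species.w-cong F p) (Species.w-cong G q) }) ⟩
      (∑ᶠ[ F [ V ] ] λ s → ∑ᶠ[ G [ W ] ] λ t → Species.w F V s * Species.w G W t)
        ≈⟨ Sum.⨁-cong (F [ V ]) (λ s → fold-*ˡ (Species.w F V s) (Species.w G W) (elements (G [ W ]))) ⟨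
      (∑ᶠ[ F [ V ] ] λ s → Species.w F V s * weightOn G W)
        ≈⟨ fold-*ʳ (weightOn G W) (Species.w F V) (elements (F [ V ])) ⟨
      weightOn F V * weightOn G W
        ≈⟨ *-cong (weightOn-card F V) (weightOn-card G W) ⟩
      ∣ F [ card V ]∣ʷ * ∣ G [ card W ]∣ʷ  ∎
      where
      V W : FinSet
      V = side U S true
      W = side U S false

  module _ (F B : Species) (g : ℕ → Scalar) where
    private
      module F = Species F
      module B = Species B
      module Comp = Composition F B

    -- The factor g lets one computation serve twice: g = 1 yields the total weight of a
    -- composition, the indicator of m the numerator of the probability.
    marked : ∀ U → Carrier ((F ∘ˢ B) [ U ]) → Scalar
    marked U t = g (card (components F B U t)) * Species.w (F ∘ˢ B) U t

    marked-cong : ∀ U → Congruent setoid ((F ∘ˢ B) [ U ]) (marked U)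
    marked-cong U {t@(π , _)} {t′@(ρ , _)} e@(p , _) = *-cong
      (reflexive (≡.cong g (card-≅ {blocks U π} {blocks U ρ} (blocksIso idᵇ {π} {ρ} p))))
      (Species.w-cong (F ∘ˢ B) {s = t} {t = t′} e)

    -- For a fixed partition the weight factorises: the F-structure on the blocks sums to a total
    -- depending only on their number, and `∑-sections` treats the blocks one by one.
    ∑-marked : ∀ U → ∑ᶠ[ (F ∘ˢ B) [ U ] ] marked U ≈
               partitionSum (λ k → ∣ B [ k ]∣ʷ) (λ k → g k * ∣ F [ k ]∣ʷ) U
    ∑-marked U = ≈-trans
      (∑-total (Composition.fibration F B) U (FinSet.elements-unique (partitions U)) (λ π _ → FinSet.elements-complete (partitions U) π)
        {marked U} (λ {s} {t} → marked-cong U {s} {t}))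
      (Sum.⨁-cong (partitions U) on-partition)
      where
      open ≈-Reasoning
      on-partition : ∀ π → ∑ᶠ[ F [ blocks U π ] ×ᶠ Comp.assemblies U π ] (λ x → marked U (π , x)) ≈
                     term (λ k → ∣ B [ k ]∣ʷ) (λ k → g k * ∣ F [ k ]∣ʷ) U π
      on-partition π = begin
        ∑ᶠ[ F [ blocks U π ] ×ᶠ Comp.assemblies U π ] (λ x → marked U (π , x))
          ≈⟨ fold-*ˡ (g k) (λ (s , b) → F.w _ s * wt b) (elements (F [ blocks U π ] ×ᶠ Comp.assemblies U π)) ⟨
        g k * (∑ᶠ[ F [ blocks U π ] ×ᶠ Comp.assemblies U π ] λ (s , b) → F.w _ s * wt b)
          ≈⟨ *-congˡ (Sum.⨁-× (F [ blocks U π ]) (Comp.assemblies U π) {λ (s , b) → F.w _ s * wt b}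
               (λ { {s , b} {t , d} (p , q) → *-cong (F.w-cong p) (wt-cong {b} {d} q) })) ⟩
        g k * (∑ᶠ[ F [ blocks U π ] ] λ s → ∑ᶠ[ Comp.assemblies U π ] λ b → F.w _ s * wt b)
          ≈⟨ *-congˡ (Sum.⨁-cong (F [ blocks U π ]) (λ s → fold-*ˡ (F.w _ s) wt (elements (Comp.assemblies U π)))) ⟨
        g k * (∑ᶠ[ F [ blocks U π ] ] λ s → F.w _ s * ∑ᶠ[ Comp.assemblies U π ] wt)
          ≈⟨ *-congˡ (fold-*ʳ _ (F.w (blocks U π)) (elements (F [ blocks U π ]))) ⟨
        g k * (weightOn F (blocks U π) * ∑ᶠ[ Comp.assemblies U π ] wt)
          ≈⟨ *-congˡ (*-cong (weightOn-card F (blocks U π))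
               (≈-trans (∑-sections (blocks U π) (Comp.onBlocks U π) (λ x → B.w (block U π x)) (λ x → B.w-cong) (λ p → B.w-transport _))
                 (Prod.⨁-cong (blocks U π) (λ x → weightOn-card B (block U π x))))) ⟩
        g k * (∣ F [ k ]∣ʷ * blockProduct (λ k → ∣ B [ k ]∣ʷ) U π)
          ≈⟨ *-assoc _ _ _ ⟨
        term (λ k → ∣ B [ k ]∣ʷ) (λ k → g k * ∣ F [ k ]∣ʷ) U π  ∎
        where
        k : ℕ
        k = card (blocks U π)
        wt : Carrier (Comp.assemblies U π) → Scalar
        wt b = ∏ᶠ[ blocks U π ] λ x → B.w (block U π x) (at b x)
        wt-cong : Congruent setoid (Comp.assemblies U π) wt
        wt-cong q = Prod.⨁-cong (blocks U π) (λ x → B.w-cong (q x))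

  partitionSum-cong : ∀ v {f g : ℕ → Scalar} → (∀ k → f k ≈ g k) → ∀ U → partitionSum v f U ≈ partitionSum v g U
  partitionSum-cong v e U = Sum.⨁-cong (partitions U) (λ π → *-congʳ (e _))

  ∣∘∣ʷ : ∀ F B n → ∣ F ∘ˢ B [ n ]∣ʷ ≈ partitionSum (λ k → ∣ B [ k ]∣ʷ) (λ k → ∣ F [ k ]∣ʷ) ⟦ n ⟧
  ∣∘∣ʷ F B n = ≈-trans
    (Sum.⨁-cong ((F ∘ˢ B) [ ⟦ n ⟧ ]) (λ t → ≈-sym (*-identityˡ (Species.w (F ∘ˢ B) ⟦ n ⟧ t))))
    (≈-trans (∑-marked F B (λ _ → 1#) ⟦ n ⟧)
      (partitionSum-cong (λ k → ∣ B [ k ]∣ʷ) {λ k → 1# * ∣ F [ k ]∣ʷ} {λ k → ∣ F [ k ]∣ʷ} (λ k → *-identityˡ ∣ F [ k ]∣ʷ) ⟦ n ⟧))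

  ∣≃∣ʷ : ∀ {F G} → F ≃ G → ∀ n → ∣ F [ n ]∣ʷ ≈ ∣ G [ n ]∣ʷ
  ∣≃∣ʷ {F} {G} φ n = Sum.⨁-≅ (_≃_.iso φ ⟦ n ⟧) (Species.w-cong G) (λ s → ≈-sym (_≃_.weight-preserving φ ⟦ n ⟧ s))

  ∣ℰ∣∣ʷ : ∀ {P : ℕ → Set} (P? : ∀ k → Dec (P k)) n → ∣ ℰ∣ P? [ n ]∣ʷ ≈ indicator (does (P? n))
  ∣ℰ∣∣ʷ {P} P? n = ≈-trans (on-truth (P? (card ⟦ n ⟧))) (reflexive (≡.cong (λ k → indicator (does (P? k))) (card-⟦⟧ n)))
    where
    on-truth : ∀ {Q : Set} (d : Dec Q) → ∑ᶠ[ truth d ] (λ _ → 1#) ≈ indicator (does d)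
    on-truth (yes _) = +-identityʳ 1#
    on-truth (no _)  = ≈-refl

  -- The index set is infinite, but `bounded` confines the inhabited summands on n points to indices
  -- at most n.
  ∣∑ᵢ∣ʷ : ∀ F bounded n → ∣ ∑ᵢ F bounded [ n ]∣ʷ ≈ sum (applyUpTo (λ j → ∣ F j [ n ]∣ʷ) (suc n))
  ∣∑ᵢ∣ʷ F bounded n = ≈-trans
    (∑-total (sumFibration ℕ._≟_ F (λ U → upTo (suc (card U))) λ {U} k s → ∈-upTo⁺ (ℕ.s≤s (bounded k U s))) ⟦ n ⟧ {upTo (suc n)} (UniqueProp.upTo⁺ (suc n))
      (λ j s → ∈-upTo⁺ (ℕ.s≤s (≡.subst (j ℕ.≤_) (card-⟦⟧ n) (bounded j ⟦ n ⟧ s))))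
      {Species.w (∑ᵢ F bounded) ⟦ n ⟧} (λ {s} {t} → Species.w-cong (∑ᵢ F bounded) {⟦ n ⟧} {s} {t}))
    (reflexive (≡.cong sum (List.map-upTo (λ j → ∣ F j [ n ]∣ʷ) (suc n))))

  module _ (A B : Species) (φ : AssembledFrom K A B) (m : ℕ) (U : FinSet) where
    private
      g : ℕ → Scalar
      g k = indicator (does (k ℕ.≟ m))
      inA : Carrier (A [ U ]) → Scalar
      inA s = if does (hasComponents? A B φ m U s) then Species.w A U s else 0#

    ∑-hasComponents : sum (map (Species.w A U) (filter (hasComponents? A B φ m U) (elements (A [ U ])))) ≈
      partitionSum (λ k → ∣ B [ k ]∣ʷ) g U
    ∑-hasComponents = begin
      sum (map (Species.w A U) (filter (hasComponents? A B φ m U) (elements (A [ U ]))))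
        ≈⟨ Sum.⨁-filter (A [ U ]) (hasComponents? A B φ m U) (Species.w A U) ⟩
      ∑ᶠ[ A [ U ] ] inA
        ≈⟨ Sum.⨁-≅ (_≃_.iso φ U) {inA} {marked ℰ B g U} (λ {s} {t} → marked-cong ℰ B g U {s} {t})
             to-marked ⟩
      ∑ᶠ[ (ℰ ∘ˢ B) [ U ] ] marked ℰ B g U
        ≈⟨ ∑-marked ℰ B g U ⟩
      partitionSum (λ k → ∣ B [ k ]∣ʷ) (λ k → g k * ∣ ℰ [ k ]∣ʷ) U
        ≈⟨ partitionSum-cong (λ k → ∣ B [ k ]∣ʷ) {λ k → g k * ∣ ℰ [ k ]∣ʷ} {g} (λ k → ≈-trans (*-congˡ (∣ℰ∣∣ʷ (λ _ → yes tt) k)) (*-identityʳ _)) U ⟩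
      partitionSum (λ k → ∣ B [ k ]∣ʷ) g U  ∎
      where
      open ≈-Reasoning
      select : ∀ b {x} → (if b then x else 0#) ≈ indicator b * x
      select true  = ≈-sym (*-identityˡ _)
      select false = ≈-sym (zeroˡ _)
      to-marked : ∀ s → inA s ≈ marked ℰ B g U (to (_≃_.iso φ U) s)
      to-marked s = ≈-trans (select (does (hasComponents? A B φ m U s))) (*-congˡ (≈-sym (_≃_.weight-preserving φ U s)))

  module _ (B : Species) (n : ℕ) (s : Carrier (B [ ⟦ suc n ⟧ ])) where
    private
      module B = Species B
      U : FinSet
      U = ⟦ suc n ⟧
      whole : Partition U
      whole = record { related = λ _ _ → true ; ~-refl = λ _ → refl ; ~-sym = λ _ → refl ; ~-trans = λ _ _ → refl }
      intoBlock : ∀ x → U ≅ block U whole x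
      intoBlock x = record { inverse = record
        { to = λ y → y , refl ; from = proj₁ ; to-cong = λ p → p ; from-cong = λ p → p
        ; inverse = (λ p → p) , (λ p → p) } }

    singleBlock : Carrier ((ℰ ∘ˢ B) [ U ])
    singleBlock = whole , tt , record
      { at = λ x → B.transport (intoBlock x) s
      ; coh = λ {x} {y} p → B.transport-∘′ (intoBlock x) (blockIso idᵇ {whole} {whole} (λ _ _ → refl) {x} {y} p) (intoBlock y) s (λ _ → refl) }

    w-singleBlock : Species.w (ℰ ∘ˢ B) U singleBlock ≈ B.w U s
    w-singleBlock = ≈-trans (*-identityˡ _) (≈-trans
      (Prod.⨁-cong (blocks U whole) (λ x → B.w-transport (intoBlock x) s))
      (≈-trans (Prod.⨁-list (blocks U whole) (λ _ → ≈-refl) {zero ∷ []} ([] ∷ []) (λ _ → here refl)) (*-identityʳ _)))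

  -- Pull the one-block assembly carrying s back along φ: its weight is that of s. The size is
  -- `suc n` because the partition of the empty set has no block.
  connected-positive : ∀ A B → AssembledFrom K A B → Positive A → ∀ n s → 0# < Species.w B ⟦ suc n ⟧ s
  connected-positive A B φ A>0 n s = <-≤-trans (A>0 ⟦ suc n ⟧ a) (≤-reflexive (begin
    Species.w A ⟦ suc n ⟧ a                          ≈⟨ _≃_.weight-preserving φ ⟦ suc n ⟧ a ⟨
    Species.w (ℰ ∘ˢ B) ⟦ suc n ⟧ (to (_≃_.iso φ ⟦ suc n ⟧) a) ≈⟨ Species.w-cong (ℰ ∘ˢ B) {s = to (_≃_.iso φ ⟦ suc n ⟧) a} {t = t} (to-from (_≃_.iso φ ⟦ suc n ⟧) t) ⟩
    Species.w (ℰ ∘ˢ B) ⟦ suc n ⟧ t                   ≈⟨ w-singleBlock B n s ⟩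
    Species.w B ⟦ suc n ⟧ s                          ∎))
    where
    open ≈-Reasoning
    t : Carrier ((ℰ ∘ˢ B) [ ⟦ suc n ⟧ ])
    t = singleBlock B n s
    a : Carrier (A [ ⟦ suc n ⟧ ])
    a = from (_≃_.iso φ ⟦ suc n ⟧) t

  ∑-nonneg : ∀ {A : Set} (g : A → Scalar) → (∀ x → 0# ≤ g x) → ∀ xs → 0# ≤ sum (map g xs)
  ∑-nonneg g p []       = ≤-refl
  ∑-nonneg g p (x ∷ xs) = +-nonneg (p x) (∑-nonneg g p xs)

-- Exponential generating functions of species and of the inverse of ℰ

module GeneratingFunctions {c ℓ₁ ℓ₂} (K : ArchimedeanOrderedField c ℓ₁ ℓ₂) where
  open ArchimedeanOrderedField K hiding (product; zero)
  open WeightedSpecies K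
  open FieldProperties K
  open PowerSeries K
  open PartitionSums K
  open SpeciesTotals K
  open Bender K using (sum-applyUpTo-last)
  open SemiringSolver commutativeSemiring using (solve; _:+_; _:*_; _:=_)

  n!≉0 : ∀ n → ¬ fromℕ (n !) ≈ 0#
  n!≉0 n = fromℕ≉0 (n !) {{n ℕ.!≢0}}

  0!≈1 : fromℕ (0 !) ≈ 1#
  0!≈1 = +-identityʳ 1#

  egf : (ℕ → Scalar) → Series
  egf a n = a n / fromℕ (n !)

  egf-isEGF : ∀ a → egf a isEGFof a
  egf-isEGF a n = ≈-sym (≈-trans (*-comm _ _) (x/y*y≈x (a n) (n!≉0 n)))

  isEGF-unique : ∀ {f a} → f isEGFof a → f ≋ egf a
  isEGF-unique {f} {a} e n = *-cancelˡ-≈ (n!≉0 n) (≈-trans (≈-sym (e n)) (egf-isEGF a n))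

  egf-cong : ∀ {a b} → (∀ n → a n ≈ b n) → egf a ≋ egf b
  egf-cong e n = *-congʳ (e n)

  egf-0 : ∀ a → egf a 0 ≈ a 0
  egf-0 a = ≈-sym (≈-trans (egf-isEGF a 0) (≈-trans (*-congʳ 0!≈1) (*-identityˡ _)))

  ∂-egf : ∀ a → ∂ (egf a) ≋ egf (a ∘ suc)
  ∂-egf a = isEGF-unique (isEGF-suc (egf-isEGF a))

  egf-• : ∀ x a → egf (λ n → x * a n) ≋ x • egf a
  egf-• x a n = *-assoc _ _ _

  egf-- : ∀ a b → egf (λ n → a n - b n) ≋ egf a ⊞ ⊟ egf b
  egf-- a b n = ≈-trans (distribʳ _ _ _) (+-congˡ (≈-sym (RingP.-‿distribˡ-* _ _)))

  egf-low : ∀ N a → egf (low N a) ≋ low N (egf a)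
  egf-low N a n with N ℕ.≤? n
  ... | yes N≤n = ≈-trans (*-congʳ (low-≥ N a n N≤n)) (≈-trans (zeroˡ _) (≈-sym (low-≥ N (egf a) n N≤n)))
  ... | no N≰n  = ≈-trans (*-congʳ (low-< N a n (ℕ.≰⇒> N≰n))) (≈-sym (low-< N (egf a) n (ℕ.≰⇒> N≰n)))

  egf-· : ∀ F G → egf (λ n → ∣ F · G [ n ]∣ʷ) ≋ egf (λ n → ∣ F [ n ]∣ʷ) ⊛ egf (λ n → ∣ G [ n ]∣ʷ)
  egf-· F G n = ≈-sym (isEGF-unique
    (λ n → ≈-trans (∣·∣ʷ F G n) (subsetSum-⊛ n (egf-isEGF (λ n → ∣ F [ n ]∣ʷ)) (egf-isEGF (λ n → ∣ G [ n ]∣ʷ)))) n)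

  egf-·ᵛ : ∀ F Φ → egf (λ n → ∣ F ·ᵛ Φ [ n ]∣ᵛ) ≋ egf (λ n → ∣ F [ n ]∣ʷ) ⊛ egf (λ n → ∣ Φ [ n ]∣ᵛ)
  egf-·ᵛ F Φ = begin
    egf (λ n → ∣ F ·ᵛ Φ [ n ]∣ᵛ)
      ≈⟨ egf-- (λ n → ∣ F · Virtual.pos Φ [ n ]∣ʷ) (λ n → ∣ F · Virtual.neg Φ [ n ]∣ʷ) ⟩
    egf (λ n → ∣ F · Virtual.pos Φ [ n ]∣ʷ) ⊞ ⊟ egf (λ n → ∣ F · Virtual.neg Φ [ n ]∣ʷ)
      ≈⟨ Ser.+-cong (egf-· F (Virtual.pos Φ)) (Ser.-‿cong (egf-· F (Virtual.neg Φ))) ⟩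
    F̂ ⊛ P̂ ⊞ ⊟ (F̂ ⊛ N̂)
      ≈⟨ Ser.+-congˡ {F̂ ⊛ P̂} (SerP.-‿distribʳ-* F̂ N̂) ⟩
    F̂ ⊛ P̂ ⊞ F̂ ⊛ ⊟ N̂
      ≈⟨ ⊛-distribˡ F̂ P̂ (⊟ N̂) ⟨
    F̂ ⊛ (P̂ ⊞ ⊟ N̂)
      ≈⟨ ⊛-congˡ {F̂} (egf-- (λ n → ∣ Virtual.pos Φ [ n ]∣ʷ) (λ n → ∣ Virtual.neg Φ [ n ]∣ʷ)) ⟨
    F̂ ⊛ egf (λ n → ∣ Φ [ n ]∣ᵛ)  ∎
    where
    open SetoidReasoning Ser.setoid
    F̂ P̂ N̂ : Series
    F̂ = egf (λ n → ∣ F [ n ]∣ʷ)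
    P̂ = egf (λ n → ∣ Virtual.pos Φ [ n ]∣ʷ)
    N̂ = egf (λ n → ∣ Virtual.neg Φ [ n ]∣ʷ)

  -- The composite f̂ ∘ v̂ of exponential generating functions.
  compose : (v f : ℕ → Scalar) → Series
  compose v f = egf (λ n → partitionSum v f ⟦ n ⟧)

  compose-cong : ∀ v {f g : ℕ → Scalar} → (∀ k → f k ≈ g k) → compose v f ≋ compose v g
  compose-cong v e = egf-cong (λ n → partitionSum-cong v e ⟦ n ⟧)

  compose-0 : ∀ v f → compose v f 0 ≈ f 0
  compose-0 v f = ≈-trans (egf-0 (λ n → partitionSum v f ⟦ n ⟧)) (partitionSum-0 v f)

  -- The chain rule, where `f ∘ suc` is the sequence of the derivative of f̂. The choices of a
  -- constant, of `sign` and of an indicator for f give the equations of exp B, exp(-B) and the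
  -- divided powers of B.
  ∂-compose : ∀ v f → ∂ (compose v f) ≋ ∂ (egf v) ⊛ compose v (f ∘ suc)
  ∂-compose v f n = ≈-trans (∂-egf (λ n → partitionSum v f ⟦ n ⟧) n) (≈-sym (isEGF-unique
    (λ n → ≈-trans (partitionSum-suc v f n)
      (subsetSum-⊛ n (isEGF-suc (egf-isEGF v)) (egf-isEGF (λ j → partitionSum v (f ∘ suc) ⟦ j ⟧)))) n))

  compose-• : ∀ v x f → compose v (λ k → x * f k) ≋ x • compose v f
  compose-• v x f n = ≈-trans (egf-cong (λ n → ≈-trans
      (Sum.⨁-cong (partitions ⟦ n ⟧) (λ π → *-assoc x (f (card (blocks ⟦ n ⟧ π))) (blockProduct v ⟦ n ⟧ π)))
      (≈-sym (fold-*ˡ x (term v f ⟦ n ⟧) (elements (partitions ⟦ n ⟧))))) n)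
    (egf-• x (λ n → partitionSum v f ⟦ n ⟧) n)

  compose-⊞ : ∀ v f g → compose v (λ k → f k + g k) ≋ compose v f ⊞ compose v g
  compose-⊞ v f g n = ≈-trans
    (*-congʳ (≈-trans (Sum.⨁-cong (partitions ⟦ n ⟧) (λ π → distribʳ _ (f (card (blocks ⟦ n ⟧ π))) _))
      (Sum.fold-map-∙ (term v f ⟦ n ⟧) (term v g ⟦ n ⟧) (elements (partitions ⟦ n ⟧)))))
    (distribʳ _ _ _)

  compose-0ˢ : ∀ v → compose v 0ˢ ≋ 0ˢ
  compose-0ˢ v n = ≈-trans (*-congʳ (≈-trans (Sum.⨁-cong (partitions ⟦ n ⟧) (λ π → zeroˡ _))
    (Sum.fold-map-ε (elements (partitions ⟦ n ⟧))))) (zeroˡ _)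

  -- The values (-1)^k, whose exponential generating function is exp(-z). The recursion by a scalar
  -- factor fits `compose-•`.
  sign : ℕ → Scalar
  sign zero    = 1#
  sign (suc n) = - 1# * sign n

  -1•≋⊟ : ∀ f → (- 1#) • f ≋ ⊟ f
  -1•≋⊟ f n = ≈-trans (≈-sym (RingP.-‿distribˡ-* 1# (f n))) (-‿cong (*-identityˡ (f n)))

  ∂-compose-sign : ∀ v → ∂ (compose v sign) ≋ ⊟ ∂ (egf v) ⊛ compose v sign
  ∂-compose-sign v = begin
    ∂ (compose v sign)                             ≈⟨ ∂-compose v sign ⟩
    ∂ (egf v) ⊛ compose v (λ k → - 1# * sign k)    ≈⟨ ⊛-congˡ {∂ (egf v)} (compose-• v (- 1#) sign) ⟩
    ∂ (egf v) ⊛ ((- 1#) • compose v sign)          ≈⟨ ⊛-congˡ {∂ (egf v)} (-1•≋⊟ (compose v sign)) ⟩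
    ∂ (egf v) ⊛ ⊟ compose v sign                   ≈⟨ SerP.-‿distribʳ-* (∂ (egf v)) (compose v sign) ⟨
    ⊟ (∂ (egf v) ⊛ compose v sign)                 ≈⟨ SerP.-‿distribˡ-* (∂ (egf v)) (compose v sign) ⟩
    ⊟ ∂ (egf v) ⊛ compose v sign                   ∎
    where open SetoidReasoning Ser.setoid

  exp : Series
  exp = egf (λ _ → 1#)

  -- The derivative of the product cancels to 0, and its constant term is 1.
  exp⊛sign : exp ⊛ egf sign ≋ 1ˢ
  exp⊛sign = ∂-injective
    (≈-trans (*-cong (egf-0 (λ _ → 1#)) (egf-0 sign)) (*-identityˡ 1#))
    (begin
      ∂ (exp ⊛ egf sign)                           ≈⟨ ∂-⊛ exp (egf sign) ⟩
      ∂ exp ⊛ egf sign ⊞ exp ⊛ ∂ (egf sign)        ≈⟨ Ser.+-cong (⊛-congʳ (∂-egf (λ _ → 1#)))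
        (⊛-congˡ {exp} (λ n → ≈-trans (∂-egf sign n) (≈-trans (egf-• (- 1#) sign n) (-1•≋⊟ (egf sign) n)))) ⟩
      exp ⊛ egf sign ⊞ exp ⊛ ⊟ egf sign            ≈⟨ Ser.+-congˡ {exp ⊛ egf sign} (Ser.sym (SerP.-‿distribʳ-* exp (egf sign))) ⟩
      exp ⊛ egf sign ⊞ ⊟ (exp ⊛ egf sign)          ≈⟨ Ser.-‿inverseʳ (exp ⊛ egf sign) ⟩
      0ˢ                                           ≈⟨ ∂-1ˢ ⟨
      ∂ 1ˢ                                         ∎)
    where open SetoidReasoning Ser.setoid

  -- The series (exp - 1)^j.
  power : ℕ → Series
  power j = egf (λ n → ∣ ℰ₊ ^ˢ j [ n ]∣ʷ)

  power-0 : power 0 ≋ 1ˢ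
  power-0 zero    = ≈-trans (egf-0 (λ n → ∣ 𝟙 [ n ]∣ʷ)) (∣ℰ∣∣ʷ (λ k → + k ≟ℤ + 0) 0)
  power-0 (suc n) = ≈-trans (*-congʳ (∣ℰ∣∣ʷ (λ k → + k ≟ℤ + 0) (suc n))) (zeroˡ _)

  expm1 : Series
  expm1 = egf (λ n → ∣ ℰ₊ [ n ]∣ʷ)

  power-suc : ∀ j → power (suc j) ≋ expm1 ⊛ power j
  power-suc j = egf-· ℰ₊ (ℰ₊ ^ˢ j)

  nonempty? : ∀ k → Dec (¬ k ≡ 0)
  nonempty? k = Relation.Nullary.¬? (k ℕ.≟ 0)

  expm1-0 : expm1 0 ≈ 0#
  expm1-0 = ≈-trans (egf-0 (λ n → ∣ ℰ₊ [ n ]∣ʷ)) (∣ℰ∣∣ʷ nonempty? 0)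

  expm1⊞1 : expm1 ⊞ 1ˢ ≋ exp
  expm1⊞1 zero    = ≈-trans (+-congʳ expm1-0) (≈-trans (+-identityˡ 1#) (≈-sym (egf-0 (λ _ → 1#))))
  expm1⊞1 (suc n) = ≈-trans (+-identityʳ _) (*-congʳ (∣ℰ∣∣ʷ nonempty? (suc n)))

  power-vanishes : ∀ j n → n ℕ.< j → power j n ≈ 0#
  power-vanishes (suc j) zero    _           =
    ≈-trans (power-suc j 0) (≈-trans (*-congʳ expm1-0) (zeroˡ _))
  power-vanishes (suc j) (suc n) (ℕ.s≤s n<j) = begin
    power (suc j) (suc n)
      ≈⟨ power-suc j (suc n) ⟩
    expm1 0 * power j (suc n) + (expm1 ∘ suc ⊛ power j) n
      ≈⟨ +-cong (≈-trans (*-congʳ expm1-0) (zeroˡ _))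
           (⊛-cong≤ n {g′ = 0ˢ} (λ _ _ → ≈-refl) (λ k k≤n → power-vanishes j k (ℕ.≤-<-trans k≤n n<j))) ⟩
    0# + (expm1 ∘ suc ⊛ 0ˢ) n
      ≈⟨ ≈-trans (+-identityˡ _) (Ser.zeroʳ (expm1 ∘ suc) n) ⟩
    0#  ∎
    where open ≈-Reasoning

  -- ∑_{j < 2J} (−1)^j (exp − 1)^j
  alternating : ℕ → Series
  alternating zero    = 0ˢ
  alternating (suc J) = alternating J ⊞ (power (J ℕ.+ J) ⊞ ⊟ power (suc (J ℕ.+ J)))

  -- Telescoping: since exp = (exp - 1) + 1, multiplying a power of exp - 1 by exp gives that power
  -- plus the next one.
  exp⊛alternating : ∀ J → exp ⊛ alternating J ≋ 1ˢ ⊞ ⊟ power (J ℕ.+ J)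
  exp⊛alternating zero    = begin
    exp ⊛ 0ˢ        ≈⟨ Ser.zeroʳ exp ⟩
    0ˢ              ≈⟨ Ser.-‿inverseʳ 1ˢ ⟨
    1ˢ ⊞ ⊟ 1ˢ       ≈⟨ Ser.+-congˡ {1ˢ} (Ser.-‿cong power-0) ⟨
    1ˢ ⊞ ⊟ power 0  ∎
    where open SetoidReasoning Ser.setoid
  exp⊛alternating (suc J) = begin
    exp ⊛ (alternating J ⊞ (p ⊞ ⊟ q))              ≈⟨ ⊛-distribˡ exp (alternating J) (p ⊞ ⊟ q) ⟩
    exp ⊛ alternating J ⊞ exp ⊛ (p ⊞ ⊟ q)          ≈⟨ Ser.+-cong (exp⊛alternating J) (⊛-distribˡ exp p (⊟ q)) ⟩
    1ˢ ⊞ ⊟ p ⊞ (exp ⊛ p ⊞ exp ⊛ ⊟ q)               ≈⟨ Ser.+-congˡ {1ˢ ⊞ ⊟ p} (Ser.+-cong (step (J ℕ.+ J))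
      (Ser.trans (Ser.sym (SerP.-‿distribʳ-* exp q)) (Ser.-‿cong (step (suc (J ℕ.+ J)))))) ⟩
    1ˢ ⊞ ⊟ p ⊞ ((q ⊞ p) ⊞ ⊟ (r ⊞ q))               ≈⟨ (λ n → cancel (1ˢ n) (p n) (q n) (r n)) ⟩
    1ˢ ⊞ ⊟ r                                       ≈⟨ Ser.+-congˡ {1ˢ} (Ser.-‿cong (λ n → reflexive (≡.cong (λ k → power (suc k) n) (≡.sym (ℕ.+-suc J J))))) ⟩
    1ˢ ⊞ ⊟ power (suc J ℕ.+ suc J)                 ∎
    where
    open SetoidReasoning Ser.setoid
    p q r : Series
    p = power (J ℕ.+ J)
    q = power (suc (J ℕ.+ J))
    r = power (suc (suc (J ℕ.+ J)))
    step : ∀ j → exp ⊛ power j ≋ power (suc j) ⊞ power j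
    step j = begin
      exp ⊛ power j                        ≈⟨ ⊛-congʳ expm1⊞1 ⟨
      (expm1 ⊞ 1ˢ) ⊛ power j               ≈⟨ ⊛-distribʳ (power j) expm1 1ˢ ⟩
      expm1 ⊛ power j ⊞ 1ˢ ⊛ power j       ≈⟨ Ser.+-cong (Ser.sym (power-suc j)) (⊛-identityˡ (power j)) ⟩
      power (suc j) ⊞ power j              ∎
    cancel : ∀ o p q r → o - p + ((q + p) - (r + q)) ≈ o - r
    cancel o p q r = ≈-trans (+-congˡ (+-congˡ (≈-sym (RingP.-‿+-comm r q)))) (≈-trans
      (solve 6 (λ o p p⁻ q q⁻ r⁻ → o :+ p⁻ :+ ((q :+ p) :+ (r⁻ :+ q⁻)) := o :+ r⁻ :+ ((p :+ p⁻) :+ (q :+ q⁻)))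
        ≈-refl o p (- p) q (- q) (- r))
      (≈-trans (+-congˡ (≈-trans (+-cong (-‿inverseʳ p) (-‿inverseʳ q)) (+-identityˡ 0#))) (+-identityʳ _)))

  alternating-stable : ∀ n d → alternating (d ℕ.+ suc n) n ≈ alternating (suc n) n
  alternating-stable n zero    = ≈-refl
  alternating-stable n (suc d) = ≈-trans (+-cong (alternating-stable n d)
    (≈-trans (+-cong (power-vanishes (J ℕ.+ J) n n<J+J) (≈-trans (-‿cong (power-vanishes (suc (J ℕ.+ J)) n (ℕ.m≤n⇒m≤1+n n<J+J))) RingP.-0#≈0#))
      (+-identityˡ 0#))) (+-identityʳ _)
    where
    J : ℕ
    J = d ℕ.+ suc n
    n<J+J : n ℕ.< J ℕ.+ J
    n<J+J = ℕ.≤-trans (ℕ.m≤n+m (suc n) d) (ℕ.m≤m+n J J)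

  -- The infinite sum read off along the diagonal: powers beyond n do not reach degree n, so
  -- coefficient n is final after n + 1 pairs of terms.
  alternating-sum : Series
  alternating-sum n = alternating (suc n) n

  exp⊛alternating-sum : exp ⊛ alternating-sum ≋ 1ˢ
  exp⊛alternating-sum n = begin
    (exp ⊛ alternating-sum) n        ≈⟨ ⊛-cong≤ n (λ _ _ → ≈-refl) stable ⟩
    (exp ⊛ alternating (suc n)) n    ≈⟨ exp⊛alternating (suc n) n ⟩
    1ˢ n - power (suc n ℕ.+ suc n) n ≈⟨ +-congˡ (≈-trans (-‿cong (power-vanishes (suc n ℕ.+ suc n) n (ℕ.m≤m+n (suc n) (suc n)))) RingP.-0#≈0#) ⟩
    1ˢ n + 0#                        ≈⟨ +-identityʳ _ ⟩
    1ˢ n                             ∎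
    where
    open ≈-Reasoning
    stable : ∀ k → k ℕ.≤ n → alternating-sum k ≈ alternating (suc n) k
    stable k k≤n = ≈-sym (≈-trans
      (reflexive (≡.cong (λ J → alternating J k) (≡.sym (ℕ.m∸n+n≡m (ℕ.s≤s k≤n)))))
      (alternating-stable k (n ∸ k)))

  -- Both series are inverse to exp, and inverses are unique.
  alternating-sum≋sign : alternating-sum ≋ egf sign
  alternating-sum≋sign = begin
    alternating-sum                          ≈⟨ ⊛-identityˡ alternating-sum ⟨
    1ˢ ⊛ alternating-sum                     ≈⟨ ⊛-congʳ exp⊛sign ⟨
    exp ⊛ egf sign ⊛ alternating-sum         ≈⟨ ⊛-congʳ (⊛-comm exp (egf sign)) ⟩
    egf sign ⊛ exp ⊛ alternating-sum         ≈⟨ ⊛-assoc (egf sign) exp alternating-sum ⟩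
    egf sign ⊛ (exp ⊛ alternating-sum)       ≈⟨ ⊛-congˡ {egf sign} exp⊛alternating-sum ⟩
    egf sign ⊛ 1ˢ                            ≈⟨ Ser.*-identityʳ (egf sign) ⟩
    egf sign                                 ∎
    where open SetoidReasoning Ser.setoid

  ∣ℰ⁻¹∣ᵛ : ∀ n → ∣ ℰ⁻¹ [ n ]∣ᵛ ≈ sign n
  ∣ℰ⁻¹∣ᵛ n = begin
    ∣ ℰ⁻¹ [ n ]∣ᵛ
      ≈⟨ +-cong
           (∣∑ᵢ∣ʷ (λ j → ℰ₊ ^ˢ (j ℕ.+ j)) (λ j U s → ℕ.≤-trans (ℕ.m≤m+n j j) (ℰ₊^-bounded _ U s)) n)
           (-‿cong (∣∑ᵢ∣ʷ (λ j → ℰ₊ ^ˢ suc (j ℕ.+ j))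
             (λ j U s → ℕ.≤-trans (ℕ.m≤n⇒m≤1+n (ℕ.m≤m+n j j)) (ℰ₊^-bounded _ U s)) n)) ⟩
    sum (applyUpTo even (suc n)) - sum (applyUpTo odd (suc n))
      ≈⟨ difference (suc n) ⟩
    fromℕ (n !) * alternating-sum n
      ≈⟨ *-congˡ (alternating-sum≋sign n) ⟩
    fromℕ (n !) * egf sign n
      ≈⟨ egf-isEGF sign n ⟨
    sign n  ∎
    where
    open ≈-Reasoning
    even odd : ℕ → Scalar
    even j = ∣ ℰ₊ ^ˢ (j ℕ.+ j) [ n ]∣ʷ
    odd j = ∣ ℰ₊ ^ˢ suc (j ℕ.+ j) [ n ]∣ʷ
    n! : Scalar
    n! = fromℕ (n !)
    -- The common cut-off of both sums pairs the powers 2j and 2j + 1, as `alternating` does.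
    difference : ∀ J → sum (applyUpTo even J) - sum (applyUpTo odd J) ≈ n! * alternating J n
    difference zero    = ≈-trans (-‿inverseʳ 0#) (≈-sym (zeroʳ _))
    difference (suc J) = begin
      sum (applyUpTo even (suc J)) - sum (applyUpTo odd (suc J))
        ≈⟨ +-cong (sum-applyUpTo-last J even) (-‿cong (sum-applyUpTo-last J odd)) ⟩
      X + even J - (Y + odd J)
        ≈⟨ +-congˡ (RingP.-‿+-comm Y (odd J)) ⟨
      X + even J + (- Y - odd J)
        ≈⟨ solve 4 (λ x e y o → x :+ e :+ (y :+ o) := x :+ y :+ (e :+ o)) ≈-refl X (even J) (- Y) (- odd J) ⟩
      X - Y + (even J - odd J)
        ≈⟨ +-cong (difference J) (+-cong (egf-isEGF (λ n → ∣ ℰ₊ ^ˢ (J ℕ.+ J) [ n ]∣ʷ) n)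
             (≈-trans (-‿cong (egf-isEGF (λ n → ∣ ℰ₊ ^ˢ suc (J ℕ.+ J) [ n ]∣ʷ) n)) (RingP.-‿distribʳ-* _ _))) ⟩
      n! * alternating J n + (n! * power (J ℕ.+ J) n + n! * - power (suc (J ℕ.+ J)) n)
        ≈⟨ ≈-trans (+-congˡ (≈-sym (distribˡ _ _ _))) (≈-sym (distribˡ _ _ _)) ⟩
      n! * alternating (suc J) n  ∎
      where
      X Y : Scalar
      X = sum (applyUpTo even J)
      Y = sum (applyUpTo odd J)

  module _ (B : Species) where
    private
      v : ℕ → Scalar
      v k = ∣ B [ k ]∣ʷ

    egf-∘ : ∀ F → egf (λ n → ∣ F ∘ˢ B [ n ]∣ʷ) ≋ compose v (λ k → ∣ F [ k ]∣ʷ)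
    egf-∘ F = egf-cong (∣∘∣ʷ F B)

    egf-∘ᵛ : ∀ Φ → egf (λ n → ∣ Φ ∘ᵛ B [ n ]∣ᵛ) ≋ compose v (λ k → ∣ Φ [ k ]∣ᵛ)
    egf-∘ᵛ Φ = begin
      egf (λ n → ∣ Φ ∘ᵛ B [ n ]∣ᵛ)
        ≈⟨ egf-- (λ n → ∣ Virtual.pos Φ ∘ˢ B [ n ]∣ʷ) (λ n → ∣ Virtual.neg Φ ∘ˢ B [ n ]∣ʷ) ⟩
      egf (λ n → ∣ Virtual.pos Φ ∘ˢ B [ n ]∣ʷ) ⊞ ⊟ egf (λ n → ∣ Virtual.neg Φ ∘ˢ B [ n ]∣ʷ)
        ≈⟨ Ser.+-cong (egf-∘ (Virtual.pos Φ)) (Ser.-‿cong (egf-∘ (Virtual.neg Φ))) ⟩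
      compose v p ⊞ ⊟ compose v q
        ≈⟨ Ser.+-congˡ {compose v p} (λ n → ≈-trans (compose-• v (- 1#) q n) (-1•≋⊟ (compose v q) n)) ⟨
      compose v p ⊞ compose v (λ k → - 1# * q k)
        ≈⟨ compose-⊞ v p (λ k → - 1# * q k) ⟨
      compose v (λ k → p k + - 1# * q k)
        ≈⟨ compose-cong v {λ k → p k + - 1# * q k} {λ k → ∣ Φ [ k ]∣ᵛ} (λ k → +-congˡ (-1•≋⊟ q k)) ⟩
      compose v (λ k → ∣ Φ [ k ]∣ᵛ)  ∎
      where
      open SetoidReasoning Ser.setoid
      p q : ℕ → Scalar
      p k = ∣ Virtual.pos Φ [ k ]∣ʷ
      q k = ∣ Virtual.neg Φ [ k ]∣ʷ

    -- The normalised total weights of ℬ^{m−1}; the index m − 1 is an integer, so that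
    -- they vanish for m = 0.
    previous : ℕ → Series
    previous m = compose v (λ k → indicator (does (+ k ≟ℤ (+ m -ℤ 1ℤ))))

    egf-𝒟 : ∀ m → egf (λ n → ∣ 𝒟 B m [ n ]∣ᵛ) ≋ previous m ⊛ compose v sign
    egf-𝒟 m = begin
      egf (λ n → ∣ 𝒟 B m [ n ]∣ᵛ)
        ≈⟨ egf-·ᵛ (B ⁽ + m -ℤ 1ℤ ⁾) (ℰ⁻¹ ∘ᵛ B) ⟩
      egf (λ n → ∣ B ⁽ + m -ℤ 1ℤ ⁾ [ n ]∣ʷ) ⊛ egf (λ n → ∣ ℰ⁻¹ ∘ᵛ B [ n ]∣ᵛ)
        ≈⟨ Ser.*-cong
             (λ n → ≈-trans (egf-∘ ℰ₍ + m -ℤ 1ℤ ₎ n) (compose-cong v (∣ℰ∣∣ʷ (λ k → + k ≟ℤ (+ m -ℤ 1ℤ))) n))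
             (λ n → ≈-trans (egf-∘ᵛ ℰ⁻¹ n) (compose-cong v ∣ℰ⁻¹∣ᵛ n)) ⟩
      previous m ⊛ compose v sign  ∎
      where open SetoidReasoning Ser.setoid

-- Expansion of the probability of having m components

nCk*k!*[n∸k]!≡n! : ∀ {n k} → k ℕ.≤ n → (n C k) ℕ.* (k ! ℕ.* (n ∸ k) !) ≡ n !
nCk*k!*[n∸k]!≡n! {n} {k} k≤n = ≡.trans (≡.cong (ℕ._* (k ! ℕ.* (n ∸ k) !)) (nCk≡n!/k![n-k]! k≤n))
  (ℕ.m/n*n≡m (k![n∸k]!∣n! k≤n))
  where instance _ = k ℕ.!* (n ∸ k) !≢0

module Assemblies {c ℓ₁ ℓ₂} (K : ArchimedeanOrderedField c ℓ₁ ℓ₂) where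
  open ArchimedeanOrderedField K hiding (product; zero)
  open Asymptotics K
  open WeightedSpecies K
  open FieldProperties K
  open PowerSeries K
  open PartitionSums K
  open SpeciesTotals K
  open GeneratingFunctions K
  open Bender K
  open SemiringSolver commutativeSemiring using (solve; _:+_; _:*_; _:=_)

  module _ (𝒜 ℬ : Species) (ℬ∅ : Carrier (ℬ [ ⟦ 0 ⟧ ]) → ⊥) (φ : AssembledFrom K 𝒜 ℬ)
           (positive : Positive 𝒜) (gargantuan : GargantuanSpecies 𝒜) where

    v : ℕ → Scalar
    v k = ∣ ℬ [ k ]∣ʷ

    a α b α⁻¹ : Series
    a n = ∣ 𝒜 [ n ]∣ʷ
    α = egf a
    b = egf v
    α⁻¹ = compose v sign

    -- The normalised total weights of ℬ^{m}.
    H : ℕ → Series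
    H m = compose v (λ k → indicator (does (k ℕ.≟ m)))

    egf-nonneg : ∀ {x : ℕ → Scalar} → (∀ n → 0# ≤ x n) → ∀ n → 0# ≤ egf x n
    egf-nonneg x≥0 n = *-nonneg (x≥0 n) (<⇒≤ (⁻¹-positive (0<fromℕ (n !) {{n ℕ.!≢0}})))

    α≥0 : ∀ n → 0# ≤ α n
    α≥0 = egf-nonneg (λ n → ∑-nonneg (Species.w 𝒜 ⟦ n ⟧) (λ s → <⇒≤ (positive ⟦ n ⟧ s)) (elements (𝒜 [ ⟦ n ⟧ ])))

    v₀≈0 : v 0 ≈ 0#
    v₀≈0 = ∑-none (Species.w ℬ ⟦ 0 ⟧) ℬ∅ (elements (ℬ [ ⟦ 0 ⟧ ]))

    v≥0 : ∀ n → 0# ≤ v n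
    v≥0 zero    = ≤-reflexive (≈-sym v₀≈0)
    v≥0 (suc n) = ∑-nonneg (Species.w ℬ ⟦ suc n ⟧) (λ s → <⇒≤ (connected-positive 𝒜 ℬ φ positive n s)) (elements (ℬ [ ⟦ suc n ⟧ ]))

    α≋compose : α ≋ compose v (λ _ → 1#)
    α≋compose n = ≈-trans (egf-cong (∣≃∣ʷ φ) n) (≈-trans (egf-∘ ℬ ℰ n) (compose-cong v (∣ℰ∣∣ʷ (λ _ → yes tt)) n))

    ∂α : ∂ α ≋ ∂ b ⊛ α
    ∂α n = ≈-trans (*-congˡ (α≋compose (suc n))) (≈-trans (∂-compose v (λ _ → 1#) n) (⊛-congˡ {∂ b} (λ k → ≈-sym (α≋compose k)) n))

    α₀≈1 : α 0 ≈ 1#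
    α₀≈1 = ≈-trans (α≋compose 0) (compose-0 v (λ _ → 1#))

    open WithScale α α≥0 gargantuan
    open Exponential α₀≈1 b (egf-nonneg v≥0) ∂α

    ∂H₀ : ∂ (H 0) ≋ 0ˢ
    ∂H₀ n = ≈-trans (∂-compose v (λ k → indicator (does (k ℕ.≟ 0))) n)
      (≈-trans (⊛-congˡ {∂ b} (compose-0ˢ v) n) (Ser.zeroʳ (∂ b) n))

    H₀≋1 : H 0 ≋ 1ˢ
    H₀≋1 = ∂-injective (compose-0 v (λ k → indicator (does (k ℕ.≟ 0)))) (λ n → ≈-trans (∂H₀ n) (≈-sym (∂-1ˢ n)))

    ∂H : ∀ m → ∂ (H (suc m)) ≋ ∂ b ⊛ H m
    ∂H m = ∂-compose v (λ k → indicator (does (k ℕ.≟ suc m)))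

    H-suc-0 : ∀ m → H (suc m) 0 ≈ 0#
    H-suc-0 m = compose-0 v (λ k → indicator (does (k ℕ.≟ suc m)))

    b₀≈0 : b 0 ≈ 0#
    b₀≈0 = ≈-trans (egf-0 v) v₀≈0

    H-dominated : ∀ m → Dominated (H m)
    H-dominated zero    n = ≤-trans (≤-reflexive (∣∣-cong (H₀≋1 n))) (1ˢ-dominated n)
    H-dominated (suc m)   = primitive-dominated (H-suc-0 m) (∂H m) (H-dominated m)

    b-dominated : Dominated b
    b-dominated = primitive-dominated b₀≈0 (λ n → ≈-sym (Ser.*-identityʳ (∂ b) n)) 1ˢ-dominated

    -- H m = b^m / m!
    b⊛H : ∀ m → b ⊛ H m ≋ fromℕ (suc m) • H (suc m)
    b⊛H m = ∂-injective
      (≈-trans (*-congʳ b₀≈0) (≈-trans (zeroˡ _) (≈-sym (≈-trans (*-congˡ (H-suc-0 m)) (zeroʳ _)))))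
      (begin
        ∂ (b ⊛ H m)                          ≈⟨ ∂-⊛ b (H m) ⟩
        ∂ b ⊛ H m ⊞ b ⊛ ∂ (H m)              ≈⟨ Ser.+-congˡ {∂ b ⊛ H m} (b⊛∂H m) ⟩
        ∂ b ⊛ H m ⊞ fromℕ m • (∂ b ⊛ H m)    ≈⟨ (λ n → ≈-trans (+-congʳ (≈-sym (*-identityˡ _))) (≈-sym (distribʳ _ 1# (fromℕ m)))) ⟩
        fromℕ (suc m) • (∂ b ⊛ H m)          ≈⟨ (λ n → *-congˡ (∂H m n)) ⟨
        fromℕ (suc m) • ∂ (H (suc m))        ≈⟨ ∂-• (fromℕ (suc m)) (H (suc m)) ⟨
        ∂ (fromℕ (suc m) • H (suc m))        ∎)
      where
      open SetoidReasoning Ser.setoid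
      -- Proved together with `b⊛H`: the case m + 1 uses `b⊛H m`, the case 0 needs no induction.
      b⊛∂H : ∀ m → b ⊛ ∂ (H m) ≋ fromℕ m • (∂ b ⊛ H m)
      b⊛∂H zero    = begin
        b ⊛ ∂ (H 0)                ≈⟨ ⊛-congˡ {b} ∂H₀ ⟩
        b ⊛ 0ˢ                     ≈⟨ Ser.zeroʳ b ⟩
        0ˢ                         ≈⟨ (λ n → zeroˡ ((∂ b ⊛ H 0) n)) ⟨
        0# • (∂ b ⊛ H 0)           ∎
      b⊛∂H (suc m) = begin
        b ⊛ ∂ (H (suc m))                      ≈⟨ ⊛-congˡ {b} (∂H m) ⟩
        b ⊛ (∂ b ⊛ H m)                        ≈⟨ ⊛-assoc b (∂ b) (H m) ⟨
        b ⊛ ∂ b ⊛ H m                          ≈⟨ ⊛-congʳ (⊛-comm b (∂ b)) ⟩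
        ∂ b ⊛ b ⊛ H m                          ≈⟨ ⊛-assoc (∂ b) b (H m) ⟩
        ∂ b ⊛ (b ⊛ H m)                        ≈⟨ ⊛-congˡ {∂ b} (b⊛H m) ⟩
        ∂ b ⊛ (fromℕ (suc m) • H (suc m))      ≈⟨ ⊛-comm (∂ b) (fromℕ (suc m) • H (suc m)) ⟩
        (fromℕ (suc m) • H (suc m)) ⊛ ∂ b      ≈⟨ •-⊛ (fromℕ (suc m)) (H (suc m)) (∂ b) ⟩
        fromℕ (suc m) • (H (suc m) ⊛ ∂ b)      ≈⟨ (λ n → *-congˡ (⊛-comm (H (suc m)) (∂ b) n)) ⟩
        fromℕ (suc m) • (∂ b ⊛ H (suc m))      ∎

    -- For each r, exp(-P) is the signed composite for the weights `low (suc r) v`; `egf-low`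
    -- identifies truncating the weights with truncating b.
    b-expands : Expands b α⁻¹
    b-expands r = log-expansion r (compose (low (suc r) v) sign) α⁻¹
      (compose-0 (low (suc r) v) sign)
      (λ n → ≈-trans (∂-compose-sign (low (suc r) v) n)
        (⊛-congʳ (λ k → -‿cong (*-congˡ (egf-low (suc r) v (suc k)))) n))
      (compose-0 v sign) (∂-compose-sign v) b-dominated

    previous₀≋0 : previous ℬ 0 ≋ 0ˢ
    -- For m = 0 the index is -1, which no `+ k` equals, so the indicator computes to 0.
    previous₀≋0 = compose-0ˢ v

    b⊛previous : ∀ m → b ⊛ previous ℬ m ≋ fromℕ m • H m
    b⊛previous zero    n = ≈-trans (⊛-congˡ {b} previous₀≋0 n) (≈-trans (Ser.zeroʳ b n) (≈-sym (zeroˡ _)))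
    -- `+ suc m -ℤ 1ℤ` computes to `+ m`, so `previous ℬ (suc m)` is `H m` by computation.
    b⊛previous (suc m)   = b⊛H m

    -- In the inductive step the Leibniz rule yields m copies of `H m ⊛ α⁻¹` from the factor `H m`
    -- and one more from b; dividing by m + 1 leaves a single copy.
    H-expands : ∀ m → Expands (H m) (previous ℬ m ⊛ α⁻¹)
    H-expands zero    = Expands-resp (λ n → ≈-sym (H₀≋1 n))
      (λ n → ≈-sym (≈-trans (⊛-congʳ previous₀≋0 n) (⊛-zeroˡ α⁻¹ n))) 1ˢ-expands
    H-expands (suc m) = Expands-resp
      (λ n → ≈-trans (*-congˡ (b⊛H m n)) (cancel (H (suc m) n)))
      (λ n → ≈-trans (*-congˡ (derivative n)) (cancel ((H m ⊛ α⁻¹) n)))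
      (Expands-• (M ⁻¹) (Expands-⊛ b-dominated (H-dominated m) b-expands (H-expands m)))
      where
      M : Scalar
      M = fromℕ (suc m)
      cancel : ∀ x → M ⁻¹ * (M * x) ≈ x
      cancel x = ≈-trans (≈-sym (*-assoc _ _ _))
        (≈-trans (*-congʳ (⁻¹-inverseˡ (fromℕ≉0 (suc m)))) (*-identityˡ x))
      open SetoidReasoning Ser.setoid
      derivative : b ⊛ (previous ℬ m ⊛ α⁻¹) ⊞ H m ⊛ α⁻¹ ≋ M • (H m ⊛ α⁻¹)
      derivative = begin
        b ⊛ (previous ℬ m ⊛ α⁻¹) ⊞ H m ⊛ α⁻¹      ≈⟨ Ser.+-congʳ {H m ⊛ α⁻¹} (Ser.sym (⊛-assoc b (previous ℬ m) α⁻¹)) ⟩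
        b ⊛ previous ℬ m ⊛ α⁻¹ ⊞ H m ⊛ α⁻¹        ≈⟨ Ser.+-congʳ {H m ⊛ α⁻¹} (Ser.trans (⊛-congʳ (b⊛previous m)) (•-⊛ (fromℕ m) (H m) α⁻¹)) ⟩
        fromℕ m • (H m ⊛ α⁻¹) ⊞ H m ⊛ α⁻¹         ≈⟨ (λ n → ≈-trans (+-comm _ _) (≈-trans (+-congʳ (≈-sym (*-identityˡ _))) (≈-sym (distribʳ _ 1# (fromℕ m))))) ⟩
        M • (H m ⊛ α⁻¹)                         ∎

    private
      d : ℕ → Series
      d m k = ∣ 𝒟 ℬ m [ k ]∣ᵛ
      g : ℕ → Series
      g k n = fromℕ (n C k) * (a (n ∸ k) / a n)
      x : ℕ → Series
      x m n = ℙ 𝒜 n (hasComponents? 𝒜 ℬ φ m ⟦ n ⟧)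

    !⁻¹ : ℕ → Scalar
    !⁻¹ k = fromℕ (k !) ⁻¹

    0<!⁻¹ : ∀ k → 0# < !⁻¹ k
    0<!⁻¹ k = ⁻¹-positive (0<fromℕ (k !) {{k ℕ.!≢0}})

    quotient : ∀ {p q p̂ q̂ s} → ¬ s ≈ 0# → ¬ q̂ ≈ 0# → p ≈ s * p̂ → q ≈ s * q̂ → p / q ≈ p̂ / q̂
    quotient {p} {q} {p̂} {q̂} {s} s≉0 q̂≉0 p≈ q≈ = *-cancelˡ-≈ sq̂≉0 (begin
      s * q̂ * (p / q)            ≈⟨ *-comm _ _ ⟩
      p / q * (s * q̂)            ≈⟨ *-congˡ q≈ ⟨
      p / q * q                  ≈⟨ x/y*y≈x p (λ q≈0 → sq̂≉0 (≈-trans (≈-sym q≈) q≈0)) ⟩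
      p                          ≈⟨ p≈ ⟩
      s * p̂                      ≈⟨ *-congˡ (x/y*y≈x p̂ q̂≉0) ⟨
      s * (p̂ / q̂ * q̂)            ≈⟨ solve 3 (λ s t q → s :* (t :* q) := s :* q :* t) ≈-refl s (p̂ / q̂) q̂ ⟩
      s * q̂ * (p̂ / q̂)            ∎)
      where
      open ≈-Reasoning
      sq̂≉0 : ¬ s * q̂ ≈ 0#
      sq̂≉0 e = q̂≉0 (*-cancelˡ-≈ s≉0 (≈-trans e (≈-sym (zeroʳ s))))

    -- The binomial coefficient absorbs n! and (n - k)! and leaves only 1/k!, which turns `d m k`
    -- into a coefficient of the generating function of 𝒟(m).
    g≈ : ∀ k n → k ℕ.≤ n → 0# < α n → g k n ≈ !⁻¹ k * (α (n ∸ k) / α n)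
    g≈ k n k≤n 0<αn = begin
      fromℕ (n C k) * (a (n ∸ k) / a n)
        ≈⟨ *-assoc _ _ _ ⟨
      fromℕ (n C k) * a (n ∸ k) / a n
        ≈⟨ quotient (n!≉0 n) (0<⇒≉0 0<αn) numerator (egf-isEGF a n) ⟩
      !⁻¹ k * α (n ∸ k) / α n
        ≈⟨ *-assoc _ _ _ ⟩
      !⁻¹ k * (α (n ∸ k) / α n)  ∎
      where
      open ≈-Reasoning
      F G N : Scalar
      F = fromℕ (k !)
      G = fromℕ ((n ∸ k) !)
      N = fromℕ (n C k)
      numerator : N * a (n ∸ k) ≈ fromℕ (n !) * (!⁻¹ k * α (n ∸ k))
      numerator = begin
        N * a (n ∸ k)                        ≈⟨ *-congˡ (egf-isEGF a (n ∸ k)) ⟩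
        N * (G * α (n ∸ k))                  ≈⟨ *-identityʳ _ ⟨
        N * (G * α (n ∸ k)) * 1#             ≈⟨ *-congˡ (⁻¹-inverse (n!≉0 k)) ⟨
        N * (G * α (n ∸ k)) * (F * !⁻¹ k)    ≈⟨ solve 5 (λ N G α F I → N :* (G :* α) :* (F :* I) := N :* (F :* G) :* (I :* α)) ≈-refl N G (α (n ∸ k)) F (!⁻¹ k) ⟩
        N * (F * G) * (!⁻¹ k * α (n ∸ k))    ≈⟨ *-congʳ (≈-trans (*-congˡ (≈-sym (fromℕ-* (k !) ((n ∸ k) !))))
          (≈-trans (≈-sym (fromℕ-* (n C k) (k ! ℕ.* (n ∸ k) !))) (reflexive (≡.cong fromℕ (nCk*k!*[n∸k]!≡n! k≤n))))) ⟩
        fromℕ (n !) * (!⁻¹ k * α (n ∸ k))    ∎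

    x≈ : ∀ m n → 0# < α n → x m n ≈ H m n / α n
    x≈ m n 0<αn = quotient (n!≉0 n) (0<⇒≉0 0<αn)
      (≈-trans (∑-hasComponents 𝒜 ℬ φ m ⟦ n ⟧) (egf-isEGF (λ n → partitionSum v (λ k → indicator (does (k ℕ.≟ m))) ⟦ n ⟧) n))
      (egf-isEGF a n)

    module _ (m : ℕ) where
      private
        D : Series
        D = previous ℬ m ⊛ α⁻¹
        remainder : ℕ → Series
        remainder r n = x m n - (∑[ 0 ⋯ r ] λ k → d m k * g k n)

      -- After multiplication by α n this is the remainder that `H-expands` bounds. The partial sum
      -- includes the index r, hence `low (suc r)`.
      remainder≈ : ∀ r n → r ℕ.≤ n → 0# < α n → remainder r n ≈ (H m ⊞ ⊟ (low (suc r) D ⊛ α)) n / α n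
      remainder≈ r n r≤n 0<αn = begin
        x m n - sum (applyUpTo (λ k → d m k * g k n) (suc r))
          ≈⟨ +-cong (x≈ m n 0<αn) (-‿cong (sum-applyUpTo-cong (suc r) termwise)) ⟩
        H m n / α n - sum (applyUpTo (λ k → D k * α (n ∸ k) / α n) (suc r))
          ≈⟨ +-congˡ (-‿cong (sum-applyUpTo-*ʳ (α n ⁻¹) (λ k → D k * α (n ∸ k)) (suc r))) ⟨
        H m n / α n - sum (applyUpTo (λ k → D k * α (n ∸ k)) (suc r)) / α n
          ≈⟨ +-congˡ (-‿cong (*-congʳ (low-⊛-as-sum (suc r) n D α (ℕ.s≤s r≤n)))) ⟨
        H m n / α n - (low (suc r) D ⊛ α) n / α n
          ≈⟨ ≈-trans (+-congˡ (RingP.-‿distribˡ-* _ _)) (≈-sym (distribʳ _ _ _)) ⟩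
        (H m ⊞ ⊟ (low (suc r) D ⊛ α)) n / α n  ∎
        where
        open ≈-Reasoning
        termwise : ∀ k → k ℕ.< suc r → d m k * g k n ≈ D k * α (n ∸ k) / α n
        termwise k (ℕ.s≤s k≤r) = begin
          d m k * g k n                                ≈⟨ *-congˡ (g≈ k n (ℕ.≤-trans k≤r r≤n) 0<αn) ⟩
          d m k * (!⁻¹ k * (α (n ∸ k) / α n))          ≈⟨ *-assoc _ _ _ ⟨
          egf (d m) k * (α (n ∸ k) / α n)              ≈⟨ *-congʳ (egf-𝒟 ℬ m k) ⟩
          D k * (α (n ∸ k) / α n)                      ≈⟨ *-assoc _ _ _ ⟨
          D k * α (n ∸ k) / α n                        ∎

      ∣g∣≈ : ∀ k n → k ℕ.≤ n → 0# < α n → ∣ g k n ∣ ≈ !⁻¹ k * (α (n ∸ k) / α n)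
      ∣g∣≈ k n k≤n 0<αn = ≈-trans (∣∣-cong (g≈ k n k≤n 0<αn))
        (∣x∣≈x (*-nonneg (<⇒≤ (0<!⁻¹ k)) (*-nonneg (α≥0 (n ∸ k)) (<⇒≤ (⁻¹-positive 0<αn)))))

      error-bound : ∀ r → remainder r =O g (suc r)
      -- F = (r + 1)! undoes the 1/(r + 1)! contained in `g (suc r)`; the threshold `suc r` allows
      -- the use of `g≈` at that index.
      error-bound r = E * F , M ℕ.⊔ (N ℕ.⊔ suc r) , λ n le → bound n
        (small n (ℕ.m⊔n≤o⇒m≤o M _ le))
        (pos n (ℕ.m⊔n≤o⇒m≤o N _ (ℕ.m⊔n≤o⇒n≤o M _ le)))
        (ℕ.m⊔n≤o⇒n≤o N _ (ℕ.m⊔n≤o⇒n≤o M _ le))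
        where
        open O (H-expands m (suc r)) renaming (κ to E; κ-nonneg to E≥0; N to M; bound to small)
        F : Scalar
        F = fromℕ (suc r !)
        N : ℕ
        N = proj₁ α-positive
        pos : ∀ n → N ℕ.≤ n → 0# < α n
        pos = proj₂ α-positive
        bound : ∀ n → ∣ (H m ⊞ ⊟ (low (suc r) D ⊛ α)) n ∣ ≤ E * α (n ∸ suc r) → 0# < α n → suc r ℕ.≤ n →
                ∣ remainder r n ∣ ≤ E * F * ∣ g (suc r) n ∣
        bound n p 0<αn r<n = begin
          ∣ remainder r n ∣                            ≈⟨ ∣∣-cong (remainder≈ r n (ℕ.<⇒≤ r<n) 0<αn) ⟩
          ∣ z / α n ∣                                  ≈⟨ ∣x*y∣≈∣x∣*∣y∣ z (α n ⁻¹) ⟩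
          ∣ z ∣ * ∣ α n ⁻¹ ∣                           ≈⟨ *-congˡ (∣x∣≈x I≥0) ⟩
          ∣ z ∣ / α n                                  ≤⟨ *-monoʳ-≤ I≥0 p ⟩
          E * α (n ∸ suc r) / α n                      ≈⟨ *-assoc _ _ _ ⟩
          E * q                                        ≈⟨ *-congʳ (*-identityʳ E) ⟨
          E * 1# * q                                   ≈⟨ *-congʳ (*-congˡ (⁻¹-inverse (n!≉0 (suc r)))) ⟨
          E * (F * !⁻¹ (suc r)) * q                    ≈⟨ solve 4 (λ E F I q → E :* (F :* I) :* q := E :* F :* (I :* q)) ≈-refl E F (!⁻¹ (suc r)) q ⟩
          E * F * (!⁻¹ (suc r) * q)                    ≈⟨ *-congˡ (∣g∣≈ (suc r) n r<n 0<αn) ⟨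
          E * F * ∣ g (suc r) n ∣                      ∎
          where
          open ≤-Reasoning
          z q : Scalar
          z = (H m ⊞ ⊟ (low (suc r) D ⊛ α)) n
          q = α (n ∸ suc r) / α n
          I≥0 : 0# ≤ α n ⁻¹
          I≥0 = <⇒≤ (⁻¹-positive 0<αn)

      scale-bound : ∀ k → g (suc k) =o g k
      scale-bound k ε 0<ε = (M ℕ.+ k) ℕ.⊔ (N ℕ.⊔ suc k) , λ n le → bound n
        (≡.subst (λ j → α j ≤ ε′ * α (n ∸ k)) (≡.trans (ℕ.∸-+-assoc n k 1) (≡.cong (n ∸_) (ℕ.+-comm k 1)))
          (small (n ∸ k) (ℕ.m+n≤o⇒m≤o∸n M (ℕ.m⊔n≤o⇒m≤o (M ℕ.+ k) _ le))))
        (pos n (ℕ.m⊔n≤o⇒m≤o N _ (ℕ.m⊔n≤o⇒n≤o (M ℕ.+ k) _ le)))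
        (ℕ.m⊔n≤o⇒n≤o N _ (ℕ.m⊔n≤o⇒n≤o (M ℕ.+ k) _ le))
        where
        F ε′ : Scalar
        F = fromℕ (suc k !)
        -- The quotient (k + 1)!/k! compensates for the different factorials in `g k` and
        -- `g (suc k)`.
        ε′ = ε * (F * !⁻¹ k)
        N M : ℕ
        N = proj₁ α-positive
        pos : ∀ n → N ℕ.≤ n → 0# < α n
        pos = proj₂ α-positive
        ratio′ : _
        ratio′ = α-ratio ε′ (*-positive 0<ε (*-positive (0<fromℕ (suc k !) {{suc k ℕ.!≢0}}) (0<!⁻¹ k)))
        M = proj₁ ratio′
        small : ∀ n → M ℕ.≤ n → α (n ∸ 1) ≤ ε′ * α n
        small = proj₂ ratio′
        bound : ∀ n → α (n ∸ suc k) ≤ ε′ * α (n ∸ k) → 0# < α n → suc k ℕ.≤ n → ∣ g (suc k) n ∣ ≤ ε * ∣ g k n ∣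
        bound n p 0<αn k<n = begin
          ∣ g (suc k) n ∣                                ≈⟨ ∣g∣≈ (suc k) n k<n 0<αn ⟩
          !⁻¹ (suc k) * (α (n ∸ suc k) / α n)            ≤⟨ *-monoˡ-≤ (<⇒≤ (0<!⁻¹ (suc k))) (*-monoʳ-≤ (<⇒≤ (⁻¹-positive 0<αn)) p) ⟩
          !⁻¹ (suc k) * (ε * (F * !⁻¹ k) * α (n ∸ k) / α n)
            ≈⟨ solve 6 (λ J ε F I α A → J :* (ε :* (F :* I) :* α :* A) := (F :* J) :* (ε :* (I :* (α :* A)))) ≈-refl
                 (!⁻¹ (suc k)) ε F (!⁻¹ k) (α (n ∸ k)) (α n ⁻¹) ⟩
          F * !⁻¹ (suc k) * (ε * (!⁻¹ k * (α (n ∸ k) / α n)))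
            ≈⟨ ≈-trans (*-congʳ (⁻¹-inverse (n!≉0 (suc k)))) (*-identityˡ _) ⟩
          ε * (!⁻¹ k * (α (n ∸ k) / α n))                ≈⟨ *-congˡ (∣g∣≈ k n (ℕ.<⇒≤ k<n) 0<αn) ⟨
          ε * ∣ g k n ∣                                  ∎
          where open ≤-Reasoning

    expansion : ∀ m → Expansion (x m) (d m) g
    expansion m = record
      { error      = error-bound m
      ; scale      = scale-bound m
      ; error-term = λ r d≉0 → =O-coefficient {d m} {g} (suc r) d≉0 (error-bound m r)
      ; terms      = λ k d≉0 → =o-coefficients {d m} {g} k d≉0 (scale-bound m k)
      }


theorem3p1 : ∀ {c ℓ₁ ℓ₂} (K : ArchimedeanOrderedField c ℓ₁ ℓ₂) →
    let open ArchimedeanOrderedField K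
        open Asymptotics K
        open WeightedSpecies K
    in (𝒜 ℬ : Species) →
       (FinSet.Carrier (ℬ [ ⟦ 0 ⟧ ]) → ⊥) →
       (φ : 𝒜 ≃ ℰ ∘ˢ ℬ) →
       Positive 𝒜 →
       GargantuanSpecies 𝒜 →
       (m : ℕ) →
       Expansion (λ n → ℙ 𝒜 n (hasComponents? 𝒜 ℬ φ m ⟦ n ⟧))
                 (λ k → ∣ 𝒟 ℬ m [ k ]∣ᵛ)
                 (λ k n → fromℕ (n C k) * (∣ 𝒜 [ n ∸ k ]∣ʷ / ∣ 𝒜 [ n ]∣ʷ))
theorem3p1 K = Assemblies.expansion K
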